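{- Let $p$ be a prime with $p\equiv1\pmod4$, and write $p=a^2+b^2$ with $a,b\in\mathbb Z$ and $a\equiv1\pmod4$. Then $$\sum_{k=0}^{\frac{p-1}2}\frac{\binom{2k}k^2}{8^k}\equiv\sum_{k=0}^{\frac{p-1}2}\frac{\binom{2k}k^2}{(-16)^k}\equiv P_{\frac{p-1}2}(3)\equiv(-1)^{\frac{p-1}4}\Big(2a-\frac p{2a}\Big)\pmod{p^2}.$$
   Context: Congruences are between rational numbers whose denominators are prime to $p$. $P_n(x)$ is the $n$-th Legendre polynomial, defined by $\frac1{\sqrt{1-2xt+t^2}}=\sum_{n\ge0}P_n(x)t^n$, equivalently $P_n(x)=\frac1{2^n}\sum_{k=0}^{[n/2]}\frac{(-1)^k(2n-2k)!}{k!(n-k)!(n-2k)!}x^{n-2k}$. -}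

module Defs where

open import Data.Nat.Base as ℕ using (ℕ; zero; suc; _!; _∸_; ⌊_/2⌋)
import Data.Nat.Properties as ℕ
open import Data.Nat.Coprimality as Coprime using (Coprime)
open import Data.Integer.Base as ℤ using (ℤ; +_; -[1+_])
import Data.Integer.Properties as ℤ
open import Data.Integer.DivMod using (_%ℕ_)
open import Data.Rational.Base as ℚ using (ℚ; mkℚ; _÷_; ↧ₙ_)
import Data.Rational.Properties as ℚ
open import Data.Fin.Base using (toℕ)
open import Data.Product.Base using (∃-syntax; _×_)
open import Algebra.Definitions.RawSemiring ℚ.+-*-rawSemiring using (sum; _^_)
open import Relation.Binary.PropositionalEquality using (_≡_; sym; subst)

ι : ℤ → ℚ
ι i = i ℚ./ 1

ι≢0 : ∀ i .{{_ : ℤ.NonZero i}} → ℚ.NonZero (ι i)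
ι≢0 i = subst ℚ.NonZero (sym (ℚ.↥p/↧p≡p (reduced i))) (reduced≢0 i)
  where
  reduced : ℤ → ℚ
  reduced i = mkℚ i 0 (Coprime.sym (Coprime.1-coprimeTo ℤ.∣ i ∣))
  reduced≢0 : ∀ i .{{_ : ℤ.NonZero i}} → ℚ.NonZero (reduced i)
  reduced≢0 (+ suc _)  = _
  reduced≢0 -[1+ _ ] = _

-- The library's ℚ._/_ only takes denominators in ℕ.  This symbol is U+2215.
infixl 7 _∕_
_∕_ : (i j : ℤ) .{{_ : ℤ.NonZero j}} → ℚ
i ∕ j = (ι i ÷ ι j) {{ι≢0 j}}

i^n≢0 : ∀ i n .{{_ : ℤ.NonZero i}} → ℤ.NonZero (i ℤ.^ n)
i^n≢0 i zero    = _
i^n≢0 i (suc n) {{i≢0}} = ℤ.i*j≢0 i (i ℤ.^ n) {{i≢0}} {{i^n≢0 i n}}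

infixl 7 _∕[_^_]
_∕[_^_] : (i j : ℤ) (n : ℕ) .{{_ : ℤ.NonZero j}} → ℚ
i ∕[ j ^ n ] = (i ∕ (j ℤ.^ n)) {{i^n≢0 j n}}

%4≡1⇒2*≢0 : ∀ {a} → a %ℕ 4 ≡ 1 → ℤ.NonZero (+ 2 ℤ.* a)
%4≡1⇒2*≢0 {+ suc _}  _ = _
%4≡1⇒2*≢0 { -[1+ _ ]} _ = _

∑≤ : ℕ → (ℕ → ℚ) → ℚ
∑≤ n f = sum {suc n} (λ k → f (toℕ k))

infix 6 ∑≤
syntax ∑≤ n (λ k → e) = ∑[ k ≤ n ] e

-- Legendre polynomials as functions on ℚ, by the explicit formula
--   Pₙ(x) = 2⁻ⁿ Σ_{k ≤ ⌊n/2⌋} (-1)ᵏ (2n-2k)! / (k! (n-k)! (n-2k)!) x^{n-2k};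
-- every ∸ is exact for k ≤ ⌊n/2⌋.
P-denominator : ℕ → ℕ → ℕ
P-denominator n k = k ! ℕ.* (n ∸ k) ! ℕ.* (n ∸ 2 ℕ.* k) !

P-denominator≢0 : ∀ n k → ℕ.NonZero (P-denominator n k)
P-denominator≢0 n k =
  ℕ.m*n≢0 (k ! ℕ.* (n ∸ k) !) ((n ∸ 2 ℕ.* k) !)
    {{ℕ.m*n≢0 (k !) ((n ∸ k) !) {{k ℕ.!≢0}} {{(n ∸ k) ℕ.!≢0}}}}
    {{(n ∸ 2 ℕ.* k) ℕ.!≢0}}

P-coefficient : ℕ → ℕ → ℚ
P-coefficient n k =
  (ℤ.-1ℤ ℤ.^ k ℤ.* + ((2 ℕ.* n ∸ 2 ℕ.* k) !) ∕ + P-denominator n k)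
    {{P-denominator≢0 n k}}

P : ℕ → ℚ → ℚ
P n x = (+ 1 ∕[ + 2 ^ n ]) ℚ.*
  (∑[ k ≤ ⌊ n /2⌋ ] (P-coefficient n k ℚ.* x ^ (n ∸ 2 ℕ.* k)))

Integral : ℕ → ℚ → Set
Integral p x = Coprime (↧ₙ x) p

-- Congruence modulo p ^ r in the ring of rationals with denominator prime to p;
-- membership of both sides in that ring is part of the relation.
infix 4 _≅_[mod_^_]
_≅_[mod_^_] : ℚ → ℚ → ℕ → ℕ → Set
x ≅ y [mod p ^ r ] =
  Integral p x × Integral p y ×
  ∃[ z ] Integral p z × x ℚ.- y ≡ ι (+ (p ℕ.^ r)) ℚ.* z

{-# OPTIONS --safe #-}
-- Write p = 4m + 1, n = 2m and cₖ = C(2k,k)/4ᵏ.  Modulo p² the coefficients of Pₙ at 1 are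
-- C(n,k) C(n+k,k) ≡ (-1)ᵏ cₖ², so the two sums are Pₙ(-3) and Pₙ(3), which agree because n is even.
-- Since cₖ ≡ cₙ₋ₖ (mod p), Σ (-1)ᵏ (cₖ - cₙ₋ₖ)² ≡ 0 (mod p²); hence Pₙ(3) ≡ Σ (-1)ᵏ cₖ cₙ₋ₖ = cₘ =: X.
--
-- It remains to see that X + p/X ≡ 2A for A = (-1)ᵐ a.  On the one hand, 2A = -Σ χ(x³ - x) exactly:
-- Jacobsthal's identity S(1)² + S(g)² = 4p gives A = ±a by uniqueness of sums of two squares, and
-- multiplying the signs χ(x³ - x), x ≤ n, with Wilson's theorem gives A modulo 4.  On the other hand,
-- with z = xᵖ one has χ(x³ - x) ≡ (z³ - z)ⁿᵖ and (z² - 1)ᵖ ≡ z² - 1 + p Σ z²ⁱ/i (mod p²), so the sum over x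
-- reduces to power sums of Teichmüller representatives.  What is left are sums of (-1)ˢ C(n-1,s)/(m-s)
-- and (-1)ˢ C(n-1,s)/(3m-s) modulo p: the first turns C(2m,m) into X, the second is 1/X.
module Submission where

open import Defs
open import Data.Nat.Base as ℕ using (ℕ; zero; suc; _∸_; _!; _≤_; _<_; z≤n; s≤s; ⌊_/2⌋)
import Data.Nat.Properties as ℕ
open import Data.Nat.DivMod using (_/_; _%_; m*n/n≡m; m≡m%n+[m/n]*n)
open import Data.Nat.Primality using (Prime; euclidsLemma; prime⇒nonTrivial; prime⇒irreducible)
open import Data.Nat.Combinatorics using (_C_; nCk+nC[k+1]≡[n+1]C[k+1]; nCk≡nC[n∸k]; nCn≡1; k>n⇒nCk≡0)
import Data.Nat.Divisibility as ℕ
import Data.Nat.Coprimality as Coprime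
open import Data.Nat.Tactic.RingSolver using () renaming (solve-∀ to ℕ-solve-∀)
open import Data.Integer.Base as ℤ using (ℤ; +_; -[1+_]; -_; -1ℤ; _+_; _*_; _-_; _^_)
import Data.Integer.Properties as ℤ
open import Data.Integer.DivMod using (_%ℕ_; _/ℕ_; n%ℕd<d; a≡a%ℕn+[a/ℕn]*n)
import Data.Integer.Divisibility.Signed as Signed
open import Data.Integer.Tactic.RingSolver using (solve-∀)
open import Data.Rational.Base as ℚ using (ℚ; mkℚ; ↧ₙ_)
import Data.Rational.Properties as ℚ
open import Data.Rational.Unnormalised.Base as ℚᵘ using (mkℚᵘ)
import Data.Rational.Unnormalised.Properties as ℚᵘ
open import Data.Rational.Solver using (module +-*-Solver)
open import Algebra.Definitions.RawSemiring ℚ.+-*-rawSemiring using () renaming (_^_ to _^ℚ_)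
open import Data.Product.Base using (_×_; _,_; proj₁; proj₂; ∃)
open import Data.Sum.Base using (_⊎_; inj₁; inj₂; [_,_]′)
open import Function.Base using (id; _∘_; case_of_)
open import Relation.Nullary using (¬_; Dec; yes; no; contradiction; ¬?; _⊎-dec_; decidable-stable; toSum)
open import Relation.Binary.Bundles using (Setoid)
open import Relation.Binary.PropositionalEquality using (_≡_; _≢_; refl; sym; trans; cong; cong₂; subst; subst₂; module ≡-Reasoning)
import Relation.Binary.Reasoning.Setoid as SetoidReasoning

-- The obstacle is precision. Euler's criterion gives χ only modulo p, while Σ χ(x³ - x) must be
-- compared with X modulo p². The remedy: x ≡ y (mod p) implies xᵖ ≡ yᵖ (mod p²), and 0, 1, -1 are
-- their own p-th powers, so the criterion itself may be raised to the p-th power. The price is the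
-- expansion of (z² - 1)ᵖ, whose correction brings in harmonic sums, in essence the Fermat quotient
-- of 2. They are related to each other but never evaluated: X carries the odd harmonic sum `O m`
-- through 4ᵐ, the sum `U` carries the same one, and together they form a single X. Only `V` is left
-- over, and X V ≡ 1 is the origin of p/X. All of this happens in ℤ, with congruences modulo p and
-- p². A reciprocal is a fixed power `inv`, so expressions with denominators obey ordinary ring
-- identities; rationals enter only at the end, as fractions that represent residue classes modulo
-- p².

infix 4 _≈_⟨_⟩
-- The modulus is an arbitrary integer, so that p, p², 2, 4 and 0 share one set of lemmas. As a
-- record the relation lets x, y and M be inferred, and the explicit quotient reduces most proofs to
-- one ring identity.
record _≈_⟨_⟩ (x y M : ℤ) : Set where
  constructor by
  field
    quotient : ℤ
    equality : x ≡ y + quotient * M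

≈-reflexive : ∀ {M x y} → x ≡ y → x ≈ y ⟨ M ⟩
≈-reflexive {M} {x} refl = by (+ 0) (lemma x M)
  where
  lemma : ∀ x M → x ≡ x + + 0 * M
  lemma = solve-∀

≈-refl : ∀ {M x} → x ≈ x ⟨ M ⟩
≈-refl = ≈-reflexive refl

≈-sym : ∀ {M x y} → x ≈ y ⟨ M ⟩ → y ≈ x ⟨ M ⟩
≈-sym {M} {x} {y} (by q refl) = by (- q) (lemma y q M)
  where
  lemma : ∀ y q M → y ≡ y + q * M + - q * M
  lemma = solve-∀

≈-trans : ∀ {M x y z} → x ≈ y ⟨ M ⟩ → y ≈ z ⟨ M ⟩ → x ≈ z ⟨ M ⟩
≈-trans {M} {z = z} (by q refl) (by r refl) = by (q + r) (lemma z q r M)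
  where
  lemma : ∀ z q r M → z + r * M + q * M ≡ z + (q + r) * M
  lemma = solve-∀

≈-setoid : ℤ → Setoid _ _
≈-setoid M = record
  { Carrier = ℤ
  ; _≈_ = λ x y → x ≈ y ⟨ M ⟩
  ; isEquivalence = record { refl = ≈-refl ; sym = ≈-sym ; trans = ≈-trans }
  }

module ≈-Reasoning (M : ℤ) = SetoidReasoning (≈-setoid M)

-- Modulo 0 a congruence is an equality. Exact laws of finite sums such as `∑-cong` and `∑-single`
-- are thereby read off from their congruence versions.
≈0⇒≡ : ∀ {x y} → x ≈ y ⟨ + 0 ⟩ → x ≡ y
≈0⇒≡ {y = y} (by q refl) = lemma y q
  where
  lemma : ∀ y q → y + q * + 0 ≡ y
  lemma = solve-∀

+-≈ : ∀ {M x y u v} → x ≈ y ⟨ M ⟩ → u ≈ v ⟨ M ⟩ → x + u ≈ y + v ⟨ M ⟩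
+-≈ {M} {y = y} {v = v} (by q refl) (by r refl) = by (q + r) (lemma y v q r M)
  where
  lemma : ∀ y v q r M → y + q * M + (v + r * M) ≡ y + v + (q + r) * M
  lemma = solve-∀

*-≈ : ∀ {M x y u v} → x ≈ y ⟨ M ⟩ → u ≈ v ⟨ M ⟩ → x * u ≈ y * v ⟨ M ⟩
*-≈ {M} {y = y} {v = v} (by q refl) (by r refl) = by (q * v + y * r + q * r * M) (lemma y v q r M)
  where
  lemma : ∀ y v q r M → (y + q * M) * (v + r * M) ≡ y * v + (q * v + y * r + q * r * M) * M
  lemma = solve-∀

*-≈ˡ : ∀ {M u v} x → u ≈ v ⟨ M ⟩ → x * u ≈ x * v ⟨ M ⟩
*-≈ˡ x = *-≈ (≈-refl {x = x})

*-≈ʳ : ∀ {M u v} x → u ≈ v ⟨ M ⟩ → u * x ≈ v * x ⟨ M ⟩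
*-≈ʳ x u≈v = *-≈ u≈v ≈-refl

neg-≈ : ∀ {M x y} → x ≈ y ⟨ M ⟩ → - x ≈ - y ⟨ M ⟩
neg-≈ {M} {y = y} (by q refl) = by (- q) (lemma y q M)
  where
  lemma : ∀ y q M → - (y + q * M) ≡ - y + - q * M
  lemma = solve-∀

−-≈ : ∀ {M x y u v} → x ≈ y ⟨ M ⟩ → u ≈ v ⟨ M ⟩ → x - u ≈ y - v ⟨ M ⟩
−-≈ x≈y u≈v = +-≈ x≈y (neg-≈ u≈v)

+-≈ˡ : ∀ {M u v} x → u ≈ v ⟨ M ⟩ → x + u ≈ x + v ⟨ M ⟩
+-≈ˡ x = +-≈ (≈-refl {x = x})

−-≈ˡ : ∀ {M u v} x → u ≈ v ⟨ M ⟩ → x - u ≈ x - v ⟨ M ⟩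
−-≈ˡ x = −-≈ (≈-refl {x = x})

^-≈ : ∀ {M x y} k → x ≈ y ⟨ M ⟩ → x ^ k ≈ y ^ k ⟨ M ⟩
^-≈ zero x≈y = ≈-refl
^-≈ (suc k) x≈y = *-≈ x≈y (^-≈ k x≈y)

-- The passage from modulus p to modulus p²: a quantity multiplied by p need only be known modulo p.
*-≈-scale : ∀ {M x y} N → x ≈ y ⟨ M ⟩ → N * x ≈ N * y ⟨ N * M ⟩
*-≈-scale {M} {y = y} N (by q refl) = by q (lemma y q M N)
  where
  lemma : ∀ y q M N → N * (y + q * M) ≡ N * y + q * (N * M)
  lemma = solve-∀

≈-weaken : ∀ {M x y} N → x ≈ y ⟨ N * M ⟩ → x ≈ y ⟨ M ⟩
≈-weaken {M} {y = y} N (by q refl) = by (q * N) (lemma y q M N)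
  where
  lemma : ∀ y q M N → y + q * (N * M) ≡ y + q * N * M
  lemma = solve-∀

M≈0 : ∀ {M} → M ≈ + 0 ⟨ M ⟩
M≈0 {M} = by (+ 1) (lemma M)
  where
  lemma : ∀ M → M ≡ + 0 + + 1 * M
  lemma = solve-∀

M*≈0 : ∀ {M} x → M * x ≈ + 0 ⟨ M ⟩
M*≈0 {M} x = by x (lemma M x)
  where
  lemma : ∀ M x → M * x ≡ + 0 + x * M
  lemma = solve-∀

x≈y⇒x-y≈0 : ∀ {M x y} → x ≈ y ⟨ M ⟩ → x - y ≈ + 0 ⟨ M ⟩
x≈y⇒x-y≈0 {M} {y = y} (by q refl) = by q (lemma y q M)
  where
  lemma : ∀ y q M → y + q * M - y ≡ + 0 + q * M
  lemma = solve-∀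

x-y≈0⇒x≈y : ∀ {M x y} → x - y ≈ + 0 ⟨ M ⟩ → x ≈ y ⟨ M ⟩
x-y≈0⇒x≈y {M} {x} {y} (by q e) = by q (trans (lemma x y) (trans (cong (_+_ y) e) (lemma′ y q M)))
  where
  lemma : ∀ x y → x ≡ y + (x - y)
  lemma = solve-∀
  lemma′ : ∀ y q M → y + (+ 0 + q * M) ≡ y + q * M
  lemma′ = solve-∀

-- Finite sums over initial segments of ℕ

∑ : ℕ → (ℕ → ℤ) → ℤ
∑ zero f = + 0
∑ (suc n) f = ∑ n f + f n

∑-≈ : ∀ {M} n {f g : ℕ → ℤ} → (∀ i → i < n → f i ≈ g i ⟨ M ⟩) → ∑ n f ≈ ∑ n g ⟨ M ⟩
∑-≈ zero f≈g = ≈-refl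
∑-≈ (suc n) f≈g = +-≈ (∑-≈ n (λ i i<n → f≈g i (ℕ.m<n⇒m<1+n i<n))) (f≈g n (ℕ.n<1+n n))

∑-cong : ∀ n {f g : ℕ → ℤ} → (∀ i → i < n → f i ≡ g i) → ∑ n f ≡ ∑ n g
∑-cong n f≡g = ≈0⇒≡ (∑-≈ n (λ i i<n → ≈-reflexive (f≡g i i<n)))

∑-ext : ∀ n {f g : ℕ → ℤ} → (∀ i → f i ≡ g i) → ∑ n f ≡ ∑ n g
∑-ext n f≡g = ∑-cong n (λ i _ → f≡g i)

∑-+ : ∀ n (f g : ℕ → ℤ) → ∑ n (λ i → f i + g i) ≡ ∑ n f + ∑ n g
∑-+ zero f g = refl
∑-+ (suc n) f g = trans (cong (_+ (f n + g n)) (∑-+ n f g)) (lemma (∑ n f) (∑ n g) (f n) (g n))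
  where
  lemma : ∀ a b x y → a + b + (x + y) ≡ a + x + (b + y)
  lemma = solve-∀

∑-*ˡ : ∀ n c (f : ℕ → ℤ) → ∑ n (λ i → c * f i) ≡ c * ∑ n f
∑-*ˡ zero c f = sym (ℤ.*-zeroʳ c)
∑-*ˡ (suc n) c f = trans (cong (_+ c * f n) (∑-*ˡ n c f)) (sym (ℤ.*-distribˡ-+ c (∑ n f) (f n)))

∑-*ʳ : ∀ n c (f : ℕ → ℤ) → ∑ n (λ i → f i * c) ≡ ∑ n f * c
∑-*ʳ n c f = trans (∑-ext n (λ i → ℤ.*-comm (f i) c)) (trans (∑-*ˡ n c f) (ℤ.*-comm c (∑ n f)))

∑-neg : ∀ n (f : ℕ → ℤ) → ∑ n (λ i → - f i) ≡ - ∑ n f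
∑-neg zero f = refl
∑-neg (suc n) f = trans (cong (_+ - f n) (∑-neg n f)) (sym (ℤ.neg-distrib-+ (∑ n f) (f n)))

∑-− : ∀ n (f g : ℕ → ℤ) → ∑ n (λ i → f i - g i) ≡ ∑ n f - ∑ n g
∑-− n f g = trans (∑-+ n f (λ i → - g i)) (cong (_+_ (∑ n f)) (∑-neg n g))

∑-const : ∀ n c → ∑ n (λ _ → c) ≡ + n * c
∑-const zero c = sym (ℤ.*-zeroˡ c)
∑-const (suc n) c = trans (cong (_+ c) (∑-const n c)) (lemma (+ n) c)
  where
  lemma : ∀ n c → n * c + c ≡ (+ 1 + n) * c
  lemma = solve-∀

∑-≈0 : ∀ {M} n {f : ℕ → ℤ} → (∀ i → i < n → f i ≈ + 0 ⟨ M ⟩) → ∑ n f ≈ + 0 ⟨ M ⟩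
∑-≈0 n f≈0 = ≈-trans (∑-≈ n f≈0) (≈-reflexive (trans (∑-const n (+ 0)) (ℤ.*-zeroʳ (+ n))))

∑-≡0 : ∀ n {f : ℕ → ℤ} → (∀ i → i < n → f i ≡ + 0) → ∑ n f ≡ + 0
∑-≡0 n f≡0 = ≈0⇒≡ (∑-≈0 n (λ i i<n → ≈-reflexive (f≡0 i i<n)))

∑-swap : ∀ m n (f : ℕ → ℕ → ℤ) → ∑ m (λ i → ∑ n (f i)) ≡ ∑ n (λ j → ∑ m (λ i → f i j))
∑-swap zero n f = sym (∑-≡0 n (λ _ _ → refl))
∑-swap (suc m) n f = trans (cong (_+ ∑ n (f m)) (∑-swap m n f)) (sym (∑-+ n (λ j → ∑ m (λ i → f i j)) (f m)))

∑-head : ∀ n (f : ℕ → ℤ) → ∑ (suc n) f ≡ f 0 + ∑ n (f ∘ suc)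
∑-head zero f = ℤ.+-comm (+ 0) (f 0)
∑-head (suc n) f = trans (cong (_+ f (suc n)) (∑-head n f)) (ℤ.+-assoc (f 0) (∑ n (f ∘ suc)) (f (suc n)))

∑-split : ∀ m n (f : ℕ → ℤ) → ∑ (m ℕ.+ n) f ≡ ∑ m f + ∑ n (λ i → f (m ℕ.+ i))
∑-split m zero f = trans (cong (λ k → ∑ k f) (ℕ.+-identityʳ m)) (sym (ℤ.+-identityʳ (∑ m f)))
∑-split m (suc n) f = trans (cong (λ k → ∑ k f) (ℕ.+-suc m n))
  (trans (cong (_+ f (m ℕ.+ n)) (∑-split m n f)) (ℤ.+-assoc (∑ m f) _ (f (m ℕ.+ n))))

∑-reverse : ∀ n (f : ℕ → ℤ) → ∑ n f ≡ ∑ n (λ i → f (n ∸ suc i))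
∑-reverse zero f = refl
∑-reverse (suc n) f = begin
  ∑ n f + f n ≡⟨ cong (_+ f n) (∑-reverse n f) ⟩
  ∑ n (λ i → f (n ∸ suc i)) + f n ≡⟨ ℤ.+-comm _ (f n) ⟩
  f n + ∑ n (λ i → f (n ∸ suc i)) ≡⟨ ∑-head n (λ i → f (n ∸ i)) ⟨
  ∑ (suc n) (λ i → f (n ∸ i)) ∎
  where open ≡-Reasoning

∑-single-≈ : ∀ {M} n {f : ℕ → ℤ} k → k < n → (∀ i → i < n → i ≢ k → f i ≈ + 0 ⟨ M ⟩) → ∑ n f ≈ f k ⟨ M ⟩
∑-single-≈ {M} (suc n) {f} k k<1+n f≈0 with k ℕ.≟ n
... | yes refl = ≈-trans (+-≈ (∑-≈0 n (λ i i<n → f≈0 i (ℕ.m<n⇒m<1+n i<n) (ℕ.<⇒≢ i<n))) ≈-refl)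
    (≈-reflexive (ℤ.+-identityˡ (f n)))
... | no k≢n = ≈-trans (+-≈ (∑-single-≈ n k (ℕ.≤∧≢⇒< (ℕ.s≤s⁻¹ k<1+n) k≢n) (λ i i<n → f≈0 i (ℕ.m<n⇒m<1+n i<n)))
    (f≈0 n (ℕ.n<1+n n) (k≢n ∘ sym)))
    (≈-reflexive (ℤ.+-identityʳ (f k)))

∑-single : ∀ n {f : ℕ → ℤ} k → k < n → (∀ i → i < n → i ≢ k → f i ≡ + 0) → ∑ n f ≡ f k
∑-single n k k<n f≡0 = ≈0⇒≡ (∑-single-≈ n k k<n (λ i i<n i≢k → ≈-reflexive (f≡0 i i<n i≢k)))

2*suc : ∀ k → 2 ℕ.* suc k ≡ suc (suc (2 ℕ.* k))
2*suc = ℕ-solve-∀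

-- Binomial coefficients

opaque
  -- Opaque, so that binomials stay symbolic and are handled only through the laws of this block.
  -- Integer-valued, so that recurrences can use true subtraction.
  B : ℕ → ℕ → ℤ
  B n k = + (n C k)

  B≡C : ∀ n k → B n k ≡ + (n C k)
  B≡C n k = refl

  B-pascal : ∀ n k → B (suc n) (suc k) ≡ B n k + B n (suc k)
  B-pascal n k = cong +_ (sym (nCk+nC[k+1]≡[n+1]C[k+1] n k))

  B-zero : ∀ n → B n 0 ≡ + 1
  B-zero zero = refl
  B-zero (suc n) = cong +_ (trans (nCk≡nC[n∸k] {0} {suc n} z≤n) (nCn≡1 (suc n)))

  B-diag : ∀ n → B n n ≡ + 1
  B-diag n = cong +_ (nCn≡1 n)

  B-above : ∀ {n k} → n < k → B n k ≡ + 0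
  B-above n<k = cong +_ (k>n⇒nCk≡0 n<k)

  B-sym : ∀ {n k} → k ≤ n → B n k ≡ B n (n ∸ k)
  B-sym k≤n = cong +_ (nCk≡nC[n∸k] k≤n)

B-absorb : ∀ n k → + suc k * B (suc n) (suc k) ≡ + suc n * B n k
B-absorb zero zero = cong (_*_ (+ 1)) (trans (B-diag 1) (sym (B-diag 0)))
B-absorb zero (suc k) = trans (cong (+ suc (suc k) *_) (B-above {1} {suc (suc k)} (s≤s (s≤s z≤n))))
    (trans (ℤ.*-zeroʳ (+ suc (suc k))) (sym (cong (+ 1 *_) (B-above {0} {suc k} (s≤s z≤n)))))
B-absorb (suc n) zero = begin
  + 1 * B (suc (suc n)) 1 ≡⟨ ℤ.*-identityˡ _ ⟩
  B (suc (suc n)) 1 ≡⟨ B-pascal (suc n) 0 ⟩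
  B (suc n) 0 + B (suc n) 1 ≡⟨ cong (_+_ (B (suc n) 0)) (trans (sym (ℤ.*-identityˡ (B (suc n) 1))) (B-absorb n 0)) ⟩
  B (suc n) 0 + + suc n * B n 0 ≡⟨ cong₂ (λ u v → u + + suc n * v) (B-zero (suc n)) (B-zero n) ⟩
  + 1 + + suc n * + 1 ≡⟨ lemma (+ n) ⟩
  + suc (suc n) * + 1 ≡⟨ cong (+ suc (suc n) *_) (B-zero (suc n)) ⟨
  + suc (suc n) * B (suc n) 0 ∎
  where
  open ≡-Reasoning
  lemma : ∀ n → + 1 + (+ 1 + n) * + 1 ≡ (+ 2 + n) * + 1
  lemma = solve-∀
B-absorb (suc n) (suc k) = begin
  + suc (suc k) * B (suc (suc n)) (suc (suc k)) ≡⟨ cong (+ suc (suc k) *_) (B-pascal (suc n) (suc k)) ⟩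
  + suc (suc k) * (B (suc n) (suc k) + B (suc n) (suc (suc k))) ≡⟨ lemma (+ k) (B (suc n) (suc k)) (B (suc n) (suc (suc k))) ⟩
  B (suc n) (suc k) + (+ suc k * B (suc n) (suc k) + + suc (suc k) * B (suc n) (suc (suc k)))
      ≡⟨ cong₂ (λ u v → B (suc n) (suc k) + (u + v)) (B-absorb n k) (B-absorb n (suc k)) ⟩
  B (suc n) (suc k) + (+ suc n * B n k + + suc n * B n (suc k)) ≡⟨ cong (_+_ (B (suc n) (suc k))) (ℤ.*-distribˡ-+ (+ suc n) (B n k) (B n (suc k))) ⟨
  B (suc n) (suc k) + + suc n * (B n k + B n (suc k)) ≡⟨ cong (λ u → B (suc n) (suc k) + + suc n * u) (B-pascal n k) ⟨
  B (suc n) (suc k) + + suc n * B (suc n) (suc k) ≡⟨ lemma′ (+ n) (B (suc n) (suc k)) ⟩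
  + suc (suc n) * B (suc n) (suc k) ∎
  where
  open ≡-Reasoning
  lemma : ∀ k u v → (+ 2 + k) * (u + v) ≡ u + ((+ 1 + k) * u + (+ 2 + k) * v)
  lemma = solve-∀
  lemma′ : ∀ n u → u + (+ 1 + n) * u ≡ (+ 2 + n) * u
  lemma′ = solve-∀

-- The factor on the right is an integer difference instead of a truncated one: at k = n it
-- vanishes, and beyond that both coefficients do.
B-stepʳ : ∀ n k → + suc k * B n (suc k) ≡ (+ n - + k) * B n k
B-stepʳ n k = begin
  + suc k * B n (suc k) ≡⟨ lemma (+ k) (B n k) (B n (suc k)) ⟩
  + suc k * (B n k + B n (suc k)) - + suc k * B n k ≡⟨ cong (λ u → + suc k * u - + suc k * B n k) (B-pascal n k) ⟨
  + suc k * B (suc n) (suc k) - + suc k * B n k ≡⟨ cong (_- + suc k * B n k) (B-absorb n k) ⟩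
  + suc n * B n k - + suc k * B n k ≡⟨ lemma′ (+ n) (+ k) (B n k) ⟩
  (+ n - + k) * B n k ∎
  where
  open ≡-Reasoning
  lemma : ∀ k u v → (+ 1 + k) * v ≡ (+ 1 + k) * (u + v) - (+ 1 + k) * u
  lemma = solve-∀
  lemma′ : ∀ n k u → (+ 1 + n) * u - (+ 1 + k) * u ≡ (n - k) * u
  lemma′ = solve-∀

B-stepˡ : ∀ n k → (+ suc n - + k) * B (suc n) k ≡ + suc n * B n k
B-stepˡ n zero = trans (cong ((+ suc n - + 0) *_) (B-zero (suc n)))
    (trans (cong (_* + 1) (ℤ.+-identityʳ (+ suc n))) (cong (+ suc n *_) (sym (B-zero n))))
B-stepˡ n (suc k) = begin
  (+ suc n - + suc k) * B (suc n) (suc k) ≡⟨ cong ((+ suc n - + suc k) *_) (B-pascal n k) ⟩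
  (+ suc n - + suc k) * (B n k + B n (suc k)) ≡⟨ lemma (+ n) (+ k) (B n k) (B n (suc k)) ⟩
  (+ n - + k) * B n k + (+ n - + k) * B n (suc k) ≡⟨ cong (_+ (+ n - + k) * B n (suc k)) (B-stepʳ n k) ⟨
  + suc k * B n (suc k) + (+ n - + k) * B n (suc k) ≡⟨ lemma′ (+ n) (+ k) (B n (suc k)) ⟩
  + suc n * B n (suc k) ∎
  where
  open ≡-Reasoning
  lemma : ∀ n k u v → (+ 1 + n - (+ 1 + k)) * (u + v) ≡ (n - k) * u + (n - k) * v
  lemma = solve-∀
  lemma′ : ∀ n k v → (+ 1 + k) * v + (n - k) * v ≡ (+ 1 + n) * v
  lemma′ = solve-∀

B*!*! : ∀ k l → B (k ℕ.+ l) k * (+ (k !) * + (l !)) ≡ + ((k ℕ.+ l) !)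
B*!*! zero l = trans (cong (_* (+ 1 * + (l !))) (B-zero l)) (trans (ℤ.*-identityˡ _) (ℤ.*-identityˡ _))
B*!*! (suc k) l = begin
  B (suc k ℕ.+ l) (suc k) * (+ (suc k !) * + (l !)) ≡⟨ cong (λ x → B (suc k ℕ.+ l) (suc k) * (x * + (l !))) (ℤ.pos-* (suc k) (k !)) ⟩
  B (suc k ℕ.+ l) (suc k) * (+ suc k * + (k !) * + (l !)) ≡⟨ lemma (B (suc k ℕ.+ l) (suc k)) (+ suc k) (+ (k !)) (+ (l !)) ⟩
  + suc k * B (suc k ℕ.+ l) (suc k) * (+ (k !) * + (l !)) ≡⟨ cong (_* (+ (k !) * + (l !))) (B-absorb (k ℕ.+ l) k) ⟩
  + suc (k ℕ.+ l) * B (k ℕ.+ l) k * (+ (k !) * + (l !)) ≡⟨ ℤ.*-assoc (+ suc (k ℕ.+ l)) (B (k ℕ.+ l) k) (+ (k !) * + (l !)) ⟩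
  + suc (k ℕ.+ l) * (B (k ℕ.+ l) k * (+ (k !) * + (l !))) ≡⟨ cong (_*_ (+ suc (k ℕ.+ l))) (B*!*! k l) ⟩
  + suc (k ℕ.+ l) * + ((k ℕ.+ l) !) ≡⟨ ℤ.pos-* (suc (k ℕ.+ l)) ((k ℕ.+ l) !) ⟨
  + (suc (k ℕ.+ l) !) ∎
  where
  open ≡-Reasoning
  lemma : ∀ b s k l → b * (s * k * l) ≡ s * b * (k * l)
  lemma = solve-∀

binomial-theorem : ∀ n x → (x + + 1) ^ n ≡ ∑ (suc n) (λ k → B n k * x ^ k)
binomial-theorem zero x = sym (trans (ℤ.+-identityˡ (B 0 0 * + 1)) (cong (_* + 1) (B-zero 0)))
binomial-theorem (suc n) x = begin
  (x + + 1) * (x + + 1) ^ n ≡⟨ cong ((x + + 1) *_) (binomial-theorem n x) ⟩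
  (x + + 1) * ∑ (suc n) (λ k → B n k * x ^ k) ≡⟨ lemma x (∑ (suc n) (λ k → B n k * x ^ k)) ⟩
  x * ∑ (suc n) (λ k → B n k * x ^ k) + ∑ (suc n) (λ k → B n k * x ^ k)
    ≡⟨ cong₂ _+_ (trans (sym (∑-*ˡ (suc n) x (λ k → B n k * x ^ k))) (∑-ext (suc n) (λ k → lemma′ x (B n k) (x ^ k))))
        (trans (sym (ℤ.+-identityʳ _)) (trans (cong (_+_ (∑ (suc n) (λ k → B n k * x ^ k))) (sym (cong (_* x ^ suc n) (B-above (ℕ.n<1+n n))))) (∑-head (suc n) (λ k → B n k * x ^ k)))) ⟩
  ∑ (suc n) (λ k → B n k * x ^ suc k) + (B n 0 * + 1 + ∑ (suc n) (λ k → B n (suc k) * x ^ suc k))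
    ≡⟨ lemma″ (∑ (suc n) (λ k → B n k * x ^ suc k)) (B n 0 * + 1) _ ⟩
  B n 0 * + 1 + (∑ (suc n) (λ k → B n k * x ^ suc k) + ∑ (suc n) (λ k → B n (suc k) * x ^ suc k))
    ≡⟨ cong₂ (λ u v → u * + 1 + v) (trans (B-zero n) (sym (B-zero (suc n))))
             (trans (sym (∑-+ (suc n) (λ k → B n k * x ^ suc k) (λ k → B n (suc k) * x ^ suc k)))
                 (∑-ext (suc n) (λ k → trans (sym (ℤ.*-distribʳ-+ (x ^ suc k) (B n k) (B n (suc k)))) (cong (_* x ^ suc k) (sym (B-pascal n k)))))) ⟩
  B (suc n) 0 * + 1 + ∑ (suc n) (λ k → B (suc n) (suc k) * x ^ suc k) ≡⟨ ∑-head (suc n) (λ k → B (suc n) k * x ^ k) ⟨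
  ∑ (suc (suc n)) (λ k → B (suc n) k * x ^ k) ∎
  where
  open ≡-Reasoning
  lemma : ∀ x s → (x + + 1) * s ≡ x * s + s
  lemma = solve-∀
  lemma′ : ∀ x b y → x * (b * y) ≡ b * (x * y)
  lemma′ = solve-∀
  lemma″ : ∀ a b c → a + (b + c) ≡ b + (a + c)
  lemma″ = solve-∀

^-distribʳ-* : ∀ x y k → (x * y) ^ k ≡ x ^ k * y ^ k
^-distribʳ-* x y zero = refl
^-distribʳ-* x y (suc k) = trans (cong (_*_ (x * y)) (^-distribʳ-* x y k)) (lemma x y (x ^ k) (y ^ k))
  where
  lemma : ∀ x y u v → x * y * (u * v) ≡ x * u * (y * v)
  lemma = solve-∀

-1^2*k≡1 : ∀ k → -1ℤ ^ (2 ℕ.* k) ≡ + 1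
-1^2*k≡1 k = trans (sym (ℤ.^-*-assoc -1ℤ 2 k)) (ℤ.^-zeroˡ k)

-1^k*-1^k≡1 : ∀ k → -1ℤ ^ k * -1ℤ ^ k ≡ + 1
-1^k*-1^k≡1 k = trans (sym (^-distribʳ-* -1ℤ -1ℤ k)) (ℤ.^-zeroˡ k)

-- Taylor expansion to first order, with exponent `suc k` so that the derivative has exponent k. It
-- lifts congruences to p² in `^-lift` and isolates the term with `R` in `χ≈teichmüller`.
^-linearise : ∀ P u v k → (u + P * v) ^ suc k ≈ u ^ suc k + + suc k * (P * (u ^ k * v)) ⟨ P * P ⟩
^-linearise P u v zero = ≈-reflexive (lemma u P v)
  where
  lemma : ∀ u P v → (u + P * v) * + 1 ≡ u * + 1 + + 1 * (P * (+ 1 * v))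
  lemma = solve-∀
^-linearise P u v (suc k) = ≈-trans (*-≈ˡ (u + P * v) (^-linearise P u v k))
    (by (+ suc k * (u ^ k * (v * v))) (lemma u P v (u ^ k) (+ k)))
  where
  lemma : ∀ u P v w k → (u + P * v) * (u * w + (+ 1 + k) * (P * (w * v)))
      ≡ u * (u * w) + (+ 2 + k) * (P * (u * w * v)) + (+ 1 + k) * (w * (v * v)) * (P * P)
  lemma = solve-∀

-- Finite differences of powers: r < N gives 0, r = N gives (-1)ᴺ N!

private
  -- The shift c is there for the induction: absorbing a factor k into the binomial coefficient
  -- renames k to k + 1, which replaces c by 1 + c.
  alternating : ℕ → ℕ → ℤ → ℤ
  alternating N r c = ∑ (suc N) (λ k → B N k * -1ℤ ^ k * (+ k + c) ^ r)

  alternating-suc : ∀ N r c → alternating (suc N) (suc r) c ≡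
      c * alternating (suc N) r c - + suc N * alternating N r (+ 1 + c)
  alternating-suc N r c = begin
    alternating (suc N) (suc r) c
      ≡⟨ ∑-ext (suc (suc N)) (λ k → split (B (suc N) k) (-1ℤ ^ k) (+ k) c ((+ k + c) ^ r)) ⟩
    ∑ (suc (suc N)) (λ k → c * (B (suc N) k * -1ℤ ^ k * (+ k + c) ^ r) + + k * B (suc N) k * (-1ℤ ^ k * (+ k + c) ^ r))
      ≡⟨ ∑-+ (suc (suc N)) _ _ ⟩
    ∑ (suc (suc N)) (λ k → c * (B (suc N) k * -1ℤ ^ k * (+ k + c) ^ r)) + ∑ (suc (suc N)) (λ k → + k * B (suc N) k * (-1ℤ ^ k * (+ k + c) ^ r))
      ≡⟨ cong₂ _+_ (∑-*ˡ (suc (suc N)) c _) (trans (∑-head (suc N) (λ k → + k * B (suc N) k * (-1ℤ ^ k * (+ k + c) ^ r)))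
          (trans (cong (_+ ∑ (suc N) g) (zeroes (B (suc N) 0) (-1ℤ ^ 0 * (+ 0 + c) ^ r))) (ℤ.+-identityˡ _))) ⟩
    c * alternating (suc N) r c + ∑ (suc N) g
      ≡⟨ cong (_+_ (c * alternating (suc N) r c)) (trans (∑-ext (suc N) shift) (trans (∑-neg (suc N) _) (cong -_ (∑-*ˡ (suc N) (+ suc N) _)))) ⟩
    c * alternating (suc N) r c - + suc N * alternating N r (+ 1 + c) ∎
    where
    open ≡-Reasoning
    g : ℕ → ℤ
    g k = + suc k * B (suc N) (suc k) * (-1ℤ ^ suc k * (+ suc k + c) ^ r)
    split : ∀ b s k c w → b * s * ((k + c) * w) ≡ c * (b * s * w) + k * b * (s * w)
    split = solve-∀
    zeroes : ∀ b w → + 0 * b * w ≡ + 0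
    zeroes = solve-∀
    rearrange : ∀ n b s w → n * b * (-1ℤ * s * w) ≡ - (n * (b * s * w))
    rearrange = solve-∀
    reassociate : ∀ k c → + 1 + k + c ≡ k + (+ 1 + c)
    reassociate = solve-∀
    shift : ∀ k → g k ≡ - (+ suc N * (B N k * -1ℤ ^ k * (+ k + (+ 1 + c)) ^ r))
    shift k = trans (cong₂ (λ u v → u * (-1ℤ ^ suc k * v ^ r)) (B-absorb N k) (reassociate (+ k) c))
        (rearrange (+ suc N) (B N k) (-1ℤ ^ k) ((+ k + (+ 1 + c)) ^ r))

  alternating-zero : ∀ N c → alternating (suc N) 0 c ≡ + 0
  alternating-zero N c = trans (∑-ext (suc (suc N)) (λ k → ℤ.*-identityʳ (B (suc N) k * -1ℤ ^ k)))
      (trans (sym (binomial-theorem (suc N) -1ℤ)) (ℤ.*-zeroˡ ((+ 0) ^ N)))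

  alternating-vanish : ∀ N r c → r < N → alternating N r c ≡ + 0
  alternating-vanish (suc N) zero c _ = alternating-zero N c
  alternating-vanish (suc N) (suc r) c (s≤s r<N) = trans (alternating-suc N r c)
    (trans (cong₂ (λ u v → c * u - + suc N * v) (alternating-vanish (suc N) r c (ℕ.m<n⇒m<1+n r<N)) (alternating-vanish N r (+ 1 + c) r<N))
           (lemma c (+ suc N)))
    where
    lemma : ∀ c n → c * + 0 - n * + 0 ≡ + 0
    lemma = solve-∀

  alternating-top : ∀ N c → alternating N N c ≡ -1ℤ ^ N * + (N !)
  alternating-top zero c = trans (ℤ.+-identityˡ (B 0 0 * + 1 * + 1)) (cong (λ u → u * + 1 * + 1) (B-zero 0))
  alternating-top (suc N) c = trans (alternating-suc N N c)
    (trans (cong₂ (λ u v → c * u - + suc N * v) (alternating-vanish (suc N) N c (ℕ.n<1+n N)) (alternating-top N (+ 1 + c)))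
           (trans (lemma c (+ suc N) (-1ℤ ^ N) (+ (N !))) (cong (_*_ (-1ℤ ^ suc N)) (sym (ℤ.pos-* (suc N) (N !))))))
    where
    lemma : ∀ c n s f → c * + 0 - n * (s * f) ≡ -1ℤ * s * (n * f)
    lemma = solve-∀

∑-B-vanish : ∀ N r → r < N → ∑ (suc N) (λ k → B N k * -1ℤ ^ k * (+ k) ^ r) ≡ + 0
∑-B-vanish N r r<N = trans (∑-ext (suc N) (λ k → cong (λ u → B N k * -1ℤ ^ k * u ^ r) (sym (ℤ.+-identityʳ (+ k))))) (alternating-vanish N r (+ 0) r<N)

∑-B-top : ∀ N → ∑ (suc N) (λ k → B N k * -1ℤ ^ k * (+ k) ^ N) ≡ -1ℤ ^ N * + (N !)
∑-B-top N = trans (∑-ext (suc N) (λ k → cong (λ u → B N k * -1ℤ ^ k * u ^ N) (sym (ℤ.+-identityʳ (+ k))))) (alternating-top N (+ 0))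

-- Arithmetic modulo a prime p and modulo p²

module ModPrime (q : ℕ) (p-prime : Prime (suc q)) where

  p : ℕ
  p = suc q

  q>0 : 0 < q
  q>0 = ℕ.s≤s⁻¹ (ℕ.nonTrivial⇒n>1 p {{prime⇒nonTrivial p-prime}})

  ≈0⇒∣ : ∀ {x} → x ≈ + 0 ⟨ + p ⟩ → p ℕ.∣ ℤ.∣ x ∣
  ≈0⇒∣ (by k x≡0+kp) = Signed.∣⇒∣ᵤ (Signed.divides k (trans x≡0+kp (ℤ.+-identityˡ (k * + p))))

  ∣⇒≈0 : ∀ {x} → p ℕ.∣ ℤ.∣ x ∣ → x ≈ + 0 ⟨ + p ⟩
  ∣⇒≈0 p∣x with Signed.∣ᵤ⇒∣ {+ p} p∣x
  ... | Signed.divides k x≡kp = by k (trans x≡kp (sym (ℤ.+-identityˡ (k * + p))))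

  infix 4 _≈?_
  _≈?_ : ∀ x y → Dec (x ≈ y ⟨ + p ⟩)
  x ≈? y with p ℕ.∣? ℤ.∣ x - y ∣
  ... | yes p∣x-y = yes (x-y≈0⇒x≈y (∣⇒≈0 p∣x-y))
  ... | no p∤x-y = no (p∤x-y ∘ ≈0⇒∣ ∘ x≈y⇒x-y≈0)

  Unit : ℤ → Set
  Unit x = ¬ x ≈ + 0 ⟨ + p ⟩

  x*y≈0⇒x≈0∨y≈0 : ∀ x y → x * y ≈ + 0 ⟨ + p ⟩ → x ≈ + 0 ⟨ + p ⟩ ⊎ y ≈ + 0 ⟨ + p ⟩
  x*y≈0⇒x≈0∨y≈0 x y xy≈0 with euclidsLemma ℤ.∣ x ∣ ℤ.∣ y ∣ p-prime (subst (p ℕ.∣_) (ℤ.abs-* x y) (≈0⇒∣ xy≈0))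
  ... | inj₁ p∣x = inj₁ (∣⇒≈0 p∣x)
  ... | inj₂ p∣y = inj₂ (∣⇒≈0 p∣y)

  Unit-* : ∀ {x y} → Unit x → Unit y → Unit (x * y)
  Unit-* {x} {y} x≉0 y≉0 xy≈0 = [ x≉0 , y≉0 ]′ (x*y≈0⇒x≈0∨y≈0 x y xy≈0)

  Unit-≈ : ∀ {x y} → x ≈ y ⟨ + p ⟩ → Unit x → Unit y
  Unit-≈ x≈y x≉0 y≈0 = x≉0 (≈-trans x≈y y≈0)

  Unit-pos : ∀ k → 0 < k → k < p → Unit (+ k)
  Unit-pos (suc k) _ k<p k≈0 = ℕ.>⇒∤ k<p (≈0⇒∣ k≈0)

  Unit-1 : Unit (+ 1)
  Unit-1 = Unit-pos 1 (s≤s z≤n) (s≤s q>0)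

  Unit-^ : ∀ {x} k → Unit x → Unit (x ^ k)
  Unit-^ zero x≉0 = Unit-1
  Unit-^ (suc k) x≉0 = Unit-* x≉0 (Unit-^ k x≉0)

  Unit-*ˡ : ∀ x y → Unit (x * y) → Unit x
  Unit-*ˡ x y xy≉0 x≈0 = xy≉0 (≈-trans (*-≈ʳ y x≈0) (≈-reflexive (ℤ.*-zeroˡ y)))

  Unit-*ʳ : ∀ x y → Unit (x * y) → Unit y
  Unit-*ʳ x y xy≉0 = Unit-*ˡ y x (subst Unit (ℤ.*-comm x y) xy≉0)

  Unit-! : ∀ k → k < p → Unit (+ (k !))
  Unit-! zero _ = Unit-1
  Unit-! (suc k) k<q = subst Unit (sym (ℤ.pos-* (suc k) (k !))) (Unit-* (Unit-pos (suc k) (s≤s z≤n) k<q) (Unit-! k (ℕ.m<n⇒m<1+n (ℕ.s≤s⁻¹ k<q))))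

  *-cancelˡ-≈p : ∀ {x y} k → Unit k → k * x ≈ k * y ⟨ + p ⟩ → x ≈ y ⟨ + p ⟩
  *-cancelˡ-≈p {x} {y} k k≉0 kx≈ky =
    [ (λ k≈0 → contradiction k≈0 k≉0) , x-y≈0⇒x≈y ]′
      (x*y≈0⇒x≈0∨y≈0 k (x - y) (≈-trans (≈-reflexive (lemma k x y)) (x≈y⇒x-y≈0 kx≈ky)))
    where
    lemma : ∀ k x y → k * (x - y) ≡ k * x - k * y
    lemma = solve-∀

  B-p≈0 : ∀ k → suc k < p → B p (suc k) ≈ + 0 ⟨ + p ⟩
  B-p≈0 k 1+k<p = *-cancelˡ-≈p (+ suc k) (Unit-pos (suc k) (s≤s z≤n) 1+k<p)
    (≈-trans (≈-reflexive (B-absorb q k)) (≈-trans (M*≈0 (B q k)) (≈-reflexive (sym (ℤ.*-zeroʳ (+ suc k))))))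

  frobenius : ∀ x → (x + + 1) ^ p ≈ x ^ p + + 1 ⟨ + p ⟩
  frobenius x = begin
    (x + + 1) ^ p ≡⟨ binomial-theorem p x ⟩
    ∑ (suc p) (λ k → B p k * x ^ k) ≡⟨⟩
    ∑ (suc q) (λ k → B p k * x ^ k) + B p p * x ^ p ≡⟨ cong (_+ B p p * x ^ p) (∑-head q (λ k → B p k * x ^ k)) ⟩
    B p 0 * + 1 + ∑ q (λ k → B p (suc k) * x ^ suc k) + B p p * x ^ p
      ≈⟨ +-≈ (+-≈ˡ (B p 0 * + 1) (∑-≈0 q (λ k k<q → ≈-trans (*-≈ʳ (x ^ suc k) (B-p≈0 k (s≤s k<q))) (≈-reflexive (ℤ.*-zeroˡ (x ^ suc k)))))) (≈-refl {x = B p p * x ^ p}) ⟩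
    B p 0 * + 1 + + 0 + B p p * x ^ p ≡⟨ cong₂ (λ u v → u * + 1 + + 0 + v * x ^ p) (B-zero p) (B-diag p) ⟩
    + 1 * + 1 + + 0 + + 1 * x ^ p ≡⟨ lemma (x ^ p) ⟩
    x ^ p + + 1 ∎
    where
    open ≈-Reasoning (+ p)
    lemma : ∀ y → + 1 * + 1 + + 0 + + 1 * y ≡ y + + 1
    lemma = solve-∀

  residue : ℤ → ℕ
  residue x = x %ℕ p

  x≈residue : ∀ x → x ≈ + residue x ⟨ + p ⟩
  x≈residue x = by (x /ℕ p) (a≡a%ℕn+[a/ℕn]*n x p)

  fermat : ∀ x → x ^ p ≈ x ⟨ + p ⟩
  fermat x = ≈-trans (^-≈ p (x≈residue x)) (≈-trans (fermat-pos (residue x)) (≈-sym (x≈residue x)))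
    where
    fermat-pos : ∀ k → (+ k) ^ p ≈ + k ⟨ + p ⟩
    fermat-pos zero = ≈-reflexive (ℤ.*-zeroˡ ((+ 0) ^ q))
    fermat-pos (suc k) = subst (λ u → u ^ p ≈ u ⟨ + p ⟩) (ℤ.+-comm (+ k) (+ 1)) (≈-trans (frobenius (+ k)) (+-≈ (fermat-pos k) ≈-refl))

  fermat-unit : ∀ {x} → Unit x → x ^ q ≈ + 1 ⟨ + p ⟩
  fermat-unit {x} x≉0 = *-cancelˡ-≈p x x≉0 (≈-trans (fermat x) (≈-reflexive (sym (ℤ.*-identityʳ x))))

  -- For x = y + p k the linear term of xᵖ is p · yᵖ⁻¹ · p k, with a second factor p. Hence the
  -- class of xᵖ modulo p² depends only on x modulo p.
  ^-lift : ∀ {x y} → x ≈ y ⟨ + p ⟩ → x ^ p ≈ y ^ p ⟨ + p * + p ⟩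
  ^-lift {x} {y} (by k refl) = ≈-trans (≈-reflexive (cong (_^ p) (cong (_+_ y) (ℤ.*-comm k (+ p)))))
    (≈-trans (^-linearise (+ p) y k q) (by (y ^ q * k) (lemma (+ p) (y ^ p) (y ^ q * k))))
    where
    lemma : ∀ P a b → a + P * (P * b) ≡ a + b * (P * P)
    lemma = solve-∀

  exponent : ℕ
  exponent = ℕ.pred (q ℕ.* p)

  suc-exponent : suc exponent ≡ q ℕ.* p
  suc-exponent = ℕ.suc-pred (q ℕ.* p) {{ℕ.>-nonZero (ℕ.*-mono-< q>0 (s≤s z≤n))}}

  -- The exponent is φ(p²) - 1, so by Euler's theorem this inverts units modulo p². Being a power,
  -- it is total, exactly multiplicative and compatible with congruences to any modulus.
  inv : ℤ → ℤ
  inv x = x ^ exponent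

  inv-≈ : ∀ {M x y} → x ≈ y ⟨ M ⟩ → inv x ≈ inv y ⟨ M ⟩
  inv-≈ = ^-≈ exponent

  inv-* : ∀ x y → inv (x * y) ≡ inv x * inv y
  inv-* x y = ^-distribʳ-* x y exponent

  x*inv[x]≈1 : ∀ {x} → Unit x → x * inv x ≈ + 1 ⟨ + p * + p ⟩
  x*inv[x]≈1 {x} x≉0 = begin
    x ^ suc exponent ≡⟨ cong (x ^_) suc-exponent ⟩
    x ^ (q ℕ.* p) ≡⟨ ℤ.^-*-assoc x q p ⟨
    (x ^ q) ^ p ≈⟨ ^-lift (fermat-unit x≉0) ⟩
    (+ 1) ^ p ≡⟨ ℤ.^-zeroˡ p ⟩
    + 1 ∎
    where open ≈-Reasoning (+ p * + p)

  x*inv[x]≈1p : ∀ {x} → Unit x → x * inv x ≈ + 1 ⟨ + p ⟩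
  x*inv[x]≈1p x≉0 = ≈-weaken (+ p) (x*inv[x]≈1 x≉0)

  *-cancelˡ-≈ : ∀ {x y} k → Unit k → k * x ≈ k * y ⟨ + p * + p ⟩ → x ≈ y ⟨ + p * + p ⟩
  *-cancelˡ-≈ {x} {y} k k≉0 kx≈ky = begin
    x ≡⟨ ℤ.*-identityˡ x ⟨
    + 1 * x ≈⟨ *-≈ʳ x (x*inv[x]≈1 k≉0) ⟨
    k * inv k * x ≡⟨ lemma k (inv k) x ⟩
    inv k * (k * x) ≈⟨ *-≈ˡ (inv k) kx≈ky ⟩
    inv k * (k * y) ≡⟨ lemma k (inv k) y ⟨
    k * inv k * y ≈⟨ *-≈ʳ y (x*inv[x]≈1 k≉0) ⟩
    + 1 * y ≡⟨ ℤ.*-identityˡ y ⟩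
    y ∎
    where
    open ≈-Reasoning (+ p * + p)
    lemma : ∀ k l x → k * l * x ≡ l * (k * x)
    lemma = solve-∀

  inv-unique : ∀ {x y} → x * y ≈ + 1 ⟨ + p ⟩ → y ≈ inv x ⟨ + p ⟩
  inv-unique {x} {y} xy≈1 = *-cancelˡ-≈p x x≉0 (≈-trans xy≈1 (≈-sym (x*inv[x]≈1p x≉0)))
    where
    x≉0 : Unit x
    x≉0 = Unit-*ˡ x y (Unit-≈ (≈-sym xy≈1) Unit-1)

  inv-neg : ∀ {x} → Unit x → inv (- x) ≈ - inv x ⟨ + p ⟩
  inv-neg {x} x≉0 = ≈-sym (inv-unique (≈-trans (≈-reflexive (lemma x (inv x))) (x*inv[x]≈1p x≉0)))
    where
    lemma : ∀ x y → - x * - y ≡ x * y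
    lemma = solve-∀

  -- Each step multiplies the coefficient by (p - 1 - k)/(k + 1) ≡ -1. Inserting these weights turns
  -- a plain sum over all residues into a finite difference of order p - 1.
  B-q≈ : ∀ k → k < p → B q k * -1ℤ ^ k ≈ + 1 ⟨ + p ⟩
  B-q≈ zero _ = ≈-reflexive (cong (_* + 1) (B-zero q))
  B-q≈ (suc k) 1+k<p = *-cancelˡ-≈p (+ suc k) (Unit-pos (suc k) (s≤s z≤n) 1+k<p) (begin
    + suc k * (B q (suc k) * -1ℤ ^ suc k) ≡⟨ ℤ.*-assoc (+ suc k) (B q (suc k)) (-1ℤ ^ suc k) ⟨
    + suc k * B q (suc k) * -1ℤ ^ suc k ≡⟨ cong (_* -1ℤ ^ suc k) (B-stepʳ q k) ⟩
    (+ q - + k) * B q k * -1ℤ ^ suc k ≡⟨ lemma (+ q) (+ k) (B q k) (-1ℤ ^ k) ⟩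
    (+ suc k - + p) * (B q k * -1ℤ ^ k) ≈⟨ *-≈ (−-≈ˡ (+ suc k) M≈0) (B-q≈ k (ℕ.m<n⇒m<1+n (ℕ.s≤s⁻¹ 1+k<p))) ⟩
    (+ suc k - + 0) * + 1 ≡⟨ cong (_* + 1) (ℤ.+-identityʳ (+ suc k)) ⟩
    + suc k * + 1 ∎)
    where
    open ≈-Reasoning (+ p)
    lemma : ∀ q k b s → (q - k) * b * (-1ℤ * s) ≡ ((+ 1 + k) - (+ 1 + q)) * (b * s)
    lemma = solve-∀

  -- With the weights of `B-q≈` inserted, this is a q-th finite difference of a power below q. For r
  -- = 0 the term 0⁰ counts as 1, and the sum is p.
  power-sum-vanishes : ∀ r → r < q → ∑ p (λ x → (+ x) ^ r) ≈ + 0 ⟨ + p ⟩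
  power-sum-vanishes r r<q = ≈-trans (∑-≈ p (λ k k<p → ≈-trans (≈-reflexive (sym (ℤ.*-identityˡ ((+ k) ^ r)))) (*-≈ʳ ((+ k) ^ r) (≈-sym (B-q≈ k k<p)))))
      (≈-reflexive (∑-B-vanish q r r<q))

  ∑-units : ∀ (f : ℕ → ℤ) c {M} → f 0 ≈ + 0 ⟨ M ⟩ → (∀ k → 0 < k → k < p → f k ≈ c ⟨ M ⟩) → ∑ p f ≈ + q * c ⟨ M ⟩
  ∑-units f c {M} f0≈0 fk≈c = begin
    ∑ p f ≡⟨ ∑-head q f ⟩
    f 0 + ∑ q (f ∘ suc) ≈⟨ +-≈ f0≈0 (∑-≈ q (λ k k<q → fk≈c (suc k) (s≤s z≤n) (s≤s k<q))) ⟩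
    + 0 + ∑ q (λ _ → c) ≡⟨ trans (ℤ.+-identityˡ _) (∑-const q c) ⟩
    + q * c ∎
    where open ≈-Reasoning M

  q≈-1 : + q ≈ -1ℤ ⟨ + p ⟩
  q≈-1 = by (+ 1) (lemma (+ q))
    where
    lemma : ∀ q → q ≡ -1ℤ + + 1 * (+ 1 + q)
    lemma = solve-∀

  -- The q-th difference of x^q is q! up to sign; by `B-q≈` and Fermat it is also congruent to a sum
  -- of q ones.
  wilson : + (q !) ≈ -1ℤ ⟨ + p ⟩
  wilson = begin
    + (q !) ≡⟨ ℤ.*-identityˡ _ ⟨
    -- The sign (-1)^q is ≡ 1 by `B-q≈` at k = q, where the binomial is 1; this covers p = 2 as
    -- well.
    + 1 * + (q !) ≈⟨ *-≈ʳ (+ (q !)) (≈-trans (≈-reflexive (sym (ℤ.*-identityˡ (-1ℤ ^ q)))) (≈-trans (≈-reflexive (cong (_* -1ℤ ^ q) (sym (B-diag q)))) (B-q≈ q (ℕ.n<1+n q)))) ⟨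
    -1ℤ ^ q * + (q !) ≡⟨ ∑-B-top q ⟨
    ∑ p (λ k → B q k * -1ℤ ^ k * (+ k) ^ q) ≈⟨ ∑-units (λ k → B q k * -1ℤ ^ k * (+ k) ^ q) (+ 1)
        (≈-reflexive (trans (cong (_*_ (B q 0 * -1ℤ ^ 0)) (zero-^ q q>0)) (ℤ.*-zeroʳ (B q 0 * -1ℤ ^ 0))))
        (λ k k>0 k<p → *-≈ (B-q≈ k k<p) (fermat-unit (Unit-pos k k>0 k<p))) ⟩
    + q * + 1 ≡⟨ ℤ.*-identityʳ (+ q) ⟩
    + q ≈⟨ q≈-1 ⟩
    -1ℤ ∎
    where
    open ≈-Reasoning (+ p)
    zero-^ : ∀ n → 0 < n → (+ 0) ^ n ≡ + 0
    zero-^ (suc n) _ = ℤ.*-zeroˡ ((+ 0) ^ n)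

-- Sums over residue classes and power sums of Teichmüller representatives

indicator : ∀ {A : Set} → Dec A → ℤ
indicator (yes _) = + 1
indicator (no _) = + 0

indicator-yes : ∀ {A : Set} (A? : Dec A) → A → indicator A? ≡ + 1
indicator-yes (yes _) _ = refl
indicator-yes (no ¬a) a = contradiction a ¬a

indicator-no : ∀ {A : Set} (A? : Dec A) → ¬ A → indicator A? ≡ + 0
indicator-no (yes a) ¬a = contradiction a ¬a
indicator-no (no _) _ = refl

indicator-⇔ : ∀ {A B : Set} (A? : Dec A) (B? : Dec B) → (A → B) → (B → A) → indicator A? ≡ indicator B?
indicator-⇔ (yes a) B? f g = sym (indicator-yes B? (f a))
indicator-⇔ (no ¬a) B? f g = sym (indicator-no B? (¬a ∘ g))

module Residues (q : ℕ) (p-prime : Prime (suc q)) where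

  open ModPrime q p-prime public

  private
    residues-unique-≤ : ∀ {i j} → i < p → j ≤ i → + i ≈ + j ⟨ + p ⟩ → i ≡ j
    residues-unique-≤ {i} {j} i<p j≤i i≈j with i ∸ j in i∸j≡d | ≈0⇒∣ (≈-trans (≈-reflexive (trans (sym (ℤ.⊖-≥ j≤i)) (sym (ℤ.m-n≡m⊖n i j)))) (x≈y⇒x-y≈0 i≈j))
    ... | zero | _ = ℕ.≤-antisym (ℕ.m∸n≡0⇒m≤n i∸j≡d) j≤i
    ... | suc d | p∣1+d = contradiction p∣1+d (ℕ.>⇒∤ (subst (_< p) i∸j≡d (ℕ.≤-<-trans (ℕ.m∸n≤m i j) i<p)))

  residues-unique : ∀ {i j} → i < p → j < p → + i ≈ + j ⟨ + p ⟩ → i ≡ j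
  residues-unique {i} {j} i<p j<p i≈j =
    [ (λ i≤j → sym (residues-unique-≤ j<p i≤j (≈-sym i≈j))) , (λ j≤i → residues-unique-≤ i<p j≤i i≈j) ]′ (ℕ.≤-total i j)

  residue<p : ∀ x → residue x < p
  residue<p x = n%ℕd<d x p

  residue-≈ : ∀ {x y} → x ≈ y ⟨ + p ⟩ → residue x ≡ residue y
  residue-≈ {x} {y} x≈y = residues-unique (residue<p x) (residue<p y) (≈-trans (≈-sym (x≈residue x)) (≈-trans x≈y (x≈residue y)))

  ∑ₚ : (ℤ → ℤ) → ℤ
  ∑ₚ f = ∑ p (λ x → f (+ x))

  Periodic : (ℤ → ℤ) → Set
  Periodic f = ∀ {x y} → x ≈ y ⟨ + p ⟩ → f x ≡ f y

  Respects : (ℤ → ℤ) → Set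
  Respects σ = ∀ {x y} → x ≈ y ⟨ + p ⟩ → σ x ≈ σ y ⟨ + p ⟩

  ∑ₚ-ext : {f g : ℤ → ℤ} → (∀ x → f x ≡ g x) → ∑ₚ f ≡ ∑ₚ g
  ∑ₚ-ext f≡g = ∑-ext p (λ x → f≡g (+ x))

  δ : ℤ → ℤ → ℤ
  δ x y = indicator (x ≈? y)

  δ-⇔ : ∀ {x y u v} → (x ≈ y ⟨ + p ⟩ → u ≈ v ⟨ + p ⟩) → (u ≈ v ⟨ + p ⟩ → x ≈ y ⟨ + p ⟩) → δ x y ≡ δ u v
  δ-⇔ {x} {y} {u} {v} = indicator-⇔ (x ≈? y) (u ≈? v)

  δ-yes : ∀ {x y} → x ≈ y ⟨ + p ⟩ → δ x y ≡ + 1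
  δ-yes {x} {y} = indicator-yes (x ≈? y)

  δ-no : ∀ {x y} → ¬ x ≈ y ⟨ + p ⟩ → δ x y ≡ + 0
  δ-no {x} {y} = indicator-no (x ≈? y)

  ∑ₚ-δ : ∀ {f} → Periodic f → ∀ y → ∑ₚ (λ x → f x * δ x y) ≡ f y
  ∑ₚ-δ {f} periodic y = trans
    (∑-single p (residue y) (residue<p y)
      (λ i i<p i≢r → trans (cong (_*_ (f (+ i))) (δ-no (λ i≈y → i≢r (residues-unique i<p (residue<p y) (≈-trans i≈y (x≈residue y)))))) (ℤ.*-zeroʳ (f (+ i)))))
    (trans (cong₂ _*_ (periodic (≈-sym (x≈residue y))) (δ-yes (≈-sym (x≈residue y)))) (ℤ.*-identityʳ (f y)))

  ∑ₚ-δ₁ : ∀ y → ∑ₚ (λ x → δ x y) ≡ + 1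
  ∑ₚ-δ₁ y = trans (∑ₚ-ext (λ x → sym (ℤ.*-identityˡ (δ x y)))) (∑ₚ-δ (λ _ → refl) y)

  -- σ permutes residue classes, not the representatives 0 ≤ x < p themselves, which is why f has to
  -- be periodic. After f (σ y) is expanded with `δ` and the sums are exchanged, the inner sum
  -- counts the y with σ y ≡ x, and τ x is the only one.
  ∑ₚ-reindex : ∀ {f} (σ τ : ℤ → ℤ) → Respects σ → Respects τ → (∀ x → τ (σ x) ≈ x ⟨ + p ⟩) → (∀ x → σ (τ x) ≈ x ⟨ + p ⟩) →
      Periodic f → ∑ₚ (λ x → f (σ x)) ≡ ∑ₚ f
  ∑ₚ-reindex {f} σ τ σ-≈ τ-≈ τσ≈id στ≈id periodic = begin
    ∑ₚ (λ y → f (σ y)) ≡⟨ ∑ₚ-ext (λ y → ∑ₚ-δ periodic (σ y)) ⟨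
    ∑ₚ (λ y → ∑ₚ (λ x → f x * δ x (σ y))) ≡⟨ ∑-swap p p (λ y x → f (+ x) * δ (+ x) (σ (+ y))) ⟩
    ∑ₚ (λ x → ∑ₚ (λ y → f x * δ x (σ y))) ≡⟨ ∑ₚ-ext (λ x → ∑-*ˡ p (f x) (λ y → δ x (σ (+ y)))) ⟩
    ∑ₚ (λ x → f x * ∑ₚ (λ y → δ x (σ y)))
      ≡⟨ ∑ₚ-ext (λ x → cong (_*_ (f x)) (trans (∑ₚ-ext (λ y → δ-⇔ {x} {σ y} {y} {τ x}
           (λ x≈σy → ≈-trans (≈-sym (τσ≈id y)) (τ-≈ (≈-sym x≈σy))) (λ y≈τx → ≈-trans (≈-sym (στ≈id x)) (σ-≈ (≈-sym y≈τx))))) (∑ₚ-δ₁ (τ x)))) ⟩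
    ∑ₚ (λ x → f x * + 1) ≡⟨ ∑ₚ-ext (λ x → ℤ.*-identityʳ (f x)) ⟩
    ∑ₚ f ∎
    where open ≡-Reasoning

  ∑ₚ-scale : ∀ {f u} → Unit u → Periodic f → ∑ₚ (λ x → f (u * x)) ≡ ∑ₚ f
  ∑ₚ-scale {f} {u} u≉0 = ∑ₚ-reindex (_*_ u) (_*_ (inv u)) (*-≈ˡ u) (*-≈ˡ (inv u))
    (λ x → cancel (inv u) u x (≈-trans (≈-reflexive (ℤ.*-comm (inv u) u)) (x*inv[x]≈1p u≉0)))
    (λ x → cancel u (inv u) x (x*inv[x]≈1p u≉0))
    where
    cancel : ∀ u v x → u * v ≈ + 1 ⟨ + p ⟩ → u * (v * x) ≈ x ⟨ + p ⟩
    cancel u v x uv≈1 = ≈-trans (≈-reflexive (sym (ℤ.*-assoc u v x))) (≈-trans (*-≈ʳ x uv≈1) (≈-reflexive (ℤ.*-identityˡ x)))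

  -- Meant for x ↦ (xᵖ)ʲ modulo p², which depends on x modulo p only up to congruence. Composing
  -- with `residue` makes it strictly periodic, so that `∑ₚ-scale` applies.
  ∑ₚ-scale-≈ : ∀ {M f u} → Unit u → (∀ {x y} → x ≈ y ⟨ + p ⟩ → f x ≈ f y ⟨ M ⟩) → ∑ₚ (λ x → f (u * x)) ≈ ∑ₚ f ⟨ M ⟩
  ∑ₚ-scale-≈ {M} {f} {u} u≉0 f-≈ = begin
    ∑ₚ (λ x → f (u * x)) ≈⟨ ∑-≈ p (λ x _ → f-≈ (x≈residue (u * + x))) ⟩
    ∑ₚ (λ x → f (+ residue (u * x))) ≡⟨ ∑ₚ-scale {λ x → f (+ residue x)} u≉0 (λ x≈y → cong (λ k → f (+ k)) (residue-≈ x≈y)) ⟩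
    ∑ₚ (λ x → f (+ residue x)) ≈⟨ ∑-≈ p (λ x _ → f-≈ (x≈residue (+ x))) ⟨
    ∑ₚ f ∎
    where open ≈-Reasoning M

  -- x ^ p is the Teichmüller representative of x modulo p²

  ^q*-≈ : ∀ {x} t → Unit x → x ^ (q ℕ.* t) ≈ + 1 ⟨ + p ⟩
  ^q*-≈ {x} t x≉0 = ≈-trans (≈-reflexive (sym (ℤ.^-*-assoc x q t))) (≈-trans (^-≈ t (fermat-unit x≉0)) (≈-reflexive (ℤ.^-zeroˡ t)))

  zero-^ : ∀ {n} → 0 < n → (+ 0) ^ n ≡ + 0
  zero-^ {suc n} _ = ℤ.*-zeroˡ ((+ 0) ^ n)

  teichmüller-^q*-≈ : ∀ {x} t → Unit x → (x ^ p) ^ (q ℕ.* t) ≈ + 1 ⟨ + p * + p ⟩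
  teichmüller-^q*-≈ {x} t x≉0 = begin
    (x ^ p) ^ (q ℕ.* t) ≡⟨ ℤ.^-*-assoc (x ^ p) q t ⟨
    ((x ^ p) ^ q) ^ t ≡⟨ cong (_^ t) (trans (ℤ.^-*-assoc x p q) (trans (cong (x ^_) (ℕ.*-comm p q)) (sym (ℤ.^-*-assoc x q p)))) ⟩
    ((x ^ q) ^ p) ^ t ≈⟨ ^-≈ t (^-lift (fermat-unit x≉0)) ⟩
    ((+ 1) ^ p) ^ t ≡⟨ trans (cong (_^ t) (ℤ.^-zeroˡ p)) (ℤ.^-zeroˡ t) ⟩
    + 1 ∎
    where open ≈-Reasoning (+ p * + p)

  power-sum-full : ∀ t → 0 < t → ∑ₚ (λ x → (x ^ p) ^ (q ℕ.* t)) ≈ + q ⟨ + p * + p ⟩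
  power-sum-full t 0<t = ≈-trans
    (∑-units (λ x → ((+ x) ^ p) ^ (q ℕ.* t)) (+ 1)
      (≈-reflexive (trans (cong (_^ (q ℕ.* t)) (zero-^ {p} (s≤s z≤n))) (zero-^ {q ℕ.* t} (ℕ.*-mono-< q>0 0<t))))
      (λ k k>0 k<p → teichmüller-^q*-≈ t (Unit-pos k k>0 k<p)))
    (≈-reflexive (ℤ.*-identityʳ (+ q)))

  -- If every unit satisfied uʳ ≡ 1, the r-th power sum would be p - 1 ≡ -1, against
  -- `power-sum-vanishes`. The witness is found by a bounded search.
  non-root : ∀ r → 0 < r → r < q → ∃ λ u → Unit u × ¬ u ^ r ≈ + 1 ⟨ + p ⟩
  non-root r 0<r r<q with ℕ.anyUpTo? (λ k → ¬? (+ suc k ≈? + 0 ⊎-dec (+ suc k) ^ r ≈? + 1)) q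
  ... | yes (k , _ , ¬root) = + suc k , ¬root ∘ inj₁ , ¬root ∘ inj₂
  ... | no all-roots = contradiction
    (≈-trans (≈-sym q≈-1) (≈-trans (≈-reflexive (sym (ℤ.*-identityʳ (+ q)))) (≈-trans (≈-sym
      (∑-units (λ x → (+ x) ^ r) (+ 1) (≈-reflexive (zero-^ 0<r)) root)) (power-sum-vanishes r r<q))))
    (λ -1≈0 → Unit-1 (neg-≈ -1≈0))
    where
    root : ∀ k → 0 < k → k < p → (+ k) ^ r ≈ + 1 ⟨ + p ⟩
    root (suc k) k>0 k<p = decidable-stable ((+ suc k) ^ r ≈? + 1)
      (λ ¬root → all-roots (k , ℕ.s≤s⁻¹ k<p , [ Unit-pos (suc k) k>0 k<p , ¬root ]′))

  -- Replacing x by u x permutes the terms modulo p² and multiplies the sum by f u. Since f u ≡ uʳ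
  -- (mod p), the factor f u - 1 is a unit when u comes from `non-root`, and it can be cancelled
  -- modulo p².
  power-sum-partial : ∀ t r → 0 < r → r < q → ∑ₚ (λ x → (x ^ p) ^ (r ℕ.+ q ℕ.* t)) ≈ + 0 ⟨ + p * + p ⟩
  power-sum-partial t r 0<r r<q = cancel (non-root r 0<r r<q)
    where
    j = r ℕ.+ q ℕ.* t
    f : ℤ → ℤ
    f x = (x ^ p) ^ j
    cancel : (∃ λ u → Unit u × ¬ u ^ r ≈ + 1 ⟨ + p ⟩) → ∑ₚ f ≈ + 0 ⟨ + p * + p ⟩
    cancel (u , u≉0 , uʳ≉1) = *-cancelˡ-≈ (f u - + 1) fu-1≉0 (begin
      (f u - + 1) * ∑ₚ f ≡⟨ distrib (f u) (∑ₚ f) ⟩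
      f u * ∑ₚ f - ∑ₚ f ≡⟨ cong (_- ∑ₚ f) (∑-*ˡ p (f u) (λ x → f (+ x))) ⟨
      ∑ₚ (λ x → f u * f x) - ∑ₚ f ≡⟨ cong (_- ∑ₚ f) (∑ₚ-ext (λ x → trans (cong (_^ j) (^-distribʳ-* u x p)) (^-distribʳ-* (u ^ p) (x ^ p) j))) ⟨
      ∑ₚ (λ x → f (u * x)) - ∑ₚ f ≈⟨ x≈y⇒x-y≈0 (∑ₚ-scale-≈ {f = f} u≉0 (λ x≈y → ^-≈ j (^-lift x≈y))) ⟩
      + 0 ≡⟨ ℤ.*-zeroʳ (f u - + 1) ⟨
      (f u - + 1) * + 0 ∎)
      where
      open ≈-Reasoning (+ p * + p)
      distrib : ∀ u s → (u - + 1) * s ≡ u * s - s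
      distrib = solve-∀
      fu≈uʳ : f u ≈ u ^ r ⟨ + p ⟩
      fu≈uʳ = ≈-trans (^-≈ j (fermat u)) (≈-trans (≈-reflexive (ℤ.^-distribˡ-+-* u r (q ℕ.* t)))
          (≈-trans (*-≈ˡ (u ^ r) (^q*-≈ t u≉0)) (≈-reflexive (ℤ.*-identityʳ (u ^ r)))))
      fu-1≉0 : Unit (f u - + 1)
      fu-1≉0 fu≈1 = uʳ≉1 (≈-trans (≈-sym fu≈uʳ) (x-y≈0⇒x≈y fu≈1))

-- The quadratic character and its correlations

data Sign₀ : ℤ → Set where
  zero : Sign₀ (+ 0)
  plus : Sign₀ (+ 1)
  minus : Sign₀ -1ℤ

Sign₀-* : ∀ {x y} → Sign₀ x → Sign₀ y → Sign₀ (x * y)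
Sign₀-* zero zero = zero
Sign₀-* zero plus = zero
Sign₀-* zero minus = zero
Sign₀-* plus zero = zero
Sign₀-* plus plus = plus
Sign₀-* plus minus = minus
Sign₀-* minus zero = zero
Sign₀-* minus plus = minus
Sign₀-* minus minus = plus

x≡-x⇒x≡0 : ∀ x → x ≡ - x → x ≡ + 0
x≡-x⇒x≡0 (+ zero) _ = refl

module QuadraticCharacter (m : ℕ) (p-prime : Prime (suc (4 ℕ.* m))) where

  open Residues (4 ℕ.* m) p-prime public

  n : ℕ
  n = 2 ℕ.* m

  n+n≡q : n ℕ.+ n ≡ 4 ℕ.* m
  n+n≡q = ℕ-lemma m
    where
    ℕ-lemma : ∀ m → 2 ℕ.* m ℕ.+ 2 ℕ.* m ≡ 4 ℕ.* m
    ℕ-lemma = ℕ-solve-∀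

  +p≡ : + p ≡ + 1 + + 4 * + m
  +p≡ = cong (_+_ (+ 1)) (ℤ.pos-* 4 m)

  +n≡ : + n ≡ + 2 * + m
  +n≡ = ℤ.pos-* 2 m

  m>0 : 0 < m
  m>0 = ℕ.n≢0⇒n>0 (λ m≡0 → ℕ.<⇒≢ q>0 (sym (cong (4 ℕ.*_) m≡0)))

  4≤q : 4 ≤ 4 ℕ.* m
  4≤q = ℕ.*-monoʳ-≤ 4 m>0

  n>0 : 0 < n
  n>0 = ℕ.*-mono-< {0} {2} (s≤s z≤n) m>0

  n′ : ℕ
  n′ = ℕ.pred n

  1+n′≡n : suc n′ ≡ n
  1+n′≡n = ℕ.suc-pred n {{ℕ.>-nonZero n>0}}

  n<q : n < 4 ℕ.* m
  n<q = ℕ.*-monoˡ-< m {{ℕ.>-nonZero m>0}} {2} {4} (s≤s (s≤s (s≤s z≤n)))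

  Unit-2 : Unit (+ 2)
  Unit-2 = Unit-pos 2 (s≤s z≤n) (ℕ.≤-trans (s≤s (s≤s (s≤s z≤n))) (ℕ.m≤n⇒m≤1+n 4≤q))

  1≉-1 : ¬ + 1 ≈ -1ℤ ⟨ + p ⟩
  1≉-1 1≈-1 = Unit-2 (x≈y⇒x-y≈0 1≈-1)

  Sign₀-unique : ∀ {x y} → Sign₀ x → Sign₀ y → x ≈ y ⟨ + p ⟩ → x ≡ y
  Sign₀-unique zero zero _ = refl
  Sign₀-unique zero plus e = contradiction (≈-sym e) Unit-1
  Sign₀-unique zero minus e = contradiction (neg-≈ (≈-sym e)) Unit-1
  Sign₀-unique plus zero e = contradiction e Unit-1
  Sign₀-unique plus plus _ = refl
  Sign₀-unique plus minus e = contradiction e 1≉-1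
  Sign₀-unique minus zero e = contradiction (neg-≈ e) Unit-1
  Sign₀-unique minus plus e = contradiction (≈-sym e) 1≉-1
  Sign₀-unique minus minus _ = refl

  square-root-of-1 : ∀ y → y * y ≈ + 1 ⟨ + p ⟩ → ¬ y ≈ + 1 ⟨ + p ⟩ → -1ℤ ≈ y ⟨ + p ⟩
  square-root-of-1 y yy≈1 y≉1 = [ (λ y≈1 → contradiction (x-y≈0⇒x≈y y≈1) y≉1) , (λ y+1≈0 → ≈-sym (x-y≈0⇒x≈y y+1≈0)) ]′
    (x*y≈0⇒x≈0∨y≈0 (y - + 1) (y - -1ℤ) (≈-trans (≈-reflexive (lemma y)) (x≈y⇒x-y≈0 yy≈1)))
    where
    lemma : ∀ y → (y - + 1) * (y - -1ℤ) ≡ y * y - + 1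
    lemma = solve-∀

  opaque
    -- The character is defined by Euler's criterion, as the integer 0, 1 or -1 congruent to xⁿ. Its
    -- properties follow from this specification and `Sign₀-unique`; opacity keeps the case
    -- distinction from unfolding.
    euler : ∀ x → ∃ λ c → Sign₀ c × c ≈ x ^ n ⟨ + p ⟩
    euler x with x ≈? + 0 | x ^ n ≈? + 1
    ... | yes x≈0 | _ = + 0 , zero , ≈-sym (≈-trans (^-≈ n x≈0) (≈-reflexive (zero-^ n>0)))
    ... | no _ | yes e = + 1 , plus , ≈-sym e
    ... | no x≉0 | no x≉1 = -1ℤ , minus , square-root-of-1 (x ^ n)
      (≈-trans (≈-reflexive (trans (sym (ℤ.^-distribˡ-+-* x n n)) (cong (x ^_) n+n≡q))) (fermat-unit x≉0)) x≉1

  χ : ℤ → ℤ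
  χ x = proj₁ (euler x)

  χ-sign : ∀ x → Sign₀ (χ x)
  χ-sign x = proj₁ (proj₂ (euler x))

  χ≈^n : ∀ x → χ x ≈ x ^ n ⟨ + p ⟩
  χ≈^n x = proj₂ (proj₂ (euler x))

  χ-≡ : ∀ {x c} → Sign₀ c → x ^ n ≈ c ⟨ + p ⟩ → χ x ≡ c
  χ-≡ {x} sign xⁿ≈c = Sign₀-unique (χ-sign x) sign (≈-trans (χ≈^n x) xⁿ≈c)

  χ-periodic : Periodic χ
  χ-periodic {x} {y} x≈y = χ-≡ (χ-sign y) (≈-trans (^-≈ n x≈y) (≈-sym (χ≈^n y)))

  χ-* : ∀ x y → χ (x * y) ≡ χ x * χ y
  χ-* x y = χ-≡ (Sign₀-* (χ-sign x) (χ-sign y)) (≈-trans (≈-reflexive (^-distribʳ-* x y n)) (≈-sym (*-≈ (χ≈^n x) (χ≈^n y))))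

  χ-0 : ∀ {x} → x ≈ + 0 ⟨ + p ⟩ → χ x ≡ + 0
  χ-0 x≈0 = χ-≡ zero (≈-trans (^-≈ n x≈0) (≈-reflexive (zero-^ n>0)))

  χ-1 : χ (+ 1) ≡ + 1
  χ-1 = χ-≡ plus (≈-reflexive (ℤ.^-zeroˡ n))

  χ--1 : χ -1ℤ ≡ + 1
  χ--1 = χ-≡ plus (≈-reflexive (-1^2*k≡1 m))

  χ-neg : ∀ x → χ (- x) ≡ χ x
  χ-neg x = trans (cong χ (sym (ℤ.-1*i≡-i x))) (trans (χ-* -1ℤ x) (trans (cong (_* χ x) χ--1) (ℤ.*-identityˡ (χ x))))

  χ-unit² : ∀ {x} → Unit x → χ x * χ x ≡ + 1
  χ-unit² {x} x≉0 = Sign₀-unique (Sign₀-* (χ-sign x) (χ-sign x)) plus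
    (≈-trans (*-≈ (χ≈^n x) (χ≈^n x)) (≈-trans (≈-reflexive (trans (sym (ℤ.^-distribˡ-+-* x n n)) (cong (x ^_) n+n≡q))) (fermat-unit x≉0)))

  χ-square : ∀ {x} → Unit x → χ (x * x) ≡ + 1
  χ-square {x} x≉0 = trans (χ-* x x) (χ-unit² x≉0)

  nonresidue : ∃ λ g → Unit g × χ g ≡ -1ℤ
  nonresidue = case non-root n n>0 n<q of λ (g , g≉0 , gⁿ≉1) →
    g , g≉0 , χ-≡ minus (≈-sym (square-root-of-1 (g ^ n)
      (≈-trans (≈-reflexive (trans (sym (ℤ.^-distribˡ-+-* g n n)) (cong (g ^_) n+n≡q))) (fermat-unit g≉0)) gⁿ≉1))

  ∑χ≡0 : ∑ₚ χ ≡ + 0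
  ∑χ≡0 = case nonresidue of λ (g , g≉0 , χg≡-1) → x≡-x⇒x≡0 (∑ₚ χ) (begin
    ∑ₚ χ ≡⟨ ∑ₚ-scale g≉0 χ-periodic ⟨
    ∑ₚ (λ x → χ (g * x)) ≡⟨ ∑ₚ-ext (λ x → trans (χ-* g x) (cong (_* χ x) χg≡-1)) ⟩
    ∑ₚ (λ x → -1ℤ * χ x) ≡⟨ ∑-*ˡ p -1ℤ (λ x → χ (+ x)) ⟩
    -1ℤ * ∑ₚ χ ≡⟨ ℤ.-1*i≡-i (∑ₚ χ) ⟩
    - ∑ₚ χ ∎)
    where open ≡-Reasoning

  ∑ₚ-shift : ∀ {f} c → Periodic f → ∑ₚ (λ x → f (x + c)) ≡ ∑ₚ f
  ∑ₚ-shift c = ∑ₚ-reindex (_+ c) (_- c) (λ e → +-≈ e ≈-refl) (λ e → −-≈ e ≈-refl)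
    (λ x → ≈-reflexive (lemma x c)) (λ x → ≈-reflexive (lemma′ x c))
    where
    lemma : ∀ x c → x + c - c ≡ x
    lemma = solve-∀
    lemma′ : ∀ x c → x - c + c ≡ x
    lemma′ = solve-∀

  ∑ₚ-reflect : ∀ {f} c → Periodic f → ∑ₚ (λ x → f (c - x)) ≡ ∑ₚ f
  ∑ₚ-reflect c = ∑ₚ-reindex (_-_ c) (_-_ c) (−-≈ˡ c) (−-≈ˡ c)
    (λ x → ≈-reflexive (lemma c x)) (λ x → ≈-reflexive (lemma c x))
    where
    lemma : ∀ c x → c - (c - x) ≡ x
    lemma = solve-∀

  inv-zero : ∀ {x} → x ≈ + 0 ⟨ + p ⟩ → inv x ≈ + 0 ⟨ + p ⟩
  inv-zero x≈0 = ≈-trans (inv-≈ x≈0) (≈-reflexive (zero-^ {exponent}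
    (ℕ.s≤s⁻¹ (ℕ.<-≤-trans (ℕ.<-≤-trans (s≤s (s≤s z≤n)) 4≤q) (ℕ.≤-trans (ℕ.≤-reflexive (sym (ℕ.*-identityʳ (4 ℕ.* m)))) (ℕ.≤-trans (ℕ.*-monoʳ-≤ (4 ℕ.* m) {1} {p} (s≤s z≤n)) (ℕ.≤-reflexive (sym suc-exponent))))))))

  inv-involutive : ∀ x → inv (inv x) ≈ x ⟨ + p ⟩
  inv-involutive x with x ≈? + 0
  ... | yes x≈0 = ≈-trans (inv-zero (inv-zero x≈0)) (≈-sym x≈0)
  ... | no x≉0 = ≈-sym (inv-unique (≈-trans (≈-reflexive (ℤ.*-comm (inv x) x)) (x*inv[x]≈1p x≉0)))

  ∑χ[1+inv]≡0 : ∑ₚ (λ x → χ (+ 1 + inv x)) ≡ + 0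
  ∑χ[1+inv]≡0 = begin
    ∑ₚ (λ x → χ (+ 1 + inv x)) ≡⟨ ∑ₚ-reindex {λ x → χ (+ 1 + x)} inv inv inv-≈ inv-≈ inv-involutive inv-involutive (λ e → χ-periodic (+-≈ˡ (+ 1) e)) ⟩
    ∑ₚ (λ x → χ (+ 1 + x)) ≡⟨ ∑ₚ-ext (λ x → cong χ (ℤ.+-comm (+ 1) x)) ⟩
    ∑ₚ (λ x → χ (x + + 1)) ≡⟨ ∑ₚ-shift (+ 1) χ-periodic ⟩
    ∑ₚ χ ≡⟨ ∑χ≡0 ⟩
    + 0 ∎
    where open ≡-Reasoning

  -- For a unit x, χ(x) χ(x + 1) = χ(x²) χ(1 + 1/x) = χ(1 + 1/x). As `inv` sends 0 to 0, it is an
  -- involution on all residues, and the full sum of χ(1 + inv x) is 0; the spurious term χ(1) at x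
  -- = 0 accounts for the -1.
  ∑χ[x]χ[x+1]≡-1 : ∑ₚ (λ x → χ x * χ (x + + 1)) ≡ -1ℤ
  ∑χ[x]χ[x+1]≡-1 = begin
    ∑ₚ (λ x → χ x * χ (x + + 1)) ≡⟨ ∑ₚ-ext pointwise ⟩
    ∑ₚ (λ x → χ (+ 1 + inv x) - δ x (+ 0)) ≡⟨ ∑-− p (λ x → χ (+ 1 + inv (+ x))) (λ x → δ (+ x) (+ 0)) ⟩
    ∑ₚ (λ x → χ (+ 1 + inv x)) - ∑ₚ (λ x → δ x (+ 0)) ≡⟨ cong₂ _-_ ∑χ[1+inv]≡0 (∑ₚ-δ₁ (+ 0)) ⟩
    -1ℤ ∎
    where
    open ≡-Reasoning
    pointwise : ∀ x → χ x * χ (x + + 1) ≡ χ (+ 1 + inv x) - δ x (+ 0)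
    pointwise x = [ zero-case , unit-case ]′ (toSum (x ≈? + 0))
      where
      zero-case : x ≈ + 0 ⟨ + p ⟩ → χ x * χ (x + + 1) ≡ χ (+ 1 + inv x) - δ x (+ 0)
      zero-case x≈0 = trans (cong (_* χ (x + + 1)) (χ-0 x≈0)) (trans (ℤ.*-zeroˡ (χ (x + + 1)))
        (sym (cong₂ _-_ (trans (χ-periodic (+-≈ˡ (+ 1) (inv-zero x≈0))) χ-1) (δ-yes x≈0))))
      unit-case : Unit x → χ x * χ (x + + 1) ≡ χ (+ 1 + inv x) - δ x (+ 0)
      unit-case x≉0 = begin
        χ x * χ (x + + 1) ≡⟨ cong (_*_ (χ x)) (χ-periodic (≈-trans (+-≈ (≈-reflexive (sym (ℤ.*-identityʳ x))) (≈-sym (x*inv[x]≈1p x≉0)))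
            (≈-reflexive (sym (ℤ.*-distribˡ-+ x (+ 1) (inv x)))))) ⟩
        χ x * χ (x * (+ 1 + inv x)) ≡⟨ cong (_*_ (χ x)) (χ-* x (+ 1 + inv x)) ⟩
        χ x * (χ x * χ (+ 1 + inv x)) ≡⟨ ℤ.*-assoc (χ x) (χ x) (χ (+ 1 + inv x)) ⟨
        χ x * χ x * χ (+ 1 + inv x) ≡⟨ cong (_* χ (+ 1 + inv x)) (χ-unit² x≉0) ⟩
        + 1 * χ (+ 1 + inv x) ≡⟨ trans (ℤ.*-identityˡ _) (sym (ℤ.+-identityʳ _)) ⟩
        χ (+ 1 + inv x) - + 0 ≡⟨ cong (_-_ (χ (+ 1 + inv x))) (δ-no x≉0) ⟨
        χ (+ 1 + inv x) - δ x (+ 0) ∎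

  ∑χ²≡q : ∑ₚ (λ x → χ x * χ x) ≡ + (4 ℕ.* m)
  ∑χ²≡q = trans (≈0⇒≡ (∑-units (λ x → χ (+ x) * χ (+ x)) (+ 1) (≈-reflexive (cong (λ u → u * u) (χ-0 ≈-refl)))
      (λ k k>0 k<p → ≈-reflexive (χ-unit² (Unit-pos k k>0 k<p)))))
      (ℤ.*-identityʳ (+ (4 ℕ.* m)))

  -- If u ≢ v, the substitution r ↦ u - r followed by scaling with v - u leads to the sum of χ(x)
  -- χ(x + 1).
  ∑χχ : ∀ u v → ∑ₚ (λ r → χ (u - r) * χ (v - r)) ≡ + p * δ u v - + 1
  ∑χχ u v = [ equal , distinct ]′ (toSum (u ≈? v))
    where
    open ≡-Reasoning
    equal : u ≈ v ⟨ + p ⟩ → ∑ₚ (λ r → χ (u - r) * χ (v - r)) ≡ + p * δ u v - + 1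
    equal u≈v = begin
      ∑ₚ (λ r → χ (u - r) * χ (v - r)) ≡⟨ ∑ₚ-ext (λ r → cong (_*_ (χ (u - r))) (χ-periodic (−-≈ (≈-sym u≈v) (≈-refl {x = r})))) ⟩
      ∑ₚ (λ r → χ (u - r) * χ (u - r)) ≡⟨ ∑ₚ-reflect {λ x → χ x * χ x} u (λ e → cong (λ w → w * w) (χ-periodic e)) ⟩
      ∑ₚ (λ r → χ r * χ r) ≡⟨ ∑χ²≡q ⟩
      + (4 ℕ.* m) ≡⟨ lemma (+ (4 ℕ.* m)) ⟩
      + p * + 1 - + 1 ≡⟨ cong (λ w → + p * w - + 1) (δ-yes u≈v) ⟨
      + p * δ u v - + 1 ∎
      where
      lemma : ∀ q → q ≡ (+ 1 + q) * + 1 - + 1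
      lemma = solve-∀
    distinct : ¬ u ≈ v ⟨ + p ⟩ → ∑ₚ (λ r → χ (u - r) * χ (v - r)) ≡ + p * δ u v - + 1
    distinct u≉v = begin
      ∑ₚ (λ r → χ (u - r) * χ (v - r)) ≡⟨ ∑ₚ-ext (λ r → cong (λ w → χ (u - r) * χ w) (lemma u v r)) ⟩
      ∑ₚ (λ r → χ (u - r) * χ ((u - r) + d)) ≡⟨ ∑ₚ-reflect {λ x → χ x * χ (x + d)} u (λ e → cong₂ _*_ (χ-periodic e) (χ-periodic (+-≈ e ≈-refl))) ⟩
      ∑ₚ (λ r → χ r * χ (r + d)) ≡⟨ ∑ₚ-scale {λ x → χ x * χ (x + d)} d≉0 (λ e → cong₂ _*_ (χ-periodic e) (χ-periodic (+-≈ e ≈-refl))) ⟨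
      ∑ₚ (λ r → χ (d * r) * χ (d * r + d)) ≡⟨ ∑ₚ-ext (λ r → trans (cong₂ _*_ (χ-* d r) (trans (cong χ (lemma′ d r)) (χ-* d (r + + 1)))) (lemma″ (χ d) (χ r) (χ (r + + 1)))) ⟩
      ∑ₚ (λ r → χ d * χ d * (χ r * χ (r + + 1))) ≡⟨ ∑-*ˡ p (χ d * χ d) (λ r → χ (+ r) * χ (+ r + + 1)) ⟩
      χ d * χ d * ∑ₚ (λ r → χ r * χ (r + + 1)) ≡⟨ cong₂ _*_ (χ-unit² d≉0) ∑χ[x]χ[x+1]≡-1 ⟩
      + 1 * -1ℤ ≡⟨ cong (_- + 1) (ℤ.*-zeroʳ (+ p)) ⟨
      + p * + 0 - + 1 ≡⟨ cong (λ w → + p * w - + 1) (δ-no u≉v) ⟨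
      + p * δ u v - + 1 ∎
      where
      d = v - u
      d≉0 : Unit d
      d≉0 = u≉v ∘ ≈-sym ∘ x-y≈0⇒x≈y
      lemma : ∀ u v r → v - r ≡ (u - r) + (v - u)
      lemma = solve-∀
      lemma′ : ∀ d r → d * r + d ≡ d * (r + + 1)
      lemma′ = solve-∀
      lemma″ : ∀ a b c → a * b * (a * c) ≡ a * a * (b * c)
      lemma″ = solve-∀

-- Jacobsthal sums and their second moment

∑-*-∑ : ∀ m n (f g : ℕ → ℤ) → ∑ m (λ i → ∑ n (λ j → f i * g j)) ≡ ∑ m f * ∑ n g
∑-*-∑ m n f g = trans (∑-ext m (λ i → ∑-*ˡ n (f i) g)) (∑-*ʳ m (∑ n g) f)

∑-squares-≥0 : ∀ n (f : ℕ → ℤ) → ∃ λ k → ∑ n (λ i → f i * f i) ≡ + k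
∑-squares-≥0 zero f = 0 , refl
∑-squares-≥0 (suc n) f = case ∑-squares-≥0 n f of λ (k , eq) →
  k ℕ.+ ℤ.∣ f n ∣ ℕ.* ℤ.∣ f n ∣ , cong₂ _+_ eq (i*i≡+∣i∣² (f n))
  where
  i*i≡+∣i∣² : ∀ i → i * i ≡ + (ℤ.∣ i ∣ ℕ.* ℤ.∣ i ∣)
  i*i≡+∣i∣² (+ i) = sym (ℤ.pos-* i i)
  i*i≡+∣i∣² -[1+ i ] = refl

∑-squares≡0 : ∀ n (f : ℕ → ℤ) → ∑ n (λ i → f i * f i) ≡ + 0 → ∀ i → i < n → f i ≡ + 0
∑-squares≡0 (suc n) f sum≡0 i i<1+n =
  [ ∑-squares≡0 n f (trans k-eq (cong +_ (ℕ.m+n≡0⇒m≡0 k k+l≡0))) i , (λ { refl → square≡0 (f n) (trans l-eq (cong +_ (ℕ.m+n≡0⇒n≡0 k k+l≡0))) }) ]′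
    (ℕ.m<1+n⇒m<n∨m≡n i<1+n)
  where
  square≡0 : ∀ x → x * x ≡ + 0 → x ≡ + 0
  square≡0 x xx≡0 = [ id , id ]′ (ℤ.i*j≡0⇒i≡0∨j≡0 x xx≡0)
  k l : ℕ
  k = proj₁ (∑-squares-≥0 n f)
  l = proj₁ (∑-squares-≥0 1 (λ _ → f n))
  k-eq : ∑ n (λ i → f i * f i) ≡ + k
  k-eq = proj₂ (∑-squares-≥0 n f)
  l-eq : f n * f n ≡ + l
  l-eq = trans (sym (ℤ.+-identityˡ (f n * f n))) (proj₂ (∑-squares-≥0 1 (λ _ → f n)))
  k+l≡0 : k ℕ.+ l ≡ 0
  k+l≡0 = ℤ.+-injective (trans (sym (cong₂ _+_ k-eq l-eq)) sum≡0)

module JacobsthalSums (m : ℕ) (p-prime : Prime (suc (4 ℕ.* m))) where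

  open QuadraticCharacter m p-prime public

  private
    ∑ₚ-*ˡ : ∀ c (f : ℤ → ℤ) → ∑ₚ (λ x → c * f x) ≡ c * ∑ₚ f
    ∑ₚ-*ˡ c f = ∑-*ˡ p c (λ x → f (+ x))

    ∑ₚ-swap : ∀ (f : ℤ → ℤ → ℤ) → ∑ₚ (λ x → ∑ₚ (f x)) ≡ ∑ₚ (λ y → ∑ₚ (λ x → f x y))
    ∑ₚ-swap f = ∑-swap p p (λ x y → f (+ x) (+ y))

    ∑ₚ-units : ∀ (f : ℤ → ℤ) c → f (+ 0) ≡ + 0 → (∀ x → Unit x → f x ≡ c) → ∑ₚ f ≡ + (4 ℕ.* m) * c
    ∑ₚ-units f c f0 fx = ≈0⇒≡ (∑-units (λ x → f (+ x)) c (≈-reflexive f0) (λ k k>0 k<p → ≈-reflexive (fx (+ k) (Unit-pos k k>0 k<p))))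

  x*x≈0⇒x≈0 : ∀ x → x * x ≈ + 0 ⟨ + p ⟩ → x ≈ + 0 ⟨ + p ⟩
  x*x≈0⇒x≈0 x xx≈0 = [ id , id ]′ (x*y≈0⇒x≈0∨y≈0 x x xx≈0)

  -- A unit x differs from -x modulo p, so the two indicators on the right are never both 1.
  δ-square : ∀ {x} y → Unit x → δ (x * x) (y * y) ≡ δ y x + δ y (- x)
  δ-square {x} y x≉0 = [ y≈x-case , (λ y≉x → [ y≈-x-case y≉x , neither y≉x ]′ (toSum (y ≈? - x))) ]′ (toSum (y ≈? x))
    where
    y≈x-case : y ≈ x ⟨ + p ⟩ → δ (x * x) (y * y) ≡ δ y x + δ y (- x)
    y≈x-case y≈x = trans (δ-yes (*-≈ (≈-sym y≈x) (≈-sym y≈x))) (sym (cong₂ _+_ (δ-yes y≈x)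
      (δ-no (λ y≈-x → Unit-* Unit-2 x≉0 (≈-trans (≈-reflexive (lemma x)) (x≈y⇒x-y≈0 (≈-trans (≈-sym y≈x) y≈-x)))))))
      where
      lemma : ∀ x → + 2 * x ≡ x - - x
      lemma = solve-∀
    y≈-x-case : ¬ y ≈ x ⟨ + p ⟩ → y ≈ - x ⟨ + p ⟩ → δ (x * x) (y * y) ≡ δ y x + δ y (- x)
    y≈-x-case y≉x y≈-x = trans (δ-yes (≈-trans (≈-reflexive (lemma x)) (*-≈ (≈-sym y≈-x) (≈-sym y≈-x)))) (sym (cong₂ _+_ (δ-no y≉x) (δ-yes y≈-x)))
      where
      lemma : ∀ x → x * x ≡ - x * - x
      lemma = solve-∀
    neither : ¬ y ≈ x ⟨ + p ⟩ → ¬ y ≈ - x ⟨ + p ⟩ → δ (x * x) (y * y) ≡ δ y x + δ y (- x)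
    neither y≉x y≉-x = trans (δ-no (λ xx≈yy → [ (λ e → y≉x (x-y≈0⇒x≈y e)) , (λ e → y≉-x (x-y≈0⇒x≈y e)) ]′
        (x*y≈0⇒x≈0∨y≈0 (y - x) (y - - x) (≈-trans (≈-reflexive (lemma x y)) (x≈y⇒x-y≈0 (≈-sym xx≈yy))))))
        (sym (cong₂ _+_ (δ-no y≉x) (δ-no y≉-x)))
      where
      lemma : ∀ x y → (y - x) * (y - - x) ≡ y * y - x * x
      lemma = solve-∀

  -- The sum of χ(x³ - r x): the curve y² = x³ - r x has p + S(r) affine points modulo p.
  S : ℤ → ℤ
  S r = ∑ₚ (λ x → χ x * χ (x * x - r))

  S² : ℤ → ℤ
  S² r = S r * S r

  S-periodic : Periodic S
  S-periodic r≈s = ∑ₚ-ext (λ x → cong (_*_ (χ x)) (χ-periodic (−-≈ˡ (x * x) r≈s)))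

  -- Substituting t x for x pulls out χ(t) χ(t²) = χ(t). Hence S(r)² depends only on the quadratic
  -- class of r.
  S-scale : ∀ {t} r → Unit t → S (t * t * r) ≡ χ t * S r
  S-scale {t} r t≉0 = begin
    S (t * t * r) ≡⟨ ∑ₚ-scale {λ x → χ x * χ (x * x - t * t * r)} t≉0 (λ e → cong₂ _*_ (χ-periodic e) (χ-periodic (−-≈ (*-≈ e e) (≈-refl {x = t * t * r})))) ⟨
    ∑ₚ (λ x → χ (t * x) * χ (t * x * (t * x) - t * t * r)) ≡⟨ ∑ₚ-ext pointwise ⟩
    ∑ₚ (λ x → χ t * (χ x * χ (x * x - r))) ≡⟨ ∑ₚ-*ˡ (χ t) (λ x → χ x * χ (x * x - r)) ⟩
    χ t * S r ∎
    where
    open ≡-Reasoning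
    lemma : ∀ t x r → t * x * (t * x) - t * t * r ≡ t * t * (x * x - r)
    lemma = solve-∀
    pointwise : ∀ x → χ (t * x) * χ (t * x * (t * x) - t * t * r) ≡ χ t * (χ x * χ (x * x - r))
    pointwise x = trans
      (cong₂ _*_ (χ-* t x) (trans (cong χ (lemma t x r)) (trans (χ-* (t * t) (x * x - r)) (trans (cong (_* χ (x * x - r)) (χ-square t≉0)) (ℤ.*-identityˡ _)))))
      (ℤ.*-assoc (χ t) (χ x) (χ (x * x - r)))

  S²-scale : ∀ {t} r → Unit t → S² (t * t * r) ≡ S² r
  S²-scale {t} r t≉0 = trans (cong₂ _*_ (S-scale r t≉0) (S-scale r t≉0))
    (trans (lemma (χ t) (S r)) (trans (cong (_* S² r) (χ-unit² t≉0)) (ℤ.*-identityˡ (S² r))))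
    where
    lemma : ∀ c s → c * s * (c * s) ≡ c * c * (s * s)
    lemma = solve-∀

  S-0 : S (+ 0) ≡ + 0
  S-0 = trans (∑ₚ-ext (λ x → [ zero-case x , unit-case x ]′ (toSum (x ≈? + 0)))) ∑χ≡0
    where
    zero-case : ∀ x → x ≈ + 0 ⟨ + p ⟩ → χ x * χ (x * x - + 0) ≡ χ x
    zero-case x x≈0 = trans (cong (_* χ (x * x - + 0)) (χ-0 x≈0)) (trans (ℤ.*-zeroˡ (χ (x * x - + 0))) (sym (χ-0 x≈0)))
    unit-case : ∀ x → Unit x → χ x * χ (x * x - + 0) ≡ χ x
    unit-case x x≉0 = trans (cong (_*_ (χ x)) (trans (cong χ (ℤ.+-identityʳ (x * x))) (χ-square x≉0))) (ℤ.*-identityʳ (χ x))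

  ∑χδ : ∀ x → χ x * ∑ₚ (λ y → χ y * δ (x * x) (y * y)) ≡ + 2 * (χ x * χ x)
  ∑χδ x = [ zero-case , unit-case ]′ (toSum (x ≈? + 0))
    where
    open ≡-Reasoning
    zero-case : x ≈ + 0 ⟨ + p ⟩ → χ x * ∑ₚ (λ y → χ y * δ (x * x) (y * y)) ≡ + 2 * (χ x * χ x)
    zero-case x≈0 = trans (cong (_* ∑ₚ (λ y → χ y * δ (x * x) (y * y))) (χ-0 x≈0))
      (trans (ℤ.*-zeroˡ (∑ₚ (λ y → χ y * δ (x * x) (y * y)))) (sym (cong (λ c → + 2 * (c * c)) (χ-0 x≈0))))
    lemma : ∀ c → c * (c + c) ≡ + 2 * (c * c)
    lemma = solve-∀
    unit-case : Unit x → χ x * ∑ₚ (λ y → χ y * δ (x * x) (y * y)) ≡ + 2 * (χ x * χ x)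
    unit-case x≉0 = begin
      χ x * ∑ₚ (λ y → χ y * δ (x * x) (y * y)) ≡⟨ cong (_*_ (χ x)) (∑ₚ-ext (λ y → trans (cong (_*_ (χ y)) (δ-square y x≉0)) (ℤ.*-distribˡ-+ (χ y) (δ y x) (δ y (- x))))) ⟩
      χ x * ∑ₚ (λ y → χ y * δ y x + χ y * δ y (- x)) ≡⟨ cong (_*_ (χ x)) (∑-+ p (λ y → χ (+ y) * δ (+ y) x) (λ y → χ (+ y) * δ (+ y) (- x))) ⟩
      χ x * (∑ₚ (λ y → χ y * δ y x) + ∑ₚ (λ y → χ y * δ y (- x))) ≡⟨ cong (_*_ (χ x)) (cong₂ _+_ (∑ₚ-δ χ-periodic x) (trans (∑ₚ-δ χ-periodic (- x)) (χ-neg x))) ⟩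
      χ x * (χ x + χ x) ≡⟨ lemma (χ x) ⟩
      + 2 * (χ x * χ x) ∎

  -- Expanding the square and summing over r first leaves the correlation of χ at x² and y². Its
  -- constant part -1 contributes a multiple of Σ χ = 0; its diagonal part p selects y ≡ ±x, where
  -- χ(x) χ(y) = χ(x)² because χ(-1) = 1.
  ∑S² : ∑ₚ S² ≡ + p * (+ 2 * + (4 ℕ.* m))
  ∑S² = begin
    ∑ₚ S²
      ≡⟨ ∑ₚ-ext (λ r → sym (∑-*-∑ p p (λ x → term (+ x) r) (λ y → term (+ y) r))) ⟩
    ∑ₚ (λ r → ∑ₚ (λ x → ∑ₚ (λ y → term x r * term y r)))
      ≡⟨ ∑ₚ-swap (λ r x → ∑ₚ (λ y → term x r * term y r)) ⟩
    ∑ₚ (λ x → ∑ₚ (λ r → ∑ₚ (λ y → term x r * term y r)))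
      ≡⟨ ∑ₚ-ext (λ x → ∑ₚ-swap (λ r y → term x r * term y r)) ⟩
    ∑ₚ (λ x → ∑ₚ (λ y → ∑ₚ (λ r → term x r * term y r)))
      ≡⟨ ∑ₚ-ext (λ x → ∑ₚ-ext (λ y → trans (∑ₚ-ext (λ r → rearrange (χ x) (χ y) (χ (x * x - r)) (χ (y * y - r))))
           (trans (∑ₚ-*ˡ (χ x * χ y) (λ r → χ (x * x - r) * χ (y * y - r))) (cong (_*_ (χ x * χ y)) (∑χχ (x * x) (y * y)))))) ⟩
    ∑ₚ (λ x → ∑ₚ (λ y → χ x * χ y * (+ p * δ (x * x) (y * y) - + 1)))
      ≡⟨ ∑ₚ-ext (λ x → trans (∑ₚ-ext (λ y → expand (χ x) (χ y) (+ p) (δ (x * x) (y * y)))) (∑-− p (λ y → + p * χ x * (χ (+ y) * δ (x * x) (+ y * + y))) (λ y → χ x * χ (+ y)))) ⟩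
    ∑ₚ (λ x → ∑ₚ (λ y → + p * χ x * (χ y * δ (x * x) (y * y))) - ∑ₚ (λ y → χ x * χ y))
      ≡⟨ ∑ₚ-ext (λ x → cong₂ _-_ (∑ₚ-*ˡ (+ p * χ x) (λ y → χ y * δ (x * x) (y * y))) (trans (∑ₚ-*ˡ (χ x) χ) (cong (_*_ (χ x)) ∑χ≡0))) ⟩
    ∑ₚ (λ x → + p * χ x * ∑ₚ (λ y → χ y * δ (x * x) (y * y)) - χ x * + 0)
      ≡⟨ ∑ₚ-ext (λ x → trans (drop-zero (+ p) (χ x) (∑ₚ (λ y → χ y * δ (x * x) (y * y)))) (cong (_*_ (+ p)) (∑χδ x))) ⟩
    ∑ₚ (λ x → + p * (+ 2 * (χ x * χ x)))
      ≡⟨ trans (∑ₚ-*ˡ (+ p) (λ x → + 2 * (χ x * χ x))) (cong (_*_ (+ p)) (∑ₚ-*ˡ (+ 2) (λ x → χ x * χ x))) ⟩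
    + p * (+ 2 * ∑ₚ (λ x → χ x * χ x))
      ≡⟨ cong (λ w → + p * (+ 2 * w)) ∑χ²≡q ⟩
    + p * (+ 2 * + (4 ℕ.* m)) ∎
    where
    open ≡-Reasoning
    term : ℤ → ℤ → ℤ
    term x r = χ x * χ (x * x - r)
    rearrange : ∀ a b c d → a * c * (b * d) ≡ a * b * (c * d)
    rearrange = solve-∀
    expand : ∀ a b P d → a * b * (P * d - + 1) ≡ P * a * (b * d) - a * b
    expand = solve-∀
    drop-zero : ∀ P a s → P * a * s - a * + 0 ≡ P * (a * s)
    drop-zero = solve-∀

  private
    fibre : (ℤ → ℤ) → ℤ → ℤ
    fibre σ r = ∑ₚ (λ t → δ r (σ t))

    ∑-fibre : ∀ {f} (σ : ℤ → ℤ) → Periodic f → ∑ₚ (λ t → f (σ t)) ≡ ∑ₚ (λ r → f r * fibre σ r)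
    ∑-fibre {f} σ periodic = begin
      ∑ₚ (λ t → f (σ t)) ≡⟨ ∑ₚ-ext (λ t → ∑ₚ-δ periodic (σ t)) ⟨
      ∑ₚ (λ t → ∑ₚ (λ r → f r * δ r (σ t))) ≡⟨ ∑ₚ-swap (λ t r → f r * δ r (σ t)) ⟩
      ∑ₚ (λ r → ∑ₚ (λ t → f r * δ r (σ t))) ≡⟨ ∑ₚ-ext (λ r → ∑ₚ-*ˡ (f r) (λ t → δ r (σ t))) ⟩
      ∑ₚ (λ r → f r * fibre σ r) ∎
      where open ≡-Reasoning

    fibre-periodic : ∀ σ → Periodic (fibre σ)
    fibre-periodic σ {x} {y} x≈y = ∑ₚ-ext (λ t → δ-⇔ {x} {σ t} {y} {σ t} (≈-trans (≈-sym x≈y)) (≈-trans x≈y))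

    ∑-fibre₁ : ∀ σ → ∑ₚ (fibre σ) ≡ + p
    ∑-fibre₁ σ = begin
      ∑ₚ (fibre σ) ≡⟨ ∑ₚ-ext (λ r → ℤ.*-identityˡ (fibre σ r)) ⟨
      ∑ₚ (λ r → + 1 * fibre σ r) ≡⟨ ∑-fibre {λ _ → + 1} σ (λ _ → refl) ⟨
      ∑ₚ (λ _ → + 1) ≡⟨ ∑-const p (+ 1) ⟩
      + p * + 1 ≡⟨ ℤ.*-identityʳ (+ p) ⟩
      + p ∎
      where open ≡-Reasoning

    ∑δ-square : ∀ x → ∑ₚ (λ t → δ (x * x) (t * t)) ≡ + 2 - δ x (+ 0)
    ∑δ-square x = [ zero-case , unit-case ]′ (toSum (x ≈? + 0))
      where
      zero-case : x ≈ + 0 ⟨ + p ⟩ → ∑ₚ (λ t → δ (x * x) (t * t)) ≡ + 2 - δ x (+ 0)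
      zero-case x≈0 = trans (∑ₚ-ext (λ t → δ-⇔ {x * x} {t * t} {t} {+ 0}
          (λ e → x*x≈0⇒x≈0 t (≈-trans (≈-sym e) (*-≈ x≈0 x≈0))) (λ e → ≈-trans (*-≈ x≈0 x≈0) (≈-sym (*-≈ e e)))))
        (trans (∑ₚ-δ₁ (+ 0)) (sym (cong (_-_ (+ 2)) (δ-yes x≈0))))
      unit-case : Unit x → ∑ₚ (λ t → δ (x * x) (t * t)) ≡ + 2 - δ x (+ 0)
      unit-case x≉0 = trans (∑ₚ-ext (λ t → δ-square t x≉0)) (trans (∑-+ p (λ t → δ (+ t) x) (λ t → δ (+ t) (- x)))
        (trans (cong₂ _+_ (∑ₚ-δ₁ x) (∑ₚ-δ₁ (- x))) (sym (cong (_-_ (+ 2)) (δ-no x≉0)))))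

    ∑∑δ-square : ∑ₚ (λ x → ∑ₚ (λ t → δ (x * x) (t * t))) ≡ + p * + 2 - + 1
    ∑∑δ-square = trans (∑ₚ-ext ∑δ-square) (trans (∑-− p (λ _ → + 2) (λ x → δ (+ x) (+ 0))) (cong₂ _-_ (∑-const p (+ 2)) (∑ₚ-δ₁ (+ 0))))

  module _ {g} (g≉0 : Unit g) (χg≡-1 : χ g ≡ -1ℤ) where

    private
      sq nsq : ℤ → ℤ
      sq t = t * t
      nsq t = t * t * g

      square≉nonsquare : ∀ s t → s * s ≈ t * t * g ⟨ + p ⟩ → t ≈ + 0 ⟨ + p ⟩
      square≉nonsquare s t e = decidable-stable (t ≈? + 0) (λ t≉0 → not-a-square (χ s) (χ-sign s)
        (trans (sym (χ-* s s)) (trans (χ-periodic e) (trans (χ-* (t * t) g) (cong₂ _*_ (χ-square t≉0) χg≡-1)))))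
        where
        not-a-square : ∀ c → Sign₀ c → c * c ≢ + 1 * -1ℤ
        not-a-square .(+ 0) zero ()
        not-a-square .(+ 1) plus ()
        not-a-square .(-1ℤ) minus ()

      -- This counts the pairs with x² ≡ t²: two values of t for each unit x, one for x = 0.
      ∑NN : ∑ₚ (λ r → fibre sq r * fibre sq r) ≡ + p * + 2 - + 1
      ∑NN = trans (sym (∑-fibre sq (fibre-periodic sq))) ∑∑δ-square

      ∑N′N′ : ∑ₚ (λ r → fibre nsq r * fibre nsq r) ≡ + p * + 2 - + 1
      ∑N′N′ = trans (sym (∑-fibre nsq (fibre-periodic nsq))) (trans (∑ₚ-ext (λ x → ∑ₚ-ext (λ t →
        δ-⇔ {x * x * g} {t * t * g} {x * x} {t * t}
          (λ e → *-cancelˡ-≈p g g≉0 (≈-trans (≈-reflexive (ℤ.*-comm g (x * x))) (≈-trans e (≈-reflexive (ℤ.*-comm (t * t) g)))))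
          (*-≈ʳ g)))) ∑∑δ-square)

      -- A square and g times a square agree only at 0, so the single pair (0, 0) is counted.
      ∑NN′ : ∑ₚ (λ r → fibre sq r * fibre nsq r) ≡ + 1
      ∑NN′ = begin
        ∑ₚ (λ r → fibre sq r * fibre nsq r) ≡⟨ ∑-fibre nsq (fibre-periodic sq) ⟨
        ∑ₚ (λ t → ∑ₚ (λ s → δ (t * t * g) (s * s))) ≡⟨ ∑ₚ-ext (λ t → ∑ₚ-ext (λ s → pointwise t s)) ⟩
        ∑ₚ (λ t → ∑ₚ (λ s → δ t (+ 0) * δ s (+ 0))) ≡⟨ ∑-*-∑ p p (λ t → δ (+ t) (+ 0)) (λ s → δ (+ s) (+ 0)) ⟩
        ∑ₚ (λ t → δ t (+ 0)) * ∑ₚ (λ s → δ s (+ 0)) ≡⟨ cong₂ _*_ (∑ₚ-δ₁ (+ 0)) (∑ₚ-δ₁ (+ 0)) ⟩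
        + 1 ∎
        where
        open ≡-Reasoning
        ttg≈0 : ∀ t → t ≈ + 0 ⟨ + p ⟩ → t * t * g ≈ + 0 ⟨ + p ⟩
        ttg≈0 t t≈0 = ≈-trans (*-≈ʳ g (*-≈ t≈0 t≈0)) (≈-reflexive (ℤ.*-zeroˡ g))
        pointwise : ∀ t s → δ (t * t * g) (s * s) ≡ δ t (+ 0) * δ s (+ 0)
        pointwise t s = [ (λ t≈0 → trans (δ-⇔ {u = s} {v = + 0}
            (λ e → x*x≈0⇒x≈0 s (≈-trans (≈-sym e) (ttg≈0 t t≈0))) (λ e → ≈-trans (ttg≈0 t t≈0) (≈-sym (*-≈ e e))))
            (trans (sym (ℤ.*-identityˡ (δ s (+ 0)))) (cong (_* δ s (+ 0)) (sym (δ-yes t≈0)))))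
            , (λ t≉0 → trans (δ-no (λ e → t≉0 (square≉nonsquare s t (≈-sym e))))
            (trans (sym (ℤ.*-zeroˡ (δ s (+ 0)))) (cong (_* δ s (+ 0)) (sym (δ-no t≉0)))))
            ]′ (toSum (t ≈? + 0))

    -- The variance of the fibre sizes of t ↦ t², t²g vanishes, so every residue is hit exactly twice.
    fibres : ∀ r → fibre sq r + fibre nsq r ≡ + 2
    fibres r = trans (cong₂ _+_ (fibre-periodic sq (x≈residue r)) (fibre-periodic nsq (x≈residue r)))
      (trans (lemma (N (+ residue r)) (N′ (+ residue r))) (cong (_+ + 2) (∑-squares≡0 p (λ r → N (+ r) + N′ (+ r) - + 2) variance (residue r) (residue<p r))))
      where
      open ≡-Reasoning
      N N′ : ℤ → ℤ
      N = fibre sq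
      N′ = fibre nsq
      lemma : ∀ a b → a + b ≡ a + b - + 2 + + 2
      lemma = solve-∀
      expand : ∀ a b → (a + b - + 2) * (a + b - + 2) ≡ a * a + b * b + + 2 * (a * b) - (+ 4 * (a + b) - + 4)
      expand = solve-∀
      total : ∀ P → P * + 2 - + 1 + (P * + 2 - + 1) + + 2 * + 1 - (+ 4 * (P + P) - P * + 4) ≡ + 0
      total = solve-∀
      variance : ∑ₚ (λ r → (N r + N′ r - + 2) * (N r + N′ r - + 2)) ≡ + 0
      variance = begin
        ∑ₚ (λ r → (N r + N′ r - + 2) * (N r + N′ r - + 2))
          ≡⟨ ∑ₚ-ext (λ r → expand (N r) (N′ r)) ⟩
        ∑ₚ (λ r → N r * N r + N′ r * N′ r + + 2 * (N r * N′ r) - (+ 4 * (N r + N′ r) - + 4))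
          ≡⟨ ∑-− p (λ r → N (+ r) * N (+ r) + N′ (+ r) * N′ (+ r) + + 2 * (N (+ r) * N′ (+ r))) (λ r → + 4 * (N (+ r) + N′ (+ r)) - + 4) ⟩
        ∑ₚ (λ r → N r * N r + N′ r * N′ r + + 2 * (N r * N′ r)) - ∑ₚ (λ r → + 4 * (N r + N′ r) - + 4)
          ≡⟨ cong₂ _-_ (trans (∑-+ p (λ r → N (+ r) * N (+ r) + N′ (+ r) * N′ (+ r)) (λ r → + 2 * (N (+ r) * N′ (+ r))))
              (cong₂ _+_ (trans (∑-+ p (λ r → N (+ r) * N (+ r)) (λ r → N′ (+ r) * N′ (+ r))) (cong₂ _+_ ∑NN ∑N′N′))
              (trans (∑ₚ-*ˡ (+ 2) (λ r → N r * N′ r)) (cong (_*_ (+ 2)) ∑NN′))))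
              (trans (∑-− p (λ r → + 4 * (N (+ r) + N′ (+ r))) (λ _ → + 4))
              (cong₂ _-_ (trans (∑ₚ-*ˡ (+ 4) (λ r → N r + N′ r)) (cong (_*_ (+ 4)) (trans (∑-+ p (λ r → N (+ r)) (λ r → N′ (+ r))) (cong₂ _+_ (∑-fibre₁ sq) (∑-fibre₁ nsq)))))
              (∑-const p (+ 4)))) ⟩
        -- The moments balance: (2p - 1) + (2p - 1) + 2 - 8p + 4p = 0.
        + p * + 2 - + 1 + (+ p * + 2 - + 1) + + 2 * + 1 - (+ 4 * (+ p + + p) - + p * + 4)
          ≡⟨ total (+ p) ⟩
        + 0 ∎

    -- Sum S(t²)² + S(t² g)² over t. Each of the p - 1 units contributes the left side, and t = 0
    -- contributes nothing. By `fibres` every residue r is met twice in all, so the total is also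
    -- twice the second moment `∑S²`.
    S²[1]+S²[g]≡4p : S² (+ 1) + S² g ≡ + 4 * + p
    S²[1]+S²[g]≡4p = ℤ.*-cancelˡ-≡ (+ (4 ℕ.* m)) _ _ {{ℕ.>-nonZero q>0}} (begin
      + (4 ℕ.* m) * (S² (+ 1) + S² g)
        ≡⟨ ∑ₚ-units (λ t → S² (t * t) + S² (t * t * g)) (S² (+ 1) + S² g)
             (cong₂ _+_ (cong (λ s → s * s) S-0) (cong (λ s → s * s) (trans (cong S (ℤ.*-zeroˡ g)) S-0)))
             (λ t t≉0 → cong₂ _+_ (trans (cong S² (sym (ℤ.*-identityʳ (t * t)))) (S²-scale (+ 1) t≉0)) (S²-scale g t≉0)) ⟨
      ∑ₚ (λ t → S² (sq t) + S² (nsq t))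
        ≡⟨ ∑-+ p (λ t → S² (sq (+ t))) (λ t → S² (nsq (+ t))) ⟩
      ∑ₚ (λ t → S² (sq t)) + ∑ₚ (λ t → S² (nsq t))
        ≡⟨ cong₂ _+_ (∑-fibre sq S²-periodic) (∑-fibre nsq S²-periodic) ⟩
      ∑ₚ (λ r → S² r * fibre sq r) + ∑ₚ (λ r → S² r * fibre nsq r)
        ≡⟨ ∑-+ p (λ r → S² (+ r) * fibre sq (+ r)) (λ r → S² (+ r) * fibre nsq (+ r)) ⟨
      ∑ₚ (λ r → S² r * fibre sq r + S² r * fibre nsq r)
        ≡⟨ ∑ₚ-ext (λ r → trans (sym (ℤ.*-distribˡ-+ (S² r) (fibre sq r) (fibre nsq r))) (trans (cong (_*_ (S² r)) (fibres r)) (ℤ.*-comm (S² r) (+ 2)))) ⟩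
      ∑ₚ (λ r → + 2 * S² r)
        ≡⟨ trans (∑ₚ-*ˡ (+ 2) S²) (cong (_*_ (+ 2)) ∑S²) ⟩
      + 2 * (+ p * (+ 2 * + (4 ℕ.* m)))
        ≡⟨ lemma (+ p) (+ (4 ℕ.* m)) ⟩
      + (4 ℕ.* m) * (+ 4 * + p) ∎)
      where
      open ≡-Reasoning
      S²-periodic : Periodic S²
      S²-periodic e = cong (λ s → s * s) (S-periodic e)
      lemma : ∀ P q → + 2 * (P * (+ 2 * q)) ≡ q * (+ 4 * P)
      lemma = solve-∀

-- Central binomial coefficients modulo p² and sums of signs modulo 4

cb : ℕ → ℤ
cb k = B (2 ℕ.* k) k

cb-zero : cb 0 ≡ + 1
cb-zero = B-zero 0

cb-suc : ∀ k → + suc k * cb (suc k) ≡ + 2 * (+ 2 * + k + + 1) * cb k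
cb-suc k = begin
  + suc k * cb (suc k) ≡⟨ cong (λ j → + suc k * B j (suc k)) (2*suc k) ⟩
  + suc k * B (suc (suc (2 ℕ.* k))) (suc k) ≡⟨ B-absorb (suc (2 ℕ.* k)) k ⟩
  + suc (suc (2 ℕ.* k)) * B (suc (2 ℕ.* k)) k ≡⟨ cong (_* B (suc (2 ℕ.* k)) k) (cong (_+_ (+ 2)) (ℤ.pos-* 2 k)) ⟩
  (+ 2 + + 2 * + k) * B (suc (2 ℕ.* k)) k ≡⟨ lemma (+ k) (B (suc (2 ℕ.* k)) k) ⟩
  + 2 * ((+ 1 + + 2 * + k - + k) * B (suc (2 ℕ.* k)) k)
    ≡⟨ cong (λ j → + 2 * ((+ 1 + j - + k) * B (suc (2 ℕ.* k)) k)) (ℤ.pos-* 2 k) ⟨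
  + 2 * ((+ suc (2 ℕ.* k) - + k) * B (suc (2 ℕ.* k)) k)
    ≡⟨ cong (_*_ (+ 2)) (B-stepˡ (2 ℕ.* k) k) ⟩
  + 2 * (+ suc (2 ℕ.* k) * cb k) ≡⟨ cong (λ j → + 2 * ((+ 1 + j) * cb k)) (ℤ.pos-* 2 k) ⟩
  + 2 * ((+ 1 + + 2 * + k) * cb k) ≡⟨ lemma′ (+ k) (cb k) ⟩
  + 2 * (+ 2 * + k + + 1) * cb k ∎
  where
  open ≡-Reasoning
  lemma : ∀ k b → (+ 2 + + 2 * k) * b ≡ + 2 * ((+ 1 + + 2 * k - k) * b)
  lemma = solve-∀
  lemma′ : ∀ k b → + 2 * ((+ 1 + + 2 * k) * b) ≡ + 2 * (+ 2 * k + + 1) * b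
  lemma′ = solve-∀

∏ : ℕ → (ℕ → ℤ) → ℤ
∏ zero f = + 1
∏ (suc n) f = ∏ n f * f n

x*x≈x⟨2⟩ : ∀ x → x * x ≈ x ⟨ + 2 ⟩
x*x≈x⟨2⟩ x = residue-case (x %ℕ 2) (n%ℕd<d x 2) (by (x /ℕ 2) (a≡a%ℕn+[a/ℕn]*n x 2))
  where
  residue-case : ∀ r → r < 2 → x ≈ + r ⟨ + 2 ⟩ → x * x ≈ x ⟨ + 2 ⟩
  residue-case 0 _ x≈0 = ≈-trans (*-≈ x≈0 x≈0) (≈-sym x≈0)
  residue-case 1 _ x≈1 = ≈-trans (*-≈ x≈1 x≈1) (≈-sym x≈1)
  residue-case (suc (suc _)) (s≤s (s≤s ())) _

data PlusMinusOne : ℤ → Set where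
  plus : PlusMinusOne (+ 1)
  minus : PlusMinusOne -1ℤ

PlusMinusOne-* : ∀ {x y} → PlusMinusOne x → PlusMinusOne y → PlusMinusOne (x * y)
PlusMinusOne-* plus plus = plus
PlusMinusOne-* plus minus = minus
PlusMinusOne-* minus plus = minus
PlusMinusOne-* minus minus = plus

PlusMinusOne-∏ : ∀ n {f} → (∀ i → i < n → PlusMinusOne (f i)) → PlusMinusOne (∏ n f)
PlusMinusOne-∏ zero _ = plus
PlusMinusOne-∏ (suc n) f = PlusMinusOne-* (PlusMinusOne-∏ n (λ i i<n → f i (ℕ.m<n⇒m<1+n i<n))) (f n (ℕ.n<1+n n))

-- Each factor -1 lowers the sum by 2 and flips the product.
∑-signs : ∀ n {f} → (∀ i → i < n → PlusMinusOne (f i)) → ∑ n f ≈ + n + ∏ n f - + 1 ⟨ + 4 ⟩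
∑-signs zero _ = ≈-refl
∑-signs (suc n) {f} signs = ≈-trans (+-≈ (∑-signs n {f} signs′) (≈-refl {x = f n})) (last (PlusMinusOne-∏ n signs′) (signs n (ℕ.n<1+n n)))
  where
  signs′ : ∀ i → i < n → PlusMinusOne (f i)
  signs′ i i<n = signs i (ℕ.m<n⇒m<1+n i<n)
  plus-lemma : ∀ n x → n + x - + 1 + + 1 ≡ + 1 + n + x * + 1 - + 1
  plus-lemma = solve-∀
  minus-plus : ∀ n → n + + 1 - + 1 + -1ℤ ≡ + 1 + n + + 1 * -1ℤ - + 1 + + 0 * + 4
  minus-plus = solve-∀
  minus-minus : ∀ n → n + -1ℤ - + 1 + -1ℤ ≡ + 1 + n + -1ℤ * -1ℤ - + 1 + -1ℤ * + 4
  minus-minus = solve-∀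
  last : ∀ {x y} → PlusMinusOne x → PlusMinusOne y → + n + x - + 1 + y ≈ + suc n + x * y - + 1 ⟨ + 4 ⟩
  last {x} _ plus = ≈-reflexive (plus-lemma (+ n) x)
  last plus minus = by (+ 0) (minus-plus (+ n))
  last minus minus = by -1ℤ (minus-minus (+ n))

module CentralBinomialCongruences (m : ℕ) (p-prime : Prime (suc (4 ℕ.* m))) where

  open JacobsthalSums m p-prime public

  2n≈-1 : + 2 * + n ≈ -1ℤ ⟨ + p ⟩
  2n≈-1 = ≈-trans (≈-reflexive (trans (cong (_*_ (+ 2)) +n≡) (trans (lemma (+ m)) (cong (_+_ -1ℤ) (sym +p≡))))) (+-≈ˡ -1ℤ M≈0)
    where
    lemma : ∀ m → + 2 * (+ 2 * m) ≡ -1ℤ + (+ 1 + + 4 * m)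
    lemma = solve-∀

  n<p : n < p
  n<p = ℕ.m<n⇒m<1+n n<q

  m≤n : m ≤ n
  m≤n = ℕ.m≤m+n m (m ℕ.+ 0)

  m<p : m < p
  m<p = ℕ.≤-<-trans m≤n n<p

  Unit-1+ : ∀ k → k < 4 ℕ.* m → Unit (+ suc k)
  Unit-1+ k k<q = Unit-pos (suc k) (s≤s z≤n) (s≤s k<q)

  -- n + j + 1 ≡ -(n - j)
  !-reflect : ∀ j → j ≤ n → + ((n ℕ.+ j) !) * + ((n ∸ j) !) ≈ -1ℤ ^ j * (+ (n !) * + (n !)) ⟨ + p ⟩
  !-reflect zero _ = ≈-reflexive (trans (cong (λ k → + (k !) * + (n !)) (ℕ.+-identityʳ n)) (sym (ℤ.*-identityˡ _)))
  !-reflect (suc j) j<n = *-cancelˡ-≈p (+ suc d) (Unit-1+ d (ℕ.<-≤-trans (s≤s (ℕ.m∸n≤m n (suc j))) n<q)) (begin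
    + suc d * (+ ((n ℕ.+ suc j) !) * + (d !)) ≡⟨ cong (λ k → + suc d * (+ (k !) * + (d !))) (ℕ.+-suc n j) ⟩
    + suc d * (+ (suc (n ℕ.+ j) !) * + (d !)) ≡⟨ cong (λ w → + suc d * (w * + (d !))) (ℤ.pos-* (suc (n ℕ.+ j)) ((n ℕ.+ j) !)) ⟩
    + suc d * (+ suc (n ℕ.+ j) * + ((n ℕ.+ j) !) * + (d !)) ≡⟨ swap (+ suc d) (+ suc (n ℕ.+ j)) (+ ((n ℕ.+ j) !)) (+ (d !)) ⟩
    + suc (n ℕ.+ j) * (+ ((n ℕ.+ j) !) * (+ suc d * + (d !))) ≡⟨ cong (λ w → + suc (n ℕ.+ j) * (+ ((n ℕ.+ j) !) * w)) (trans (sym (ℤ.pos-* (suc d) (d !))) (cong (λ k → + (k !)) 1+d≡n-j)) ⟩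
    + suc (n ℕ.+ j) * (+ ((n ℕ.+ j) !) * + ((n ∸ j) !)) ≈⟨ *-≈ 1+n+j≈-1-d (!-reflect j (ℕ.<⇒≤ j<n)) ⟩
    - + suc d * (-1ℤ ^ j * (+ (n !) * + (n !))) ≡⟨ rearrange (+ suc d) (-1ℤ ^ j) (+ (n !) * + (n !)) ⟩
    + suc d * (-1ℤ ^ suc j * (+ (n !) * + (n !))) ∎)
    where
    open ≈-Reasoning (+ p)
    d = n ∸ suc j
    1+d≡n-j : suc d ≡ n ∸ j
    1+d≡n-j = sym (ℕ.+-∸-assoc 1 j<n)
    swap : ∀ a b c d → a * (b * c * d) ≡ b * (c * (a * d))
    swap = solve-∀
    rearrange : ∀ a s f → - a * (s * f) ≡ a * (-1ℤ * s * f)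
    rearrange = solve-∀
    sum-p : suc (n ℕ.+ j) ℕ.+ suc d ≡ p
    sum-p = trans (cong (suc (n ℕ.+ j) ℕ.+_) 1+d≡n-j) (cong suc (trans (ℕ.+-assoc n j (n ∸ j)) (trans (cong (n ℕ.+_) (ℕ.m+[n∸m]≡n (ℕ.<⇒≤ j<n))) n+n≡q)))
    minus-lemma : ∀ a b → a ≡ - b + (a + b)
    minus-lemma = solve-∀
    1+n+j≈-1-d : + suc (n ℕ.+ j) ≈ - + suc d ⟨ + p ⟩
    1+n+j≈-1-d = ≈-trans (≈-reflexive (trans (minus-lemma (+ suc (n ℕ.+ j)) (+ suc d)) (cong (λ k → - + suc d + + k) sum-p)))
        (≈-trans (+-≈ˡ (- + suc d) M≈0) (≈-reflexive (ℤ.+-identityʳ (- + suc d))))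

  n!²≈-1 : + (n !) * + (n !) ≈ -1ℤ ⟨ + p ⟩
  n!²≈-1 = begin
    + (n !) * + (n !) ≡⟨ trans (cong (_* (+ (n !) * + (n !))) (-1^2*k≡1 m)) (ℤ.*-identityˡ _) ⟨
    -1ℤ ^ n * (+ (n !) * + (n !)) ≈⟨ !-reflect n ℕ.≤-refl ⟨
    + ((n ℕ.+ n) !) * + ((n ∸ n) !) ≡⟨ cong₂ (λ j k → + (j !) * + (k !)) n+n≡q (ℕ.n∸n≡0 n) ⟩
    + ((4 ℕ.* m) !) * + 1 ≡⟨ ℤ.*-identityʳ _ ⟩
    + ((4 ℕ.* m) !) ≈⟨ wilson ⟩
    -1ℤ ∎
    where open ≈-Reasoning (+ p)

  O : ℕ → ℤ
  O k = ∑ k (λ i → inv (+ 2 * + i + + 1))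

  Unit-2i+1 : ∀ i → i < n → Unit (+ 2 * + i + + 1)
  Unit-2i+1 i i<n = subst Unit (trans (ℤ.+-comm (+ 1) (+ (2 ℕ.* i))) (cong (_+ + 1) (ℤ.pos-* 2 i)))
    (Unit-1+ (2 ℕ.* i) (ℕ.<-≤-trans (ℕ.*-monoʳ-< 2 i<n) (ℕ.≤-reflexive (trans (cong (n ℕ.+_) (ℕ.+-identityʳ n)) n+n≡q))))

  -- Compare consecutive ratios: 2(2k + 1)/(k + 1) for `cb`, and -4(n - k)/(k + 1) for (-4)ᵏ C(n,
  -- k). Since 2n = p - 1, -4(n - k) = 2(2k + 1) - 2p, so the ratios differ by the factor 1 - p/(2k
  -- + 1), whose inverse 1 + p/(2k + 1) accumulates in `O`.
  cb≈ : ∀ k → k ≤ n → cb k ≈ (- + 4) ^ k * B n k * (+ 1 + + p * O k) ⟨ + p * + p ⟩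
  cb≈ zero _ = ≈-reflexive (trans cb-zero (sym (trans (cong (λ b → + 1 * b * (+ 1 + + p * + 0)) (B-zero n)) (lemma (+ p)))))
    where
    lemma : ∀ P → + 1 * + 1 * (+ 1 + P * + 0) ≡ + 1
    lemma = solve-∀
  cb≈ (suc k) k<n = *-cancelˡ-≈ (+ suc k) (Unit-1+ k (ℕ.<-trans k<n n<q)) (begin
    + suc k * cb (suc k) ≡⟨ cb-suc k ⟩
    + 2 * t * cb k ≈⟨ *-≈ˡ (+ 2 * t) (cb≈ k (ℕ.<⇒≤ k<n)) ⟩
    -- The zero 2p · 1 - 2p is inserted so that its 1 can become t · inv t; the bracket is then (2t
    -- - 2p)(1 + p (O k + inv t)) up to a multiple of p².
    + 2 * t * (w * (+ 1 + + p * O k)) ≡⟨ expand t w (+ p) (O k) ⟩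
    w * (+ 2 * t + + 2 * + p * t * O k + + 2 * + p * + 1 - + 2 * + p)
      ≈⟨ *-≈ˡ w (−-≈ (+-≈ˡ (+ 2 * t + + 2 * + p * t * O k) (*-≈ˡ (+ 2 * + p) (x*inv[x]≈1 (Unit-2i+1 k k<n)))) (≈-refl {x = + 2 * + p})) ⟨
    w * (+ 2 * t + + 2 * + p * t * O k + + 2 * + p * (t * inv t) - + 2 * + p)
      ≈⟨ by (w * + 2 * (O k + inv t)) (quadratic w t (+ p) (O k) (inv t)) ⟩
    w * (+ 2 * t - + 2 * + p) * (+ 1 + + p * (O k + inv t)) ≡⟨ cong (λ x → w * x * (+ 1 + + p * (O k + inv t))) linear ⟨
    w * (- + 4 * (+ n - + k)) * (+ 1 + + p * (O k + inv t)) ≡⟨ regroup ((- + 4) ^ k) (B n k) (+ n - + k) (+ 1 + + p * (O k + inv t)) ⟩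
    (- + 4) ^ suc k * ((+ n - + k) * B n k) * (+ 1 + + p * O (suc k)) ≡⟨ cong (λ x → (- + 4) ^ suc k * x * (+ 1 + + p * O (suc k))) (B-stepʳ n k) ⟨
    (- + 4) ^ suc k * (+ suc k * B n (suc k)) * (+ 1 + + p * O (suc k)) ≡⟨ regroup′ ((- + 4) ^ suc k) (+ suc k) (B n (suc k)) (+ 1 + + p * O (suc k)) ⟩
    + suc k * ((- + 4) ^ suc k * B n (suc k) * (+ 1 + + p * O (suc k))) ∎)
    where
    open ≈-Reasoning (+ p * + p)
    t w : ℤ
    t = + 2 * + k + + 1
    w = (- + 4) ^ k * B n k
    expand : ∀ t w P o → + 2 * t * (w * (+ 1 + P * o)) ≡ w * (+ 2 * t + + 2 * P * t * o + + 2 * P * + 1 - + 2 * P)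
    expand = solve-∀
    quadratic : ∀ w t P o i → w * (+ 2 * t + + 2 * P * t * o + + 2 * P * (t * i) - + 2 * P)
        ≡ w * (+ 2 * t - + 2 * P) * (+ 1 + P * (o + i)) + w * + 2 * (o + i) * (P * P)
    quadratic = solve-∀
    regroup : ∀ s b d e → s * b * (- + 4 * d) * e ≡ - + 4 * s * (d * b) * e
    regroup = solve-∀
    regroup′ : ∀ s k b e → s * (k * b) * e ≡ k * (s * b * e)
    regroup′ = solve-∀
    linear : - + 4 * (+ n - + k) ≡ + 2 * t - + 2 * + p
    linear = trans (cong (λ x → - + 4 * (x - + k)) +n≡) (trans (lemma (+ m) (+ k)) (cong (λ x → + 2 * t - + 2 * x) (sym +p≡)))
      where
      lemma : ∀ m k → - + 4 * (+ 2 * m - k) ≡ + 2 * (+ 2 * k + + 1) - + 2 * (+ 1 + + 4 * m)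
      lemma = solve-∀

  n≡m+m : n ≡ m ℕ.+ m
  n≡m+m = cong (m ℕ.+_) (ℕ.+-identityʳ m)

  cb-m*m!² : cb m * (+ (m !) * + (m !)) ≡ + (n !)
  cb-m*m!² = trans (cong (λ j → B j m * (+ (m !) * + (m !))) n≡m+m) (trans (B*!*! m m) (cong (λ j → + (j !)) (sym n≡m+m)))

  Unit-cb-m : Unit (cb m)
  Unit-cb-m = Unit-*ˡ (cb m) (+ (m !) * + (m !)) (subst Unit (sym cb-m*m!²) (Unit-! n n<p))

  -- At k = m the coefficient `B n m` is `cb m` itself, a unit, so the binomials cancel from `cb≈`.
  -- What remains expresses 4ᵐ modulo p² through the odd harmonic sum.
  [-4]^m*[1+pO]≈1 : (- + 4) ^ m * (+ 1 + + p * O m) ≈ + 1 ⟨ + p * + p ⟩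
  [-4]^m*[1+pO]≈1 = ≈-sym (*-cancelˡ-≈ (cb m) Unit-cb-m (≈-trans (≈-reflexive (ℤ.*-identityʳ (cb m))) (≈-trans (cb≈ m m≤n)
    (≈-reflexive (lemma ((- + 4) ^ m) (cb m) (+ 1 + + p * O m))))))
    where
    lemma : ∀ s b e → s * b * e ≡ b * (s * e)
    lemma = solve-∀

  -- As 4ᵐ = 2ⁿ, this is the supplementary law χ(2) = (-1)ᵐ; it is the reduction modulo p of the
  -- preceding congruence.
  4^m≈[-1]^m : (+ 4) ^ m ≈ -1ℤ ^ m ⟨ + p ⟩
  4^m≈[-1]^m = begin
    (+ 4) ^ m ≡⟨ trans (cong (_* (+ 4) ^ m) (-1^k*-1^k≡1 m)) (ℤ.*-identityˡ _) ⟨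
    -1ℤ ^ m * -1ℤ ^ m * (+ 4) ^ m ≡⟨ trans (ℤ.*-assoc (-1ℤ ^ m) (-1ℤ ^ m) ((+ 4) ^ m)) (cong (_*_ (-1ℤ ^ m)) (sym (^-distribʳ-* -1ℤ (+ 4) m))) ⟩
    -1ℤ ^ m * (- + 4) ^ m ≡⟨ cong (_*_ (-1ℤ ^ m)) (trans (cong (_*_ ((- + 4) ^ m)) (ℤ.+-identityʳ (+ 1))) (ℤ.*-identityʳ ((- + 4) ^ m))) ⟨
    -1ℤ ^ m * ((- + 4) ^ m * (+ 1 + + 0)) ≈⟨ *-≈ˡ (-1ℤ ^ m) (*-≈ˡ ((- + 4) ^ m) (+-≈ˡ (+ 1) (M*≈0 (O m)))) ⟨
    -1ℤ ^ m * ((- + 4) ^ m * (+ 1 + + p * O m)) ≈⟨ *-≈ˡ (-1ℤ ^ m) (≈-weaken (+ p) [-4]^m*[1+pO]≈1) ⟩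
    -1ℤ ^ m * + 1 ≡⟨ ℤ.*-identityʳ (-1ℤ ^ m) ⟩
    -1ℤ ^ m ∎
    where open ≈-Reasoning (+ p)

-- Evaluation of S(1) by sums of two squares and a congruence modulo 4

PlusMinusOne-^ : ∀ k → PlusMinusOne (-1ℤ ^ k)
PlusMinusOne-^ zero = plus
PlusMinusOne-^ (suc k) = PlusMinusOne-* minus (PlusMinusOne-^ k)

PlusMinusOne⇒Sign₀ : ∀ {x} → PlusMinusOne x → Sign₀ x
PlusMinusOne⇒Sign₀ plus = plus
PlusMinusOne⇒Sign₀ minus = minus

2≉0⟨4⟩ : ¬ + 2 ≈ + 0 ⟨ + 4 ⟩
2≉0⟨4⟩ (by k eq) = ℕ.>⇒∤ (s≤s (s≤s (s≤s z≤n))) (Signed.∣⇒∣ᵤ {+ 4} {+ 2} (Signed.divides k (trans eq (ℤ.+-identityˡ (k * + 4)))))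

2k-1≈-[-1]^k : ∀ k → + 2 * + k - + 1 ≈ - (-1ℤ ^ k) ⟨ + 4 ⟩
2k-1≈-[-1]^k zero = ≈-refl
2k-1≈-[-1]^k (suc k) = ≈-trans (≈-reflexive (lemma (+ k))) (≈-trans (+-≈ (2k-1≈-[-1]^k k) (≈-refl {x = + 2})) (step (PlusMinusOne-^ k)))
  where
  lemma : ∀ k → + 2 * (+ 1 + k) - + 1 ≡ + 2 * k - + 1 + + 2
  lemma = solve-∀
  step : ∀ {s} → PlusMinusOne s → - s + + 2 ≈ - (-1ℤ * s) ⟨ + 4 ⟩
  step plus = by (+ 0) refl
  step minus = by (+ 1) refl

module JacobsthalEvaluation (m : ℕ) (p-prime : Prime (suc (4 ℕ.* m))) where

  open CentralBinomialCongruences m p-prime public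

  private
    f : ℤ → ℤ → ℤ
    f r x = χ x * χ (x * x - r)

    f-periodic : ∀ r → Periodic (f r)
    f-periodic r e = cong₂ _*_ (χ-periodic e) (χ-periodic (−-≈ (*-≈ e e) (≈-refl {x = r})))

    f-even : ∀ r x → f r (- x) ≡ f r x
    f-even r x = cong₂ _*_ (χ-neg x) (cong (λ y → χ (y - r)) (lemma x))
      where
      lemma : ∀ x → - x * - x ≡ x * x
      lemma = solve-∀

  G : ℤ → ℤ
  G r = ∑ n (λ i → f r (+ suc i))

  -- The summand is even in x because χ(-1) = 1, so x and p - x contribute equally.
  S≡2G : ∀ r → S r ≡ + 2 * G r
  S≡2G r = begin
    S r ≡⟨ ∑-head (4 ℕ.* m) (λ i → f r (+ i)) ⟩
    f r (+ 0) + ∑ (4 ℕ.* m) (λ i → f r (+ suc i)) ≡⟨ cong₂ (λ u v → u + ∑ v (λ i → f r (+ suc i)))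
        (trans (cong (_* χ (+ 0 * + 0 - r)) (χ-0 ≈-refl)) (ℤ.*-zeroˡ (χ (+ 0 * + 0 - r)))) (sym n+n≡q) ⟩
    + 0 + ∑ (n ℕ.+ n) (λ i → f r (+ suc i)) ≡⟨ trans (ℤ.+-identityˡ _) (∑-split n n (λ i → f r (+ suc i))) ⟩
    G r + ∑ n (λ i → f r (+ suc (n ℕ.+ i))) ≡⟨ cong (_+_ (G r)) (trans (∑-reverse n (λ i → f r (+ suc (n ℕ.+ i)))) (∑-cong n reflect)) ⟩
    G r + G r ≡⟨ lemma (G r) ⟩
    + 2 * G r ∎
    where
    open ≡-Reasoning
    lemma : ∀ g → g + g ≡ + 2 * g
    lemma = solve-∀
    minus-lemma : ∀ a b → a ≡ - b + (a + b)
    minus-lemma = solve-∀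
    total : ∀ i → i < n → suc (n ℕ.+ (n ∸ suc i)) ℕ.+ suc i ≡ p
    total i i<n = cong suc (trans (ℕ.+-assoc n (n ∸ suc i) (suc i)) (trans (cong (n ℕ.+_) (ℕ.m∸n+n≡m i<n)) n+n≡q))
    reflect : ∀ i → i < n → f r (+ suc (n ℕ.+ (n ∸ suc i))) ≡ f r (+ suc i)
    reflect i i<n = trans (f-periodic r (≈-trans
      (≈-reflexive (trans (minus-lemma (+ suc (n ℕ.+ (n ∸ suc i))) (+ suc i)) (cong (λ k → - + suc i + + k) (total i i<n))))
      (≈-trans (+-≈ˡ (- + suc i) M≈0) (≈-reflexive (ℤ.+-identityʳ (- + suc i)))))) (f-even r (+ suc i))

  G²+G²≡p : ∀ {g} → Unit g → χ g ≡ -1ℤ → G (+ 1) * G (+ 1) + G g * G g ≡ + p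
  G²+G²≡p {g} g≉0 χg = ℤ.*-cancelˡ-≡ (+ 4) _ _ (trans (lemma (G (+ 1)) (G g))
    (trans (sym (cong₂ _+_ (cong₂ _*_ (S≡2G (+ 1)) (S≡2G (+ 1))) (cong₂ _*_ (S≡2G g) (S≡2G g)))) (S²[1]+S²[g]≡4p g≉0 χg)))
    where
    lemma : ∀ a b → + 4 * (a * a + b * b) ≡ + 2 * a * (+ 2 * a) + + 2 * b * (+ 2 * b)
    lemma = solve-∀

  private
    2+i²-1≡ : ∀ i → + suc (suc i) * + suc (suc i) - + 1 ≡ + suc i * + suc (suc (suc i))
    2+i²-1≡ i = lemma (+ i)
      where
      lemma : ∀ i → (+ 2 + i) * (+ 2 + i) - + 1 ≡ (+ 1 + i) * (+ 3 + i)
      lemma = solve-∀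

    χ! : ∀ k → χ (+ (suc k !)) ≡ χ (+ suc k) * χ (+ (k !))
    χ! k = trans (cong χ (ℤ.pos-* (suc k) (k !))) (χ-* (+ suc k) (+ (k !)))

    -- With x = i + 2 the sign is χ of (i + 1)(i + 2)(i + 3), so the product consists of three
    -- factorials. The last one starts at 3, and χ(2) makes up for its missing factor 2.
    ∏f≡ : ∀ N → ∏ N (λ i → f (+ 1) (+ suc (suc i))) ≡ χ (+ 2) * (χ (+ (suc N !)) * χ (+ (N !)) * χ (+ (suc (suc N) !)))
    ∏f≡ zero = sym (trans (cong (λ u → χ (+ 2) * (u * u * χ (+ 2))) χ-1) (trans (lemma (χ (+ 2))) (χ-unit² Unit-2)))
      where
      lemma : ∀ c → c * (+ 1 * + 1 * c) ≡ c * c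
      lemma = solve-∀
    ∏f≡ (suc N) = trans (cong₂ _*_ (∏f≡ N) (cong (_*_ (χ (+ suc (suc N)))) (trans (cong χ (2+i²-1≡ N)) (χ-* (+ suc N) (+ suc (suc (suc N)))))))
      (trans (lemma (χ (+ 2)) (χ (+ (suc N !))) (χ (+ (N !))) (χ (+ (suc (suc N) !))) (χ (+ suc (suc N))) (χ (+ suc N)) (χ (+ suc (suc (suc N)))))
             (sym (trans (cong₂ (λ u v → χ (+ 2) * (u * χ (+ (suc N !)) * v)) (χ! (suc N)) (χ! (suc (suc N))))
                 (cong (λ u → χ (+ 2) * (χ (+ suc (suc N)) * χ (+ (suc N !)) * u * (χ (+ suc (suc (suc N))) * χ (+ (suc (suc N) !))))) (χ! N)))))
      where
      lemma : ∀ c u v w x y z → c * (u * v * w) * (x * (y * z)) ≡ c * (x * u * (y * v) * (z * w))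
      lemma = solve-∀

    χ2≡ : χ (+ 2) ≡ -1ℤ ^ m
    χ2≡ = χ-≡ (PlusMinusOne⇒Sign₀ (PlusMinusOne-^ m)) (≈-trans (≈-reflexive (sym (ℤ.^-*-assoc (+ 2) 2 m))) 4^m≈[-1]^m)

    χ[n!]≡ : χ (+ (n !)) ≡ -1ℤ ^ m
    χ[n!]≡ = χ-≡ (PlusMinusOne⇒Sign₀ (PlusMinusOne-^ m)) (≈-trans
      (≈-reflexive (trans (sym (ℤ.^-*-assoc (+ (n !)) 2 m)) (cong (_^ m) (cong (_*_ (+ (n !))) (ℤ.*-identityʳ (+ (n !)))))))
      (^-≈ m n!²≈-1))

    2[1+n]≈1 : + 2 * + suc n ≈ + 1 ⟨ + p ⟩
    2[1+n]≈1 = ≈-trans (≈-reflexive (lemma (+ n))) (+-≈ˡ (+ 2) 2n≈-1)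
      where
      lemma : ∀ n → + 2 * (+ 1 + n) ≡ + 2 + + 2 * n
      lemma = solve-∀

    ∏f≡1 : ∏ n′ (λ i → f (+ 1) (+ suc (suc i))) ≡ + 1
    ∏f≡1 = begin
      ∏ n′ (λ i → f (+ 1) (+ suc (suc i))) ≡⟨ ∏f≡ n′ ⟩
      c * (χ (+ (suc n′ !)) * v * χ (+ (suc (suc n′) !))) ≡⟨ cong (λ k → c * (χ (+ (k !)) * v * χ (+ (suc k !)))) 1+n′≡n ⟩
      c * (w * v * χ (+ (suc n !))) ≡⟨ cong₂ (λ x y → c * (x * v * y)) w≡av (χ! n) ⟩
      -- Inserting χ(2)² = 1 pairs n and n + 1 with a factor 2 each, where 2n ≡ -1 and 2(n + 1) ≡ 1;
      -- one more factor 2 stays with n!.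
      c * (a * v * v * (b * w)) ≡⟨ trans (sym (ℤ.*-identityʳ _)) (cong (_*_ (c * (a * v * v * (b * w)))) (sym (χ-unit² Unit-2))) ⟩
      c * (a * v * v * (b * w)) * (c * c) ≡⟨ lemma a b c v w ⟩
      c * a * (c * b) * (v * v) * (w * c) ≡⟨ cong₂ (λ x y → x * y * (w * c)) (cong₂ _*_ (trans (sym (χ-* (+ 2) (+ n))) (trans (χ-periodic 2n≈-1) χ--1))
          (trans (sym (χ-* (+ 2) (+ suc n))) (trans (χ-periodic 2[1+n]≈1) χ-1)))
          (χ-unit² (Unit-! n′ (ℕ.<-trans (ℕ.≤-reflexive 1+n′≡n) n<p))) ⟩
      + 1 * (w * c) ≡⟨ trans (ℤ.*-identityˡ _) (cong₂ _*_ χ[n!]≡ χ2≡) ⟩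
      -1ℤ ^ m * -1ℤ ^ m ≡⟨ -1^k*-1^k≡1 m ⟩
      + 1 ∎
      where
      open ≡-Reasoning
      a b c v w : ℤ
      a = χ (+ n)
      b = χ (+ suc n)
      c = χ (+ 2)
      v = χ (+ (n′ !))
      w = χ (+ (n !))
      w≡av : w ≡ a * v
      w≡av = trans (cong (λ k → χ (+ (k !))) (sym 1+n′≡n)) (trans (χ! n′) (cong (λ k → χ (+ k) * v) 1+n′≡n))
      lemma : ∀ a b c v w → c * (a * v * v * (b * w)) * (c * c) ≡ c * a * (c * b) * (v * v) * (w * c)
      lemma = solve-∀

    unit-sign : ∀ {x} → Unit x → PlusMinusOne (χ x)
    unit-sign {x} x≉0 = nonzero (χ-sign x) (χ-unit² x≉0)
      where
      nonzero : ∀ {c} → Sign₀ c → c * c ≡ + 1 → PlusMinusOne c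
      nonzero zero ()
      nonzero plus _ = plus
      nonzero minus _ = minus

  -- The term x = 1 vanishes. The other n - 1 terms are signs with product 1, so by `∑-signs` they
  -- add up to n - 1 = 2m - 1 modulo 4.
  G[1]≈-[-1]^m : G (+ 1) ≈ - (-1ℤ ^ m) ⟨ + 4 ⟩
  G[1]≈-[-1]^m = begin
    G (+ 1) ≡⟨ cong (λ k → ∑ k (λ i → f (+ 1) (+ suc i))) 1+n′≡n ⟨
    ∑ (suc n′) (λ i → f (+ 1) (+ suc i)) ≡⟨ ∑-head n′ (λ i → f (+ 1) (+ suc i)) ⟩
    χ (+ 1) * χ (+ 0) + ∑ n′ (λ i → f (+ 1) (+ suc (suc i))) ≡⟨ cong (_+ ∑ n′ (λ i → f (+ 1) (+ suc (suc i)))) (trans (cong (_*_ (χ (+ 1))) (χ-0 ≈-refl)) (ℤ.*-zeroʳ (χ (+ 1)))) ⟩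
    + 0 + ∑ n′ (λ i → f (+ 1) (+ suc (suc i))) ≡⟨ ℤ.+-identityˡ _ ⟩
    ∑ n′ (λ i → f (+ 1) (+ suc (suc i))) ≈⟨ ∑-signs n′ signs ⟩
    + n′ + ∏ n′ (λ i → f (+ 1) (+ suc (suc i))) - + 1 ≡⟨ cong (λ u → + n′ + u - + 1) ∏f≡1 ⟩
    + n′ + + 1 - + 1 ≡⟨ lemma (+ n′) ⟩
    + suc n′ - + 1 ≡⟨ cong (_- + 1) (trans (cong +_ 1+n′≡n) +n≡) ⟩
    + 2 * + m - + 1 ≈⟨ 2k-1≈-[-1]^k m ⟩
    - (-1ℤ ^ m) ∎
    where
    open ≈-Reasoning (+ 4)
    lemma : ∀ n → n + + 1 - + 1 ≡ + 1 + n - + 1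
    lemma = solve-∀
    signs : ∀ i → i < n′ → PlusMinusOne (f (+ 1) (+ suc (suc i)))
    signs i i<n′ = PlusMinusOne-* (unit-sign (Unit-1+ (suc i) (ℕ.<-trans 1+i<n n<q)))
      (subst PlusMinusOne (sym (trans (cong χ (2+i²-1≡ i)) (χ-* (+ suc i) (+ suc (suc (suc i))))))
        (PlusMinusOne-* (unit-sign (Unit-1+ i (ℕ.<-trans (ℕ.n<1+n i) (ℕ.<-trans 1+i<n n<q)))) (unit-sign (Unit-1+ (suc (suc i)) (ℕ.≤-<-trans 1+i<n n<q)))))
      where
      1+i<n : suc i < n
      1+i<n = ℕ.<-≤-trans (s≤s i<n′) (ℕ.≤-reflexive 1+n′≡n)

  +p≈1⟨2⟩ : + p ≈ + 1 ⟨ + 2 ⟩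
  +p≈1⟨2⟩ = by (+ 2 * + m) (trans +p≡ (lemma (+ m)))
    where
    lemma : ∀ m → + 1 + + 4 * m ≡ + 1 + + 2 * m * + 2
    lemma = solve-∀

  odd²+b²≡p⇒b-even : ∀ a b → a * a + b * b ≡ + p → a ≈ + 1 ⟨ + 2 ⟩ → b ≈ + 0 ⟨ + 2 ⟩
  odd²+b²≡p⇒b-even a b eq a≈1 = begin
    b ≈⟨ x*x≈x⟨2⟩ b ⟨
    b * b ≡⟨ lemma (a * a) (b * b) ⟩
    a * a + b * b - a * a ≡⟨ cong (_- a * a) eq ⟩
    + p - a * a ≈⟨ −-≈ +p≈1⟨2⟩ (*-≈ a≈1 a≈1) ⟩
    + 0 ∎
    where
    open ≈-Reasoning (+ 2)
    lemma : ∀ x y → y ≡ x + y - x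
    lemma = solve-∀

  -- A nonzero even k would make k² p² at least 4p².
  k²p²+z²≡p²⇒k≡0 : ∀ k z → k ≈ + 0 ⟨ + 2 ⟩ → k * + p * (k * + p) + z * z ≡ + p * + p → k ≡ + 0
  k²p²+z²≡p²⇒k≡0 k z (by l k≡2l) eq = trans k≡2l (trans (ℤ.+-identityˡ (l * + 2)) (cong (_* + 2) (l≡0 (∑-squares-≥0 1 (λ _ → l)) (∑-squares-≥0 1 (λ _ → z)))))
    where
    lemma : ∀ l P z → (+ 0 + l * + 2) * P * ((+ 0 + l * + 2) * P) + z * z ≡ (+ 0 + l * l) * (+ 4 * (P * P)) + (+ 0 + z * z)
    lemma = solve-∀
    l≡0 : (∃ λ i → + 0 + l * l ≡ + i) → (∃ λ j → + 0 + z * z ≡ + j) → l ≡ + 0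
    l≡0 (zero , l²≡0) _ = [ id , id ]′ (ℤ.i*j≡0⇒i≡0∨j≡0 l (trans (sym (ℤ.+-identityˡ (l * l))) l²≡0))
    l≡0 (suc i , l²≡) (j , z²≡) = contradiction
      (ℤ.+-injective (trans (trans (cong (_+ + j) (trans (ℤ.pos-* (suc i) (4 ℕ.* (p ℕ.* p))) (cong (_*_ (+ suc i)) (trans (ℤ.pos-* 4 (p ℕ.* p)) (cong (_*_ (+ 4)) (ℤ.pos-* p p))))))
        (trans (sym (cong₂ (λ u v → u * (+ 4 * (+ p * + p)) + v) l²≡ z²≡)) (trans (sym (lemma l (+ p) z)) (subst (λ u → u * + p * (u * + p) + z * z ≡ + p * + p) k≡2l eq)))) (sym (ℤ.pos-* p p))))
      (ℕ.>⇒≢ (ℕ.<-≤-trans (ℕ.m<m*n (p ℕ.* p) 4 (s≤s (s≤s z≤n))) (ℕ.≤-trans (ℕ.≤-reflexive (ℕ.*-comm (p ℕ.* p) 4)) (ℕ.≤-trans (ℕ.m≤m+n (4 ℕ.* (p ℕ.* p)) (i ℕ.* (4 ℕ.* (p ℕ.* p)))) (ℕ.m≤m+n _ j)))))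

  -- By Brahmagupta's identity (ad - cb)² + (ac + bd)² = p². The multiple ad - cb = k p has k even,
  -- because b and d are even, so k = 0; then a² (c² + d²) = c² (a² + b²) forces a² = c².
  two-squares-unique-∣ : ∀ a b c d → a * a + b * b ≡ + p → c * c + d * d ≡ + p → a ≈ + 1 ⟨ + 2 ⟩ → c ≈ + 1 ⟨ + 2 ⟩ →
      a * d - c * b ≈ + 0 ⟨ + p ⟩ → a ≡ c ⊎ a ≡ - c
  two-squares-unique-∣ a b c d ab cd a≈1 c≈1 (by k x≡0+kp) =
    [ (λ e → inj₁ (ℤ.i-j≡0⇒i≡j a c e)) , (λ e → inj₂ (trans (cancel a c) (trans (cong (_- c) e) (ℤ.+-identityˡ (- c))))) ]′ (ℤ.i*j≡0⇒i≡0∨j≡0 (a - c) [a-c][a+c]≡0)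
    where
    cancel : ∀ a c → a ≡ a + c - c
    cancel = solve-∀
    x≡kp : a * d - c * b ≡ k * + p
    x≡kp = trans x≡0+kp (ℤ.+-identityˡ (k * + p))
    brahmagupta : ∀ a b c d → (a * d - c * b) * (a * d - c * b) + (a * c + b * d) * (a * c + b * d) ≡ (a * a + b * b) * (c * c + d * d)
    brahmagupta = solve-∀
    k≈0 : k ≈ + 0 ⟨ + 2 ⟩
    k≈0 = begin
      k ≡⟨ ℤ.*-identityʳ k ⟨
      k * + 1 ≈⟨ *-≈ˡ k +p≈1⟨2⟩ ⟨
      k * + p ≡⟨ x≡kp ⟨
      a * d - c * b ≈⟨ −-≈ (*-≈ˡ a (odd²+b²≡p⇒b-even c d cd c≈1)) (*-≈ˡ c (odd²+b²≡p⇒b-even a b ab a≈1)) ⟩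
      a * + 0 - c * + 0 ≡⟨ cong₂ _-_ (ℤ.*-zeroʳ a) (ℤ.*-zeroʳ c) ⟩
      + 0 ∎
      where open ≈-Reasoning (+ 2)
    k≡0 : k ≡ + 0
    k≡0 = k²p²+z²≡p²⇒k≡0 k (a * c + b * d) k≈0
      (trans (cong (λ u → u * u + (a * c + b * d) * (a * c + b * d)) (sym x≡kp)) (trans (brahmagupta a b c d) (cong₂ _*_ ab cd)))
    x≡0 : a * d - c * b ≡ + 0
    x≡0 = trans x≡kp (trans (cong (_* + p) k≡0) (ℤ.*-zeroˡ (+ p)))
    lemma : ∀ a b c d → (a * a + b * b) * ((a - c) * (a + c)) ≡ a * a * (a * a + b * b - (c * c + d * d)) + (a * d - c * b) * (a * d + c * b)
    lemma = solve-∀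
    [a-c][a+c]≡0 : (a - c) * (a + c) ≡ + 0
    [a-c][a+c]≡0 = ℤ.*-cancelˡ-≡ (+ p) _ _ (begin
      + p * ((a - c) * (a + c)) ≡⟨ cong (_* ((a - c) * (a + c))) ab ⟨
      (a * a + b * b) * ((a - c) * (a + c)) ≡⟨ lemma a b c d ⟩
      a * a * (a * a + b * b - (c * c + d * d)) + (a * d - c * b) * (a * d + c * b)
        ≡⟨ cong₂ (λ u v → a * a * u + v * (a * d + c * b)) (trans (cong₂ _-_ ab cd) (ℤ.+-inverseʳ (+ p))) x≡0 ⟩
      a * a * + 0 + + 0 * (a * d + c * b) ≡⟨ zeroes (a * a) (a * d + c * b) (+ p) ⟩
      + p * + 0 ∎)
      where
      open ≡-Reasoning
      zeroes : ∀ x y P → x * + 0 + + 0 * y ≡ P * + 0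
      zeroes = solve-∀

  -- The product (ad - cb)(ad + cb) = p (a² - c²) is divisible by p, hence so is one factor. The
  -- second case is the first with -b for b.
  two-squares-unique : ∀ a b c d → a * a + b * b ≡ + p → c * c + d * d ≡ + p → a ≈ + 1 ⟨ + 2 ⟩ → c ≈ + 1 ⟨ + 2 ⟩ → a ≡ c ⊎ a ≡ - c
  two-squares-unique a b c d ab cd a≈1 c≈1 =
    [ two-squares-unique-∣ a b c d ab cd a≈1 c≈1
    , (λ e → two-squares-unique-∣ a (- b) c d (trans (cong (_+_ (a * a)) (neg² b)) ab) cd a≈1 c≈1 (≈-trans (≈-reflexive (neg-lemma a b c d)) e))
    ]′ (x*y≈0⇒x≈0∨y≈0 (a * d - c * b) (a * d + c * b) (≈-trans (≈-reflexive (lemma a b c d)) (≈-trans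
        (≈-reflexive (cong₂ (λ u v → a * a * u - c * c * v) cd ab)) (≈-trans (≈-reflexive (factor (a * a) (c * c) (+ p))) (M*≈0 (a * a - c * c))))))
    where
    neg² : ∀ b → - b * - b ≡ b * b
    neg² = solve-∀
    neg-lemma : ∀ a b c d → a * d - c * - b ≡ a * d + c * b
    neg-lemma = solve-∀
    lemma : ∀ a b c d → (a * d - c * b) * (a * d + c * b) ≡ a * a * (c * c + d * d) - c * c * (a * a + b * b)
    lemma = solve-∀
    factor : ∀ x y P → x * P - y * P ≡ P * (x - y)
    factor = solve-∀

  S[1]≡ : ∀ a b → a * a + b * b ≡ + p → a ≈ + 1 ⟨ + 4 ⟩ → S (+ 1) ≡ - (+ 2 * (-1ℤ ^ m * a))
  S[1]≡ a b ab a≈1 = trans (S≡2G (+ 1)) (trans (cong (_*_ (+ 2)) G≡) (lemma (-1ℤ ^ m * a)))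
    where
    lemma : ∀ x → + 2 * - x ≡ - (+ 2 * x)
    lemma = solve-∀
    weaken : ∀ {x y} → x ≈ y ⟨ + 4 ⟩ → x ≈ y ⟨ + 2 ⟩
    weaken = ≈-weaken (+ 2)
    sign-odd : ∀ {s} → PlusMinusOne s → - s ≈ + 1 ⟨ + 2 ⟩
    sign-odd plus = by -1ℤ refl
    sign-odd minus = ≈-refl
    -- As a ≡ 1 (mod 4), the wrong sign would give 1 ≡ -1 (mod 4).
    choose : ∀ {s} → PlusMinusOne s → G (+ 1) ≈ - s ⟨ + 4 ⟩ → G (+ 1) ≡ a ⊎ G (+ 1) ≡ - a → G (+ 1) ≡ - (s * a)
    choose plus G≈ (inj₁ G≡a) = contradiction (x≈y⇒x-y≈0 {x = + 1} {y = -1ℤ} (≈-trans (≈-sym a≈1) (≈-trans (≈-reflexive (sym G≡a)) G≈))) 2≉0⟨4⟩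
    choose plus G≈ (inj₂ G≡-a) = trans G≡-a (cong -_ (sym (ℤ.*-identityˡ a)))
    choose minus G≈ (inj₁ G≡a) = trans G≡a (sym (trans (cong -_ (ℤ.-1*i≡-i a)) (ℤ.neg-involutive a)))
    choose minus G≈ (inj₂ G≡-a) = contradiction (x≈y⇒x-y≈0 {x = + 1} {y = -1ℤ} (≈-trans (≈-sym G≈) (≈-trans (≈-reflexive G≡-a) (neg-≈ a≈1)))) 2≉0⟨4⟩
    G≡ : G (+ 1) ≡ - (-1ℤ ^ m * a)
    G≡ = case nonresidue of λ (g , g≉0 , χg≡-1) → choose (PlusMinusOne-^ m) G[1]≈-[-1]^m
      (two-squares-unique (G (+ 1)) (G g) a b (G²+G²≡p g≉0 χg≡-1) ab
        (≈-trans (weaken G[1]≈-[-1]^m) (sign-odd (PlusMinusOne-^ m))) (weaken a≈1))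

-- Alternating binomial sums and harmonic sums

∑-B-pascal : ∀ N (g : ℕ → ℤ) → ∑ (suc (suc N)) (λ s → -1ℤ ^ s * B (suc N) s * g s) ≡ ∑ (suc N) (λ s → -1ℤ ^ s * B N s * (g s - g (suc s)))
∑-B-pascal N g = begin
  ∑ (suc (suc N)) (λ s → -1ℤ ^ s * B (suc N) s * g s)
    ≡⟨ ∑-head (suc N) (λ s → -1ℤ ^ s * B (suc N) s * g s) ⟩
  + 1 * B (suc N) 0 * g 0 + ∑ (suc N) (λ s → -1ℤ ^ suc s * B (suc N) (suc s) * g (suc s))
    ≡⟨ cong₂ (λ b t → + 1 * b * g 0 + t) (trans (B-zero (suc N)) (sym (B-zero N)))
             (trans (∑-ext (suc N) (λ s → trans (cong (λ b → -1ℤ ^ suc s * b * g (suc s)) (B-pascal N s)) (expand (-1ℤ ^ s) (B N s) (B N (suc s)) (g (suc s)))))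
                 (∑-− (suc N) (λ s → -1ℤ ^ suc s * B N (suc s) * g (suc s)) (λ s → -1ℤ ^ s * B N s * g (suc s)))) ⟩
  + 1 * B N 0 * g 0 + (∑ (suc N) (λ s → -1ℤ ^ suc s * B N (suc s) * g (suc s)) - ∑ (suc N) (λ s → -1ℤ ^ s * B N s * g (suc s)))
    ≡⟨ trans (sym (ℤ.+-assoc (+ 1 * B N 0 * g 0) _ _)) (cong (_- ∑ (suc N) (λ s → -1ℤ ^ s * B N s * g (suc s))) (trans (sym (∑-head (suc N) (λ s → -1ℤ ^ s * B N s * g s))) last)) ⟩
  ∑ (suc N) (λ s → -1ℤ ^ s * B N s * g s) - ∑ (suc N) (λ s → -1ℤ ^ s * B N s * g (suc s))
    ≡⟨ ∑-− (suc N) _ _ ⟨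
  ∑ (suc N) (λ s → -1ℤ ^ s * B N s * g s - -1ℤ ^ s * B N s * g (suc s))
    ≡⟨ ∑-ext (suc N) (λ s → factor (-1ℤ ^ s * B N s) (g s) (g (suc s))) ⟩
  ∑ (suc N) (λ s → -1ℤ ^ s * B N s * (g s - g (suc s))) ∎
  where
  open ≡-Reasoning
  expand : ∀ s a b g → -1ℤ * s * (a + b) * g ≡ -1ℤ * s * b * g - s * a * g
  expand = solve-∀
  factor : ∀ c x y → c * x - c * y ≡ c * (x - y)
  factor = solve-∀
  zeroes : ∀ t c g → t + c * + 0 * g ≡ t
  zeroes = solve-∀
  last : ∑ (suc (suc N)) (λ s → -1ℤ ^ s * B N s * g s) ≡ ∑ (suc N) (λ s → -1ℤ ^ s * B N s * g s)
  last = trans (cong (λ b → ∑ (suc N) (λ s → -1ℤ ^ s * B N s * g s) + -1ℤ ^ suc N * b * g (suc N)) (B-above (ℕ.n<1+n N)))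
      (zeroes (∑ (suc N) (λ s → -1ℤ ^ s * B N s * g s)) (-1ℤ ^ suc N) (g (suc N)))

∑-B-partial : ∀ N t → ∑ (suc t) (λ s → -1ℤ ^ s * B (suc N) s) ≡ -1ℤ ^ t * B N t
∑-B-partial N zero = trans (ℤ.+-identityˡ _) (cong (_*_ (+ 1)) (trans (B-zero (suc N)) (sym (B-zero N))))
∑-B-partial N (suc t) = trans (cong₂ (λ u b → u + -1ℤ ^ suc t * b) (∑-B-partial N t) (B-pascal N t)) (lemma (-1ℤ ^ t) (B N t) (B N (suc t)))
  where
  lemma : ∀ s a b → s * a + -1ℤ * s * (a + b) ≡ -1ℤ * s * b
  lemma = solve-∀

module _ (M : ℕ) where

  private
    N = 2 ℕ.* M

    +N≡ : + N ≡ + 2 * + M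
    +N≡ = ℤ.pos-* 2 M

  -- The cut-off is freed from M for the sake of the induction. Splitting off s C(2M+2, s) = (2M+2)
  -- C(2M+1, s-1) gives the value; the bracket 2 C(2M, t) - C(2M+1, t) is C(2M, t) - C(2M, t-1)
  -- written without a predecessor.
  ∑-centred-partial : ∀ t → ∑ (suc t) (λ s → -1ℤ ^ s * B (suc (suc N)) s * (+ suc M - + s)) ≡ -1ℤ ^ t * (+ suc M * (+ 2 * B N t - B (suc N) t))
  ∑-centred-partial zero = trans (cong (λ b → + 0 + + 1 * b * (+ suc M - + 0)) (B-zero (suc (suc N)))) (trans (lemma (+ M))
      (sym (cong₂ (λ a b → + 1 * (+ suc M * (+ 2 * a - b))) (B-zero N) (B-zero (suc N)))))
    where
    lemma : ∀ M → + 0 + + 1 * + 1 * (+ 1 + M - + 0) ≡ + 1 * ((+ 1 + M) * (+ 2 * + 1 - + 1))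
    lemma = solve-∀
  ∑-centred-partial (suc t) = begin
    ∑ (suc t) (λ s → -1ℤ ^ s * B (suc (suc N)) s * (+ suc M - + s)) + -1ℤ ^ suc t * b₂ * (+ suc M - + suc t)
      ≡⟨ cong (_+ -1ℤ ^ suc t * b₂ * (+ suc M - + suc t)) (∑-centred-partial t) ⟩
    -1ℤ ^ t * (+ suc M * (+ 2 * B N t - B (suc N) t)) + -1ℤ ^ suc t * b₂ * (+ suc M - + suc t)
      ≡⟨ expand (-1ℤ ^ t) (+ M) (+ t) (B N t) (B (suc N) t) b₂ ⟩
    -1ℤ ^ suc t * ((+ 2 + + 2 * + M - + suc t) * b₂ - + suc M * (b₂ + (+ 2 * B N t - B (suc N) t)))
      ≡⟨ cong₂ (λ u v → -1ℤ ^ suc t * (u - + suc M * (v + (+ 2 * B N t - B (suc N) t)))) step (B-pascal (suc N) t) ⟩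
    -1ℤ ^ suc t * ((+ 2 + + 2 * + M) * b₁ - + suc M * (B (suc N) t + b₁ + (+ 2 * B N t - B (suc N) t)))
      ≡⟨ cong (λ u → -1ℤ ^ suc t * ((+ 2 + + 2 * + M) * u - + suc M * (B (suc N) t + u + (+ 2 * B N t - B (suc N) t)))) (B-pascal N t) ⟩
    -1ℤ ^ suc t * ((+ 2 + + 2 * + M) * (B N t + B N (suc t)) - + suc M * (B (suc N) t + (B N t + B N (suc t)) + (+ 2 * B N t - B (suc N) t)))
      ≡⟨ collect (-1ℤ ^ suc t) (+ M) (B N t) (B N (suc t)) (B (suc N) t) ⟩
    -1ℤ ^ suc t * (+ suc M * (+ 2 * B N (suc t) - (B N t + B N (suc t))))
      ≡⟨ cong (λ u → -1ℤ ^ suc t * (+ suc M * (+ 2 * B N (suc t) - u))) (B-pascal N t) ⟨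
    -1ℤ ^ suc t * (+ suc M * (+ 2 * B N (suc t) - b₁)) ∎
    where
    open ≡-Reasoning
    b₁ b₂ : ℤ
    b₁ = B (suc N) (suc t)
    b₂ = B (suc (suc N)) (suc t)
    expand : ∀ s M t a b c → s * ((+ 1 + M) * (+ 2 * a - b)) + -1ℤ * s * c * (+ 1 + M - (+ 1 + t))
        ≡ -1ℤ * s * ((+ 2 + + 2 * M - (+ 1 + t)) * c - (+ 1 + M) * (c + (+ 2 * a - b)))
    expand = solve-∀
    collect : ∀ s M a a′ b → s * ((+ 2 + + 2 * M) * (a + a′) - (+ 1 + M) * (b + (a + a′) + (+ 2 * a - b)))
        ≡ s * ((+ 1 + M) * (+ 2 * a′ - (a + a′)))
    collect = solve-∀
    step : (+ 2 + + 2 * + M - + suc t) * b₂ ≡ (+ 2 + + 2 * + M) * b₁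
    step = trans (cong (λ u → (+ 2 + u - + suc t) * b₂) (sym +N≡)) (trans (B-stepˡ (suc N) (suc t)) (cong (λ u → (+ 2 + u) * b₁) +N≡))

  ∑-centred : ∑ (suc M) (λ s → -1ℤ ^ s * B (suc (suc N)) s * (+ suc M - + s)) ≡ -1ℤ ^ M * cb M
  ∑-centred = trans (∑-centred-partial M) (cong (_*_ (-1ℤ ^ M)) (begin
    + suc M * (+ 2 * cb M - B (suc N) M) ≡⟨ distrib (+ M) (cb M) (B (suc N) M) ⟩
    + 2 * + suc M * cb M - (+ 1 + + 2 * + M - + M) * B (suc N) M ≡⟨ cong (λ u → + 2 * + suc M * cb M - (+ 1 + u - + M) * B (suc N) M) +N≡ ⟨
    + 2 * + suc M * cb M - (+ suc N - + M) * B (suc N) M ≡⟨ cong (_-_ (+ 2 * + suc M * cb M)) (trans (B-stepˡ N M) (cong (λ u → (+ 1 + u) * cb M) +N≡)) ⟩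
    + 2 * + suc M * cb M - (+ 1 + + 2 * + M) * cb M ≡⟨ collect (+ M) (cb M) ⟩
    cb M ∎))
    where
    open ≡-Reasoning
    distrib : ∀ M c b → (+ 1 + M) * (+ 2 * c - b) ≡ + 2 * (+ 1 + M) * c - (+ 1 + + 2 * M - M) * b
    distrib = solve-∀
    collect : ∀ M c → + 2 * (+ 1 + M) * c - (+ 1 + + 2 * M) * c ≡ c
    collect = solve-∀

∑-even-odd : ∀ m (g : ℕ → ℤ) → ∑ (2 ℕ.* m) g ≡ ∑ m (λ i → g (2 ℕ.* i) + g (suc (2 ℕ.* i)))
∑-even-odd zero g = refl
∑-even-odd (suc m) g = trans (cong (λ k → ∑ k g) (2*suc m)) (trans (ℤ.+-assoc (∑ (2 ℕ.* m) g) (g (2 ℕ.* m)) (g (suc (2 ℕ.* m))))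
  (cong (_+ (g (2 ℕ.* m) + g (suc (2 ℕ.* m)))) (∑-even-odd m g)))

module HarmonicCongruences (m : ℕ) (p-prime : Prime (suc (4 ℕ.* m))) where

  open JacobsthalEvaluation m p-prime public

  inv-reflect : ∀ {x y} → x + y ≡ + p → Unit y → inv x ≈ - inv y ⟨ + p ⟩
  inv-reflect {x} {y} x+y≡p y≉0 = ≈-trans (inv-≈ x≈-y) (inv-neg y≉0)
    where
    lemma : ∀ x y → x ≡ - y + (x + y)
    lemma = solve-∀
    x≈-y : x ≈ - y ⟨ + p ⟩
    x≈-y = ≈-trans (≈-reflexive (trans (lemma x y) (cong (_+_ (- y)) x+y≡p))) (≈-trans (+-≈ˡ (- y) M≈0) (≈-reflexive (ℤ.+-identityʳ (- y))))

  H : ℕ → ℤ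
  H k = ∑ k (λ i → inv (+ suc i))

  h : ℕ → ℤ
  h k = ∑ k (λ i → inv (+ 2 * + i + + 1) * inv (+ 2 * + i + + 2))

  +[m∸1+i] : ∀ {i} → i < m → + (m ∸ suc i) ≡ + m - + suc i
  +[m∸1+i] {i} i<m = sym (trans (ℤ.m-n≡m⊖n m (suc i)) (ℤ.⊖-≥ i<m))

  Unit-suc<m : ∀ i → i < m → Unit (+ suc i)
  Unit-suc<m i i<m = Unit-1+ i (ℕ.<-trans (ℕ.<-≤-trans i<m m≤n) n<q)

  i<n : ∀ {i} → i < m → i < n
  i<n i<m = ℕ.<-≤-trans i<m m≤n

  Unit-4 : Unit (+ 4)
  Unit-4 = Unit-* Unit-2 Unit-2

  ∑-≈-linear : ∀ c {f g : ℕ → ℤ} → (∀ i → i < m → f i ≈ - (inv c * g i) ⟨ + p ⟩) → ∑ m f ≈ - (inv c * ∑ m g) ⟨ + p ⟩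
  ∑-≈-linear c {f} {g} f≈ = ≈-trans (∑-≈ m f≈) (≈-reflexive (trans (∑-neg m (λ i → inv c * g i)) (cong -_ (∑-*ˡ m (inv c) g))))

  -- The odd numbers 2i + 1 with m ≤ i < n are p minus the even numbers 2, 4, ..., 2m.
  O[n]≈O-H/2 : O n ≈ O m + - (inv (+ 2) * H m) ⟨ + p ⟩
  O[n]≈O-H/2 = begin
    O n ≡⟨ cong O n≡m+m ⟩
    O (m ℕ.+ m) ≡⟨ ∑-split m m (λ i → inv (+ 2 * + i + + 1)) ⟩
    O m + ∑ m (λ i → inv (+ 2 * + (m ℕ.+ i) + + 1)) ≡⟨ cong (_+_ (O m)) (∑-reverse m (λ i → inv (+ 2 * + (m ℕ.+ i) + + 1))) ⟩
    O m + ∑ m (λ i → inv (+ 2 * + (m ℕ.+ (m ∸ suc i)) + + 1))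
      ≈⟨ +-≈ˡ (O m) (∑-≈-linear (+ 2) (λ i i<m → ≈-trans
           (inv-reflect {y = + 2 * + suc i} (reflected i i<m) (Unit-* Unit-2 (Unit-suc<m i i<m))) (≈-reflexive (cong -_ (inv-* (+ 2) (+ suc i)))))) ⟩
    O m + - (inv (+ 2) * H m) ∎
    where
    open ≈-Reasoning (+ p)
    lemma : ∀ m i → + 2 * (m + (m - (+ 1 + i))) + + 1 + + 2 * (+ 1 + i) ≡ + 1 + + 4 * m
    lemma = solve-∀
    reflected : ∀ i → i < m → + 2 * + (m ℕ.+ (m ∸ suc i)) + + 1 + + 2 * + suc i ≡ + p
    reflected i i<m = trans (cong (λ u → + 2 * (+ m + u) + + 1 + + 2 * + suc i) (+[m∸1+i] i<m)) (trans (lemma (+ m) (+ i)) (sym +p≡))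

  -- A second evaluation, splitting all odd numbers below p modulo 4: those ≡ 1 have the form p -
  -- 4(i + 1), those ≡ 3 the form p - 2(2i + 1).
  O[n]≈-H/4-O/2 : O n ≈ - (inv (+ 4) * H m) + - (inv (+ 2) * O m) ⟨ + p ⟩
  O[n]≈-H/4-O/2 = begin
    O n ≡⟨ ∑-even-odd m g ⟩
    ∑ m (λ i → g (2 ℕ.* i) + g (suc (2 ℕ.* i))) ≡⟨ ∑-+ m (λ i → g (2 ℕ.* i)) (λ i → g (suc (2 ℕ.* i))) ⟩
    ∑ m (λ i → g (2 ℕ.* i)) + ∑ m (λ i → g (suc (2 ℕ.* i)))
      ≡⟨ cong₂ _+_ (∑-reverse m (λ i → g (2 ℕ.* i))) (∑-reverse m (λ i → g (suc (2 ℕ.* i)))) ⟩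
    ∑ m (λ i → g (2 ℕ.* (m ∸ suc i))) + ∑ m (λ i → g (suc (2 ℕ.* (m ∸ suc i))))
      ≈⟨ +-≈ (∑-≈-linear (+ 4) (λ i i<m → ≈-trans
               (inv-reflect {y = + 4 * + suc i} (even i i<m) (Unit-* Unit-4 (Unit-suc<m i i<m))) (≈-reflexive (cong -_ (inv-* (+ 4) (+ suc i))))))
             (∑-≈-linear (+ 2) (λ i i<m → ≈-trans
               (inv-reflect {y = + 2 * (+ 2 * + i + + 1)} (odd i i<m) (Unit-* Unit-2 (Unit-2i+1 i (i<n i<m)))) (≈-reflexive (cong -_ (inv-* (+ 2) (+ 2 * + i + + 1)))))) ⟩
    - (inv (+ 4) * H m) + - (inv (+ 2) * O m) ∎
    where
    open ≈-Reasoning (+ p)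
    g : ℕ → ℤ
    g i = inv (+ 2 * + i + + 1)
    even-lemma : ∀ m i → + 2 * (+ 2 * (m - (+ 1 + i))) + + 1 + + 4 * (+ 1 + i) ≡ + 1 + + 4 * m
    even-lemma = solve-∀
    odd-lemma : ∀ m i → + 2 * (+ 1 + + 2 * (m - (+ 1 + i))) + + 1 + + 2 * (+ 2 * i + + 1) ≡ + 1 + + 4 * m
    odd-lemma = solve-∀
    even : ∀ i → i < m → + 2 * + (2 ℕ.* (m ∸ suc i)) + + 1 + + 4 * + suc i ≡ + p
    even i i<m = trans (cong (λ u → + 2 * u + + 1 + + 4 * + suc i) (trans (ℤ.pos-* 2 (m ∸ suc i)) (cong (_*_ (+ 2)) (+[m∸1+i] i<m)))) (trans (even-lemma (+ m) (+ i)) (sym +p≡))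
    odd : ∀ i → i < m → + 2 * + suc (2 ℕ.* (m ∸ suc i)) + + 1 + + 2 * (+ 2 * + i + + 1) ≡ + p
    odd i i<m = trans (cong (λ u → + 2 * (+ 1 + u) + + 1 + + 2 * (+ 2 * + i + + 1)) (trans (ℤ.pos-* 2 (m ∸ suc i)) (cong (_*_ (+ 2)) (+[m∸1+i] i<m)))) (trans (odd-lemma (+ m) (+ i)) (sym +p≡))

  -- Equate the two evaluations of 4 O(n): 4 O(m) - 2 H(m) ≡ -H(m) - 2 O(m).
  H≈6O : H m ≈ + 6 * O m ⟨ + p ⟩
  H≈6O = begin
    H m ≡⟨ lemma (H m) (O m) ⟩
    + 6 * O m - ((+ 4 * O m - + 2 * (+ 1 * H m)) - (- (+ 1 * H m) - + 2 * (+ 1 * O m))) ≈⟨ −-≈ˡ (+ 6 * O m) (x≈y⇒x-y≈0 quadrupled) ⟩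
    + 6 * O m - + 0 ≡⟨ ℤ.+-identityʳ _ ⟩
    + 6 * O m ∎
    where
    open ≈-Reasoning (+ p)
    lemma : ∀ H O → H ≡ + 6 * O - ((+ 4 * O - + 2 * (+ 1 * H)) - (- (+ 1 * H) - + 2 * (+ 1 * O)))
    lemma = solve-∀
    left : ∀ O i H → + 4 * O - + 2 * (+ 2 * i * H) ≡ + 4 * (O + - (i * H))
    left = solve-∀
    right : ∀ i H j O → + 4 * (- (i * H) + - (j * O)) ≡ - (+ 4 * i * H) - + 2 * (+ 2 * j * O)
    right = solve-∀
    quadrupled : + 4 * O m - + 2 * (+ 1 * H m) ≈ - (+ 1 * H m) - + 2 * (+ 1 * O m) ⟨ + p ⟩
    quadrupled = begin
      + 4 * O m - + 2 * (+ 1 * H m) ≈⟨ −-≈ˡ (+ 4 * O m) (*-≈ˡ (+ 2) (*-≈ʳ (H m) (x*inv[x]≈1p Unit-2))) ⟨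
      + 4 * O m - + 2 * (+ 2 * inv (+ 2) * H m) ≡⟨ left (O m) (inv (+ 2)) (H m) ⟩
      + 4 * (O m + - (inv (+ 2) * H m)) ≈⟨ *-≈ˡ (+ 4) O[n]≈O-H/2 ⟨
      + 4 * O n ≈⟨ *-≈ˡ (+ 4) O[n]≈-H/4-O/2 ⟩
      + 4 * (- (inv (+ 4) * H m) + - (inv (+ 2) * O m)) ≡⟨ right (inv (+ 4)) (H m) (inv (+ 2)) (O m) ⟩
      - (+ 4 * inv (+ 4) * H m) - + 2 * (+ 2 * inv (+ 2) * O m) ≈⟨ −-≈ (neg-≈ (*-≈ʳ (H m) (x*inv[x]≈1p Unit-4))) (*-≈ˡ (+ 2) (*-≈ʳ (O m) (x*inv[x]≈1p Unit-2))) ⟩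
      - (+ 1 * H m) - + 2 * (+ 1 * O m) ∎

  Unit-2i+2 : ∀ i → i < m → Unit (+ 2 * + i + + 2)
  Unit-2i+2 i i<m = subst Unit (lemma (+ i)) (Unit-* Unit-2 (Unit-suc<m i i<m))
    where
    lemma : ∀ i → + 2 * (+ 1 + i) ≡ + 2 * i + + 2
    lemma = solve-∀

  -- Partial fractions: 1/((2i + 1)(2i + 2)) = 1/(2i + 1) - 1/(2i + 2), so 2h = 2O - H ≡ -4O.
  h≈-2O : h m ≈ - (+ 2 * O m) ⟨ + p ⟩
  h≈-2O = *-cancelˡ-≈p (+ 2) Unit-2 (begin
    + 2 * h m ≡⟨ ∑-*ˡ m (+ 2) (λ i → inv (+ 2 * + i + + 1) * inv (+ 2 * + i + + 2)) ⟨
    ∑ m (λ i → + 2 * (inv (+ 2 * + i + + 1) * inv (+ 2 * + i + + 2))) ≈⟨ ∑-≈ m partial-fractions ⟩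
    ∑ m (λ i → + 2 * inv (+ 2 * + i + + 1) - inv (+ suc i)) ≡⟨ trans (∑-− m (λ i → + 2 * inv (+ 2 * + i + + 1)) (λ i → inv (+ suc i))) (cong (_- H m) (∑-*ˡ m (+ 2) (λ i → inv (+ 2 * + i + + 1)))) ⟩
    + 2 * O m - H m ≈⟨ −-≈ˡ (+ 2 * O m) H≈6O ⟩
    + 2 * O m - + 6 * O m ≡⟨ lemma (O m) ⟩
    + 2 * - (+ 2 * O m) ∎)
    where
    open ≈-Reasoning (+ p)
    lemma : ∀ o → + 2 * o - + 6 * o ≡ + 2 * - (+ 2 * o)
    lemma = solve-∀
    partial-fractions : ∀ i → i < m → + 2 * (inv (+ 2 * + i + + 1) * inv (+ 2 * + i + + 2)) ≈ + 2 * inv (+ 2 * + i + + 1) - inv (+ suc i) ⟨ + p ⟩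
    partial-fractions i i<m = *-cancelˡ-≈p (t * u) (Unit-* t≉0 u≉0) (*-cancelˡ-≈p s s≉0 (begin
      s * (t * u * (+ 2 * (inv t * inv u))) ≡⟨ left s t (inv t) u (inv u) ⟩
      + 2 * s * (t * inv t) * (u * inv u) ≈⟨ *-≈ (*-≈ˡ (+ 2 * s) (x*inv[x]≈1p t≉0)) (x*inv[x]≈1p u≉0) ⟩
      + 2 * s * + 1 * + 1 ≡⟨ middle (+ i) ⟩
      + 2 * s * u * + 1 - t * u * + 1 ≈⟨ −-≈ (*-≈ˡ (+ 2 * s * u) (x*inv[x]≈1p t≉0)) (*-≈ˡ (t * u) (x*inv[x]≈1p s≉0)) ⟨
      + 2 * s * u * (t * inv t) - t * u * (s * inv s) ≡⟨ right s (inv s) t (inv t) u ⟩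
      s * (t * u * (+ 2 * inv t - inv s)) ∎))
      where
      s t u : ℤ
      s = + suc i
      t = + 2 * + i + + 1
      u = + 2 * + i + + 2
      s≉0 : Unit s
      s≉0 = Unit-suc<m i i<m
      t≉0 : Unit t
      t≉0 = Unit-2i+1 i (i<n i<m)
      u≉0 : Unit u
      u≉0 = Unit-2i+2 i i<m
      left : ∀ s t t′ u u′ → s * (t * u * (+ 2 * (t′ * u′))) ≡ + 2 * s * (t * t′) * (u * u′)
      left = solve-∀
      middle : ∀ i → + 2 * (+ 1 + i) * + 1 * + 1 ≡ + 2 * (+ 1 + i) * (+ 2 * i + + 2) * + 1 - (+ 2 * i + + 1) * (+ 2 * i + + 2) * + 1
      middle = solve-∀
      right : ∀ s s′ t t′ u → + 2 * s * u * (t * t′) - t * u * (s * s′) ≡ s * (t * u * (+ 2 * t′ - s′))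
      right = solve-∀

  -- The partial-fraction form of Euler's beta integral
  beta : ∀ N a → a ℕ.+ N < 4 ℕ.* m → ∑ (suc N) (λ s → -1ℤ ^ s * B N s * inv (+ suc a + + s)) * + (suc (a ℕ.+ N) !) ≈ + (N !) * + (a !) ⟨ + p ⟩
  beta zero a a<q = begin
    (+ 0 + + 1 * B 0 0 * inv (+ suc a + + 0)) * + (suc (a ℕ.+ 0) !) ≡⟨ trans (cong₂ (λ b k → (+ 0 + + 1 * b * inv (+ suc k)) * + (suc (a ℕ.+ 0) !)) (B-zero 0) (ℕ.+-identityʳ a))
        (cong (λ k → (+ 0 + + 1 * + 1 * inv (+ suc a)) * + (suc k !)) (ℕ.+-identityʳ a)) ⟩
    (+ 0 + + 1 * + 1 * inv (+ suc a)) * + (suc a !) ≡⟨ cong (_*_ (+ 0 + + 1 * + 1 * inv (+ suc a))) (ℤ.pos-* (suc a) (a !)) ⟩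
    (+ 0 + + 1 * + 1 * inv (+ suc a)) * (+ suc a * + (a !)) ≡⟨ lemma (+ suc a) (inv (+ suc a)) (+ (a !)) ⟩
    + suc a * inv (+ suc a) * + (a !) ≈⟨ *-≈ʳ (+ (a !)) (x*inv[x]≈1p (Unit-1+ a (subst (_< 4 ℕ.* m) (ℕ.+-identityʳ a) a<q))) ⟩
    + 1 * + (a !) ∎
    where
    open ≈-Reasoning (+ p)
    lemma : ∀ s i f → (+ 0 + + 1 * + 1 * i) * (s * f) ≡ s * i * f
    lemma = solve-∀
  beta (suc N) a a+N<q = begin
    -- Lowering the order by Pascal's rule replaces 1/(a + 1 + s) by its difference with 1/(a + 2 +
    -- s); the cases (N, a) and (N, a + 1) of the claim remain.
    ∑ (suc (suc N)) (λ s → -1ℤ ^ s * B (suc N) s * g s) * + (suc (a ℕ.+ suc N) !)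
      ≡⟨ cong₂ (λ u k → u * + (suc k !)) (trans (∑-B-pascal N g) (trans (∑-ext (suc N) (λ s → distrib (-1ℤ ^ s * B N s) (g s) (g (suc s)))) (∑-− (suc N) (λ s → -1ℤ ^ s * B N s * g s) (λ s → -1ℤ ^ s * B N s * g (suc s))))) (ℕ.+-suc a N) ⟩
    (I - ∑ (suc N) (λ s → -1ℤ ^ s * B N s * g (suc s))) * + (suc k !)
      ≡⟨ cong₂ (λ u v → (I - u) * v) (∑-ext (suc N) (λ s → cong (λ u → -1ℤ ^ s * B N s * inv u) (shift (+ a) (+ s)))) refl ⟩
    (I - I′) * + (suc k !)
      ≡⟨ ℤ.*-distribʳ-+ (+ (suc k !)) I (- I′) ⟩
    I * + (suc k !) + - I′ * + (suc k !)
      ≡⟨ cong₂ _+_ (trans (cong (_*_ I) (ℤ.pos-* (suc k) (k !))) (pull I (+ suc k) (+ (k !)))) (sym (ℤ.neg-distribˡ-* I′ (+ (suc k !)))) ⟩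
    + suc k * (I * + (k !)) - I′ * + (suc k !)
      ≈⟨ −-≈ (*-≈ˡ (+ suc k) (beta N a (ℕ.<-trans (ℕ.+-monoʳ-< a (ℕ.n<1+n N)) a+N<q))) (beta N (suc a) (subst (_< 4 ℕ.* m) (ℕ.+-suc a N) a+N<q)) ⟩
    + suc k * (+ (N !) * + (a !)) - + (N !) * + (suc a !)
      ≡⟨ cong (λ u → + suc k * (+ (N !) * + (a !)) - + (N !) * u) (ℤ.pos-* (suc a) (a !)) ⟩
    (+ 2 + (+ a + + N)) * (+ (N !) * + (a !)) - + (N !) * (+ suc a * + (a !))
      ≡⟨ collect (+ a) (+ N) (+ (N !)) (+ (a !)) ⟩
    + suc N * + (N !) * + (a !)
      ≡⟨ cong (_* + (a !)) (ℤ.pos-* (suc N) (N !)) ⟨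
    + (suc N !) * + (a !) ∎
    where
    open ≈-Reasoning (+ p)
    k = suc (a ℕ.+ N)
    g : ℕ → ℤ
    g s = inv (+ suc a + + s)
    I I′ : ℤ
    I = ∑ (suc N) (λ s → -1ℤ ^ s * B N s * inv (+ suc a + + s))
    I′ = ∑ (suc N) (λ s → -1ℤ ^ s * B N s * inv (+ suc (suc a) + + s))
    distrib : ∀ c x y → c * (x - y) ≡ c * x - c * y
    distrib = solve-∀
    shift : ∀ a s → + 1 + a + (+ 1 + s) ≡ + 2 + a + s
    shift = solve-∀
    pull : ∀ I k f → I * (k * f) ≡ k * (I * f)
    pull = solve-∀
    collect : ∀ a N f g → (+ 2 + (a + N)) * (f * g) - f * ((+ 1 + a) * g) ≡ (+ 1 + N) * f * g
    collect = solve-∀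

  Q : ℕ → ℤ
  Q M = ∑ M (λ s → -1ℤ ^ s * B (2 ℕ.* M) s * inv (+ M - + s))

  private

    cb-suc-square : ∀ M → + suc M * + suc M * cb (suc M) ≡ (+ 2 * + M + + 2) * (+ 2 * + M + + 1) * cb M
    cb-suc-square M = trans (ℤ.*-assoc (+ suc M) (+ suc M) (cb (suc M))) (trans (cong (_*_ (+ suc M)) (cb-suc M)) (lemma (+ M) (cb M)))
      where
      lemma : ∀ M c → (+ 1 + M) * (+ 2 * (+ 2 * M + + 1) * c) ≡ (+ 2 * M + + 2) * (+ 2 * M + + 1) * c
      lemma = solve-∀

    B-2M : ∀ M s → + suc s * (+ 2 * + M + + 1 - + s) * B (suc (suc (2 ℕ.* M))) (suc s) ≡ (+ 2 * + M + + 2) * (+ 2 * + M + + 1) * B (2 ℕ.* M) s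
    B-2M M s = begin
      + suc s * (+ 2 * + M + + 1 - + s) * B (suc (suc N)) (suc s) ≡⟨ rearrange (+ suc s) (+ 2 * + M + + 1 - + s) (B (suc (suc N)) (suc s)) ⟩
      (+ 2 * + M + + 1 - + s) * (+ suc s * B (suc (suc N)) (suc s)) ≡⟨ cong (_*_ (+ 2 * + M + + 1 - + s)) (B-absorb (suc N) s) ⟩
      (+ 2 * + M + + 1 - + s) * ((+ 2 + + N) * B (suc N) s) ≡⟨ cong (λ u → (+ 2 * + M + + 1 - + s) * ((+ 2 + u) * B (suc N) s)) (ℤ.pos-* 2 M) ⟩
      (+ 2 * + M + + 1 - + s) * ((+ 2 + + 2 * + M) * B (suc N) s) ≡⟨ rearrange′ (+ M) (+ s) (B (suc N) s) ⟩
      (+ 2 * + M + + 2) * ((+ 1 + + 2 * + M - + s) * B (suc N) s) ≡⟨ cong (λ u → (+ 2 * + M + + 2) * ((+ 1 + u - + s) * B (suc N) s)) (ℤ.pos-* 2 M) ⟨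
      (+ 2 * + M + + 2) * ((+ suc N - + s) * B (suc N) s) ≡⟨ cong (_*_ (+ 2 * + M + + 2)) (B-stepˡ N s) ⟩
      (+ 2 * + M + + 2) * ((+ 1 + + N) * B N s) ≡⟨ cong (λ u → (+ 2 * + M + + 2) * ((+ 1 + u) * B N s)) (ℤ.pos-* 2 M) ⟩
      (+ 2 * + M + + 2) * ((+ 1 + + 2 * + M) * B N s) ≡⟨ rearrange″ (+ M) (B N s) ⟩
      (+ 2 * + M + + 2) * (+ 2 * + M + + 1) * B N s ∎
      where
      open ≡-Reasoning
      N = 2 ℕ.* M
      rearrange : ∀ a b c → a * b * c ≡ b * (a * c)
      rearrange = solve-∀
      rearrange′ : ∀ M s b → (+ 2 * M + + 1 - s) * ((+ 2 + + 2 * M) * b) ≡ (+ 2 * M + + 2) * ((+ 1 + + 2 * M - s) * b)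
      rearrange′ = solve-∀
      rearrange″ : ∀ M b → (+ 2 * M + + 2) * ((+ 1 + + 2 * M) * b) ≡ (+ 2 * M + + 2) * (+ 2 * M + + 1) * b
      rearrange″ = solve-∀

  -- Split (M + 1)² = (M + 1 - s)² + s (2M + 2 - s). The first part cancels the denominator and
  -- leaves `∑-centred`. In the second, s (2M + 2 - s) C(2M+2, s) is a constant times C(2M, s-1),
  -- and shifting s gives back Q(M).
  Q-suc : ∀ M → M < m → + suc M * + suc M * Q (suc M) ≈ -1ℤ ^ M * cb M - (+ 2 * + M + + 2) * (+ 2 * + M + + 1) * Q M ⟨ + p ⟩
  Q-suc M M<m = begin
    + suc M * + suc M * Q (suc M)
      ≡⟨ cong (λ k → + suc M * + suc M * ∑ (suc M) (λ s → -1ℤ ^ s * B k s * inv (+ suc M - + s))) (2*suc M) ⟩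
    + suc M * + suc M * ∑ (suc M) (λ s → b s * inv (+ suc M - + s))
      ≡⟨ ∑-*ˡ (suc M) (+ suc M * + suc M) (λ s → b s * inv (+ suc M - + s)) ⟨
    ∑ (suc M) (λ s → + suc M * + suc M * (b s * inv (+ suc M - + s)))
      ≡⟨ ∑-ext (suc M) (λ s → split (+ suc M) (+ s) (b s) (inv (+ suc M - + s))) ⟩
    ∑ (suc M) (λ s → b s * (+ suc M - + s) * ((+ suc M - + s) * inv (+ suc M - + s)) + w s)
      ≈⟨ ∑-≈ (suc M) (λ s s≤M → +-≈ (*-≈ˡ (b s * (+ suc M - + s)) (x*inv[x]≈1p (difference-unit s (ℕ.s≤s⁻¹ s≤M)))) (≈-refl {x = w s})) ⟩
    ∑ (suc M) (λ s → b s * (+ suc M - + s) * + 1 + w s)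
      ≡⟨ trans (∑-ext (suc M) (λ s → cong (_+ w s) (ℤ.*-identityʳ (b s * (+ suc M - + s))))) (∑-+ (suc M) (λ s → b s * (+ suc M - + s)) w) ⟩
    ∑ (suc M) (λ s → b s * (+ suc M - + s)) + ∑ (suc M) w
      ≡⟨ cong₂ _+_ (∑-centred M) (trans (∑-head M w) (trans (cong₂ _+_ (head (b 0) (+ suc M) (inv (+ suc M - + 0))) (∑-ext M tail)) (trans (ℤ.+-identityˡ _) (∑-neg M _)))) ⟩
    -1ℤ ^ M * cb M - ∑ M (λ s → c * (-1ℤ ^ s * B (2 ℕ.* M) s * inv (+ M - + s)))
      ≡⟨ cong (_-_ (-1ℤ ^ M * cb M)) (∑-*ˡ M c (λ s → -1ℤ ^ s * B (2 ℕ.* M) s * inv (+ M - + s))) ⟩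
    -1ℤ ^ M * cb M - c * Q M ∎
    where
    open ≈-Reasoning (+ p)
    c : ℤ
    c = (+ 2 * + M + + 2) * (+ 2 * + M + + 1)
    b w : ℕ → ℤ
    b s = -1ℤ ^ s * B (suc (suc (2 ℕ.* M))) s
    w s = + s * (+ 2 * + suc M - + s) * b s * inv (+ suc M - + s)
    split : ∀ M s b i → M * M * (b * i) ≡ b * (M - s) * ((M - s) * i) + s * (+ 2 * M - s) * b * i
    split = solve-∀
    head : ∀ b M i → + 0 * (+ 2 * M - + 0) * b * i ≡ + 0
    head = solve-∀
    shift : ∀ M s → + 1 + M - (+ 1 + s) ≡ M - s
    shift = solve-∀
    regroup : ∀ M s σ b i → (+ 1 + s) * (+ 2 * (+ 1 + M) - (+ 1 + s)) * (-1ℤ * σ * b) * i ≡ - (σ * ((+ 1 + s) * (+ 2 * M + + 1 - s) * b) * i)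
    regroup = solve-∀
    regroup′ : ∀ σ c b i → - (σ * (c * b) * i) ≡ - (c * (σ * b * i))
    regroup′ = solve-∀
    tail : ∀ s → w (suc s) ≡ - (c * (-1ℤ ^ s * B (2 ℕ.* M) s * inv (+ M - + s)))
    tail s = trans (regroup (+ M) (+ s) (-1ℤ ^ s) (B (suc (suc (2 ℕ.* M))) (suc s)) (inv (+ suc M - + suc s)))
      (trans (cong₂ (λ u v → - (-1ℤ ^ s * u * inv v)) (B-2M M s) (shift (+ M) (+ s))) (regroup′ (-1ℤ ^ s) c (B (2 ℕ.* M) s) (inv (+ M - + s))))
    difference-unit : ∀ s → s ≤ M → Unit (+ suc M - + s)
    difference-unit s s≤M = subst Unit (sym (trans (ℤ.m-n≡m⊖n (suc M) s) (ℤ.⊖-≥ (ℕ.m≤n⇒m≤1+n s≤M))))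
      (Unit-pos (suc M ∸ s) (ℕ.m<n⇒0<n∸m (s≤s s≤M)) (ℕ.≤-<-trans (ℕ.m∸n≤m (suc M) s) (ℕ.≤-<-trans M<m m<p)))

  -- Divided by the recurrence of `cb`, `Q-suc` says that Q(M)/((-1)ᴹ cb M) decreases by 1/((2M +
  -- 1)(2M + 2)) at each step; `h` collects these decrements.
  Q≈ : ∀ M → M ≤ m → Q M ≈ - (-1ℤ ^ M * cb M * h M) ⟨ + p ⟩
  Q≈ zero _ = ≈-reflexive (lemma (cb 0))
    where
    lemma : ∀ c → + 0 ≡ - (+ 1 * c * + 0)
    lemma = solve-∀
  Q≈ (suc M) M<m = *-cancelˡ-≈p (+ suc M * + suc M) (Unit-* (Unit-suc<m M M<m) (Unit-suc<m M M<m)) (begin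
    + suc M * + suc M * Q (suc M) ≈⟨ Q-suc M M<m ⟩
    -1ℤ ^ M * cb M - u * t * Q M ≈⟨ −-≈ (≈-reflexive (ones (-1ℤ ^ M * cb M))) (*-≈ˡ (u * t) (Q≈ M (ℕ.<⇒≤ M<m))) ⟩
    -1ℤ ^ M * cb M * + 1 * + 1 - u * t * - (-1ℤ ^ M * cb M * h M)
      ≈⟨ −-≈ (*-≈ (*-≈ˡ (-1ℤ ^ M * cb M) (x*inv[x]≈1p (Unit-2i+1 M (i<n M<m)))) (x*inv[x]≈1p (Unit-2i+2 M M<m))) (≈-refl {x = u * t * - (-1ℤ ^ M * cb M * h M)}) ⟨
    -1ℤ ^ M * cb M * (t * inv t) * (u * inv u) - u * t * - (-1ℤ ^ M * cb M * h M)
      ≡⟨ collect (-1ℤ ^ M) (cb M) t (inv t) u (inv u) (h M) ⟩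
    - (-1ℤ ^ suc M * (u * t * cb M) * (h M + inv t * inv u)) ≡⟨ cong (λ v → - (-1ℤ ^ suc M * v * (h M + inv t * inv u))) (cb-suc-square M) ⟨
    - (-1ℤ ^ suc M * (+ suc M * + suc M * cb (suc M)) * h (suc M)) ≡⟨ regroup (-1ℤ ^ suc M) (+ suc M) (cb (suc M)) (h (suc M)) ⟩
    + suc M * + suc M * - (-1ℤ ^ suc M * cb (suc M) * h (suc M)) ∎)
    where
    open ≈-Reasoning (+ p)
    t u : ℤ
    t = + 2 * + M + + 1
    u = + 2 * + M + + 2
    ones : ∀ x → x ≡ x * + 1 * + 1
    ones = solve-∀
    collect : ∀ σ c t t′ u u′ h → σ * c * (t * t′) * (u * u′) - u * t * - (σ * c * h) ≡ - (-1ℤ * σ * (u * t * c) * (h + t′ * u′))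
    collect = solve-∀
    regroup : ∀ σ M c h → - (σ * (M * M * c) * h) ≡ M * M * - (σ * c * h)
    regroup = solve-∀

-- The character of x³ - x modulo p²

binomial-theorem-minus : ∀ N w → (w - + 1) ^ N ≡ ∑ (suc N) (λ k → -1ℤ ^ N * (-1ℤ ^ k * B N k) * w ^ k)
binomial-theorem-minus N w = begin
  (w - + 1) ^ N ≡⟨ trans (cong (_^ N) (factor w)) (^-distribʳ-* -1ℤ (-1ℤ * w + + 1) N) ⟩
  -1ℤ ^ N * (-1ℤ * w + + 1) ^ N ≡⟨ cong (_*_ (-1ℤ ^ N)) (binomial-theorem N (-1ℤ * w)) ⟩
  -1ℤ ^ N * ∑ (suc N) (λ k → B N k * (-1ℤ * w) ^ k) ≡⟨ ∑-*ˡ (suc N) (-1ℤ ^ N) (λ k → B N k * (-1ℤ * w) ^ k) ⟨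
  ∑ (suc N) (λ k → -1ℤ ^ N * (B N k * (-1ℤ * w) ^ k)) ≡⟨ ∑-ext (suc N) (λ k → trans (cong (λ u → -1ℤ ^ N * (B N k * u)) (^-distribʳ-* -1ℤ w k)) (rearrange (-1ℤ ^ N) (B N k) (-1ℤ ^ k) (w ^ k))) ⟩
  ∑ (suc N) (λ k → -1ℤ ^ N * (-1ℤ ^ k * B N k) * w ^ k) ∎
  where
  open ≡-Reasoning
  factor : ∀ w → w - + 1 ≡ -1ℤ * (-1ℤ * w + + 1)
  factor = solve-∀
  rearrange : ∀ s b t w → s * (b * (t * w)) ≡ s * (t * b) * w
  rearrange = solve-∀

module TraceCongruence (m : ℕ) (p-prime : Prime (suc (4 ℕ.* m))) where

  open HarmonicCongruences m p-prime public

  private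
    q = 4 ℕ.* m

  -1^q≡1 : -1ℤ ^ q ≡ + 1
  -1^q≡1 = trans (sym (ℤ.^-*-assoc -1ℤ 4 m)) (ℤ.^-zeroˡ m)

  -1^n≡1 : -1ℤ ^ n ≡ + 1
  -1^n≡1 = -1^2*k≡1 m

  -1^n′≡-1 : -1ℤ ^ n′ ≡ -1ℤ
  -1^n′≡-1 = trans (lemma (-1ℤ ^ n′)) (cong -_ (trans (cong (-1ℤ ^_) 1+n′≡n) -1^n≡1))
    where
    lemma : ∀ x → x ≡ - (-1ℤ * x)
    lemma = solve-∀

  -- The series of -log(1 - w) truncated below degree p. Up to p², p R(w) is the deviation of (w -
  -- 1)ᵖ from wᵖ - 1.
  R : ℤ → ℤ
  R w = ∑ q (λ i → inv (+ suc i) * w ^ suc i)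

  -- C(p, i+1) = p/(i + 1) · C(p-1, i), and next to the factor p the last binomial matters only
  -- modulo p.
  -1^i*B-p≈ : ∀ i → i < q → -1ℤ ^ i * B p (suc i) ≈ + p * inv (+ suc i) ⟨ + p * + p ⟩
  -1^i*B-p≈ i i<q = *-cancelˡ-≈ (+ suc i) (Unit-1+ i i<q) (begin
    + suc i * (-1ℤ ^ i * B p (suc i)) ≡⟨ swap (+ suc i) (-1ℤ ^ i) (B p (suc i)) ⟩
    -1ℤ ^ i * (+ suc i * B p (suc i)) ≡⟨ cong (_*_ (-1ℤ ^ i)) (B-absorb q i) ⟩
    -1ℤ ^ i * (+ p * B q i) ≡⟨ swap′ (-1ℤ ^ i) (+ p) (B q i) ⟩
    + p * (B q i * -1ℤ ^ i) ≈⟨ *-≈-scale (+ p) (B-q≈ i (ℕ.m<n⇒m<1+n i<q)) ⟩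
    + p * + 1 ≈⟨ *-≈ˡ (+ p) (x*inv[x]≈1 (Unit-1+ i i<q)) ⟨
    + p * (+ suc i * inv (+ suc i)) ≡⟨ swap (+ p) (+ suc i) (inv (+ suc i)) ⟩
    + suc i * (+ p * inv (+ suc i)) ∎)
    where
    open ≈-Reasoning (+ p * + p)
    swap : ∀ a b c → a * (b * c) ≡ b * (a * c)
    swap = solve-∀
    swap′ : ∀ s P b → s * (P * b) ≡ P * (b * s)
    swap′ = solve-∀

  [w-1]^p≈ : ∀ w → (w - + 1) ^ p ≈ w ^ p - + 1 + + p * R w ⟨ + p * + p ⟩
  [w-1]^p≈ w = begin
    (w - + 1) ^ p ≡⟨ binomial-theorem-minus p w ⟩
    ∑ (suc q) c + c p ≡⟨ cong (_+ c p) (∑-head q c) ⟩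
    c 0 + ∑ q (c ∘ suc) + c p
      ≡⟨ cong₂ (λ u v → u + ∑ q (c ∘ suc) + v) (cong₂ (λ s b → -1ℤ * s * (+ 1 * b) * + 1) -1^q≡1 (B-zero p)) (cong₂ (λ s b → -1ℤ * s * (-1ℤ * s * b) * w ^ p) -1^q≡1 (B-diag p)) ⟩
    -1ℤ + ∑ q (c ∘ suc) + + 1 * w ^ p
      ≈⟨ +-≈ (+-≈ˡ -1ℤ (∑-≈ q middle)) (≈-refl {x = + 1 * w ^ p}) ⟩
    -1ℤ + ∑ q (λ i → + p * (inv (+ suc i) * w ^ suc i)) + + 1 * w ^ p ≡⟨ cong (λ u → -1ℤ + u + + 1 * w ^ p) (∑-*ˡ q (+ p) (λ i → inv (+ suc i) * w ^ suc i)) ⟩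
    -1ℤ + + p * R w + + 1 * w ^ p ≡⟨ lemma (+ p * R w) (w ^ p) ⟩
    w ^ p - + 1 + + p * R w ∎
    where
    open ≈-Reasoning (+ p * + p)
    c : ℕ → ℤ
    c k = -1ℤ ^ p * (-1ℤ ^ k * B p k) * w ^ k
    lemma : ∀ r w → -1ℤ + r + + 1 * w ≡ w - + 1 + r
    lemma = solve-∀
    simplify : ∀ s b w → -1ℤ * + 1 * (-1ℤ * s * b) * w ≡ s * b * w
    simplify = solve-∀
    middle : ∀ i → i < q → c (suc i) ≈ + p * (inv (+ suc i) * w ^ suc i) ⟨ + p * + p ⟩
    middle i i<q = ≈-trans (≈-reflexive (trans (cong (λ s → -1ℤ * s * (-1ℤ ^ suc i * B p (suc i)) * w ^ suc i) -1^q≡1) (simplify (-1ℤ ^ i) (B p (suc i)) (w ^ suc i))))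
      (≈-trans (*-≈ʳ (w ^ suc i) (-1^i*B-p≈ i i<q)) (≈-reflexive (ℤ.*-assoc (+ p) (inv (+ suc i)) (w ^ suc i))))

  Sign₀-^p : ∀ {c} → Sign₀ c → c ^ p ≡ c
  Sign₀-^p zero = ℤ.*-zeroˡ ((+ 0) ^ q)
  Sign₀-^p plus = ℤ.^-zeroˡ p
  Sign₀-^p minus = cong (_*_ -1ℤ) -1^q≡1

  -- A sign is its own p-th power and p-th powers lift congruences, so χ(y) ≡ (yᵖ)ⁿ modulo p² for y
  -- = x³ - x. Inside the p-th power x may be replaced by z = xᵖ, and zᵖ ≡ z; thus only (z² - 1)ᵖ
  -- has to be expanded.
  χ≈teichmüller : ∀ x → let z = x ^ p in
    χ x * χ (x * x - + 1) ≈ z ^ n * (z * z - + 1) ^ n + + n * (+ p * (z ^ n * ((z * z - + 1) ^ n′ * R (z * z)))) ⟨ + p * + p ⟩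
  χ≈teichmüller x = begin
    χ x * χ (x * x - + 1) ≡⟨ χ-* x (x * x - + 1) ⟨
    χ y ≡⟨ Sign₀-^p (χ-sign y) ⟨
    χ y ^ p ≈⟨ ^-lift (χ≈^n y) ⟩
    (y ^ n) ^ p ≡⟨ trans (ℤ.^-*-assoc y n p) (trans (cong (y ^_) (ℕ.*-comm n p)) (sym (ℤ.^-*-assoc y p n))) ⟩
    (y ^ p) ^ n ≈⟨ ^-≈ n (^-lift (*-≈ (≈-sym (fermat x)) (−-≈ (*-≈ (≈-sym (fermat x)) (≈-sym (fermat x))) (≈-refl {x = + 1})))) ⟩
    ((z * (w - + 1)) ^ p) ^ n ≡⟨ cong (_^ n) (^-distribʳ-* z (w - + 1) p) ⟩
    (z ^ p * (w - + 1) ^ p) ^ n ≈⟨ ^-≈ n (*-≈ z^p≈z ([w-1]^p≈ w)) ⟩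
    (z * (w ^ p - + 1 + + p * R w)) ^ n ≈⟨ ^-≈ n (*-≈ˡ z (+-≈ (−-≈ (≈-trans (≈-reflexive (^-distribʳ-* z z p)) (*-≈ z^p≈z z^p≈z)) (≈-refl {x = + 1})) (≈-refl {x = + p * R w}))) ⟩
    (z * (w - + 1 + + p * R w)) ^ n ≡⟨ ^-distribʳ-* z (w - + 1 + + p * R w) n ⟩
    z ^ n * (w - + 1 + + p * R w) ^ n ≡⟨ cong (λ k → z ^ n * (w - + 1 + + p * R w) ^ k) 1+n′≡n ⟨
    z ^ n * (w - + 1 + + p * R w) ^ suc n′ ≈⟨ *-≈ˡ (z ^ n) (^-linearise (+ p) (w - + 1) (R w) n′) ⟩
    z ^ n * ((w - + 1) ^ suc n′ + + suc n′ * (+ p * ((w - + 1) ^ n′ * R w)))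
      ≡⟨ cong (λ k → z ^ n * ((w - + 1) ^ k + + k * (+ p * ((w - + 1) ^ n′ * R w)))) 1+n′≡n ⟩
    z ^ n * ((w - + 1) ^ n + + n * (+ p * ((w - + 1) ^ n′ * R w)))
      ≡⟨ distrib (z ^ n) ((w - + 1) ^ n) (+ n) (+ p) ((w - + 1) ^ n′ * R w) ⟩
    z ^ n * (w - + 1) ^ n + + n * (+ p * (z ^ n * ((w - + 1) ^ n′ * R w))) ∎
    where
    open ≈-Reasoning (+ p * + p)
    y z w : ℤ
    y = x * (x * x - + 1)
    z = x ^ p
    w = z * z
    z^p≈z : z ^ p ≈ z ⟨ + p * + p ⟩
    z^p≈z = ^-lift (fermat x)
    distrib : ∀ z a n P b → z * (a + n * (P * b)) ≡ z * a + n * (P * (z * b))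
    distrib = solve-∀

  Z : ℕ → ℤ
  Z j = ∑ₚ (λ x → (x ^ p) ^ (2 ℕ.* j))

  Z-at : ∀ t → Z (n ℕ.* suc t) ≈ + q ⟨ + p * + p ⟩
  Z-at t = ≈-trans (≈-reflexive (∑ₚ-ext (λ x → cong ((x ^ p) ^_) (lemma m t)))) (power-sum-full (suc t) (s≤s z≤n))
    where
    lemma : ∀ m t → 2 ℕ.* (2 ℕ.* m ℕ.* suc t) ≡ 4 ℕ.* m ℕ.* suc t
    lemma = ℕ-solve-∀

  Z-between : ∀ t j → n ℕ.* t < j → j < n ℕ.* suc t → Z j ≈ + 0 ⟨ + p * + p ⟩
  Z-between t j lower upper = ≈-trans (≈-reflexive (∑ₚ-ext (λ x → cong ((x ^ p) ^_) (trans (cong (2 ℕ.*_) (sym (ℕ.m∸n+n≡m (ℕ.<⇒≤ lower)))) (lemma m t r)))))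
    (power-sum-partial t (2 ℕ.* r) (ℕ.*-mono-< {0} {2} (s≤s z≤n) (ℕ.m<n⇒0<n∸m lower)) (subst (2 ℕ.* r <_) (double m) (ℕ.*-monoʳ-< 2 r<n)))
    where
    r = j ∸ n ℕ.* t
    lemma : ∀ m t r → 2 ℕ.* (r ℕ.+ 2 ℕ.* m ℕ.* t) ≡ 2 ℕ.* r ℕ.+ 4 ℕ.* m ℕ.* t
    lemma = ℕ-solve-∀
    double : ∀ m → 2 ℕ.* (2 ℕ.* m) ≡ 4 ℕ.* m
    double = ℕ-solve-∀
    r<n : r < n
    r<n = ℕ.+-cancelˡ-< (n ℕ.* t) r n (subst₂ _<_ (sym (ℕ.m+[n∸m]≡n (ℕ.<⇒≤ lower))) (trans (ℕ.*-suc n t) (ℕ.+-comm n (n ℕ.* t))) upper)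

  Z-off : ∀ t j → n ℕ.* t < j → j < n ℕ.* suc (suc t) → j ≢ n ℕ.* suc t → Z j ≈ + 0 ⟨ + p * + p ⟩
  Z-off t j lower upper j≢ =
    [ Z-between t j lower , (λ n[1+t]≤j → Z-between (suc t) j (ℕ.≤∧≢⇒< n[1+t]≤j (j≢ ∘ sym)) upper) ]′ (ℕ.<-≤-connex j (n ℕ.* suc t))

  -- The exponent 2(n + j + 1) is (2j + 1) + p, and zᵖ ≡ z. The argument `suc j` keeps the exponents
  -- positive: at exponent 0 the term x = 0 would count as 1.
  Z-periodic : ∀ j → Z (n ℕ.+ suc j) ≈ Z (suc j) ⟨ + p ⟩
  Z-periodic j = ∑-≈ p (λ x _ → pointwise (+ x))
    where
    lemma : ∀ m j → 2 ℕ.* (2 ℕ.* m ℕ.+ suc j) ≡ suc (2 ℕ.* j) ℕ.+ suc (4 ℕ.* m)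
    lemma = ℕ-solve-∀
    lemma′ : ∀ j → 2 ℕ.* suc j ≡ suc (2 ℕ.* j) ℕ.+ 1
    lemma′ = ℕ-solve-∀
    pointwise : ∀ x → (x ^ p) ^ (2 ℕ.* (n ℕ.+ suc j)) ≈ (x ^ p) ^ (2 ℕ.* suc j) ⟨ + p ⟩
    pointwise x = begin
      z ^ (2 ℕ.* (n ℕ.+ suc j)) ≡⟨ trans (cong (z ^_) (lemma m j)) (ℤ.^-distribˡ-+-* z (suc (2 ℕ.* j)) p) ⟩
      z ^ suc (2 ℕ.* j) * z ^ p ≈⟨ *-≈ˡ (z ^ suc (2 ℕ.* j)) (fermat z) ⟩
      z ^ suc (2 ℕ.* j) * z ≡⟨ cong (_*_ (z ^ suc (2 ℕ.* j))) (ℤ.*-identityʳ z) ⟨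
      z ^ suc (2 ℕ.* j) * z ^ 1 ≡⟨ trans (cong (z ^_) (lemma′ j)) (ℤ.^-distribˡ-+-* z (suc (2 ℕ.* j)) 1) ⟨
      z ^ (2 ℕ.* suc j) ∎
      where
      open ≈-Reasoning (+ p)
      z = x ^ p

  z^n*w^k≡ : ∀ z k → z ^ n * (z * z) ^ k ≡ z ^ (2 ℕ.* (m ℕ.+ k))
  z^n*w^k≡ z k = trans (cong (λ u → z ^ n * u ^ k) (cong (_*_ z) (sym (ℤ.*-identityʳ z)))) (trans (cong (_*_ (z ^ n)) (ℤ.^-*-assoc z 2 k))
    (trans (sym (ℤ.^-distribˡ-+-* z n (2 ℕ.* k))) (cong (z ^_) (sym (ℕ.*-distribˡ-+ 2 m k)))))

  -- Only exponents 2j with n dividing j survive the summation over x. Here j = m + k satisfies 0 <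
  -- j < 2n, so j = n and k = m.
  main-sum : ∑ₚ (λ x → (x ^ p) ^ n * ((x ^ p) * (x ^ p) - + 1) ^ n) ≈ -1ℤ ^ m * cb m * + q ⟨ + p * + p ⟩
  main-sum = begin
    ∑ₚ (λ x → (x ^ p) ^ n * (x ^ p * x ^ p - + 1) ^ n)
      ≡⟨ ∑ₚ-ext (λ x → trans (cong (_*_ ((x ^ p) ^ n)) (binomial-theorem-minus n (x ^ p * x ^ p))) (trans (sym (∑-*ˡ (suc n) ((x ^ p) ^ n) (λ k → c k * (x ^ p * x ^ p) ^ k)))
           (∑-ext (suc n) (λ k → trans (swap ((x ^ p) ^ n) (c k) ((x ^ p * x ^ p) ^ k)) (cong (_*_ (c k)) (z^n*w^k≡ (x ^ p) k)))))) ⟩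
    ∑ₚ (λ x → ∑ (suc n) (λ k → c k * (x ^ p) ^ (2 ℕ.* (m ℕ.+ k))))
      ≡⟨ trans (∑-swap p (suc n) (λ x k → c k * ((+ x) ^ p) ^ (2 ℕ.* (m ℕ.+ k)))) (∑-ext (suc n) (λ k → ∑-*ˡ p (c k) (λ x → ((+ x) ^ p) ^ (2 ℕ.* (m ℕ.+ k))))) ⟩
    ∑ (suc n) (λ k → c k * Z (m ℕ.+ k))
      ≈⟨ ∑-single-≈ (suc n) m (s≤s m≤n) (λ k k≤n k≢m → ≈-trans (*-≈ˡ (c k) (Z-off 0 (m ℕ.+ k)
           (subst (_< m ℕ.+ k) (sym (ℕ.*-zeroʳ n)) (ℕ.<-≤-trans m>0 (ℕ.m≤m+n m k)))
           (subst (m ℕ.+ k <_) (n+n≡n*2 m) (ℕ.+-mono-<-≤ (ℕ.m<m+n m (ℕ.<-≤-trans m>0 (ℕ.m≤m+n m 0))) (ℕ.s≤s⁻¹ k≤n)))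
           (λ e → k≢m (ℕ.+-cancelˡ-≡ m k m (trans e (trans (ℕ.*-identityʳ n) n≡m+m)))))) (≈-reflexive (ℤ.*-zeroʳ (c k)))) ⟩
    c m * Z (m ℕ.+ m)
      ≡⟨ cong₂ (λ s j → s * (-1ℤ ^ m * cb m) * Z j) -1^n≡1 (trans (sym n≡m+m) (sym (ℕ.*-identityʳ n))) ⟩
    + 1 * (-1ℤ ^ m * cb m) * Z (n ℕ.* 1)
      ≈⟨ *-≈ (≈-reflexive (ℤ.*-identityˡ (-1ℤ ^ m * cb m))) (Z-at 0) ⟩
    -1ℤ ^ m * cb m * + q ∎
    where
    open ≈-Reasoning (+ p * + p)
    c : ℕ → ℤ
    c k = -1ℤ ^ n * (-1ℤ ^ k * B n k)
    swap : ∀ a b c → a * (b * c) ≡ b * (a * c)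
    swap = solve-∀
    n+n≡n*2 : ∀ m → 2 ℕ.* m ℕ.+ 2 ℕ.* m ≡ 2 ℕ.* m ℕ.* 2
    n+n≡n*2 = ℕ-solve-∀

  b : ℕ → ℤ
  b s = -1ℤ ^ s * B n′ s

  ρ : ℕ → ℤ
  ρ s = ∑ q (λ i → inv (+ suc i) * Z (m ℕ.+ (s ℕ.+ suc i)))

  -- An exact expansion; the minus sign is (-1)ⁿ⁻¹, n being even.
  correction-sum : ∑ₚ (λ x → (x ^ p) ^ n * ((x ^ p * x ^ p - + 1) ^ n′ * R (x ^ p * x ^ p))) ≡ ∑ n (λ s → b s * - ρ s)
  correction-sum = begin
    ∑ₚ (λ x → (x ^ p) ^ n * ((x ^ p * x ^ p - + 1) ^ n′ * R (x ^ p * x ^ p)))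
      ≡⟨ ∑ₚ-ext (λ x → cong (λ u → (x ^ p) ^ n * (u * R (x ^ p * x ^ p))) (trans (binomial-theorem-minus n′ (x ^ p * x ^ p)) (cong (λ k → ∑ k (λ s → -1ℤ ^ n′ * b s * (x ^ p * x ^ p) ^ s)) 1+n′≡n))) ⟩
    ∑ₚ (λ x → (x ^ p) ^ n * (∑ n (λ s → -1ℤ ^ n′ * b s * (x ^ p * x ^ p) ^ s) * R (x ^ p * x ^ p)))
      ≡⟨ ∑ₚ-ext (λ x → trans (cong (_*_ ((x ^ p) ^ n)) (sym (∑-*-∑ n q (λ s → -1ℤ ^ n′ * b s * (x ^ p * x ^ p) ^ s) (λ i → inv (+ suc i) * (x ^ p * x ^ p) ^ suc i))))
           (trans (sym (∑-*ˡ n ((x ^ p) ^ n) (λ s → ∑ q (λ i → -1ℤ ^ n′ * b s * (x ^ p * x ^ p) ^ s * (inv (+ suc i) * (x ^ p * x ^ p) ^ suc i)))))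
             (∑-ext n (λ s → trans (sym (∑-*ˡ q ((x ^ p) ^ n) (λ i → -1ℤ ^ n′ * b s * (x ^ p * x ^ p) ^ s * (inv (+ suc i) * (x ^ p * x ^ p) ^ suc i)))) (∑-ext q (λ i → monomial (x ^ p) s i)))))) ⟩
    ∑ₚ (λ x → ∑ n (λ s → ∑ q (λ i → - b s * (inv (+ suc i) * (x ^ p) ^ (2 ℕ.* (m ℕ.+ (s ℕ.+ suc i)))))))
      ≡⟨ ∑-swap p n (λ x s → ∑ q (λ i → - b s * (inv (+ suc i) * ((+ x) ^ p) ^ (2 ℕ.* (m ℕ.+ (s ℕ.+ suc i)))))) ⟩
    ∑ n (λ s → ∑ₚ (λ x → ∑ q (λ i → - b s * (inv (+ suc i) * (x ^ p) ^ (2 ℕ.* (m ℕ.+ (s ℕ.+ suc i)))))))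
      ≡⟨ ∑-ext n (λ s → ∑-swap p q (λ x i → - b s * (inv (+ suc i) * ((+ x) ^ p) ^ (2 ℕ.* (m ℕ.+ (s ℕ.+ suc i)))))) ⟩
    ∑ n (λ s → ∑ q (λ i → ∑ₚ (λ x → - b s * (inv (+ suc i) * (x ^ p) ^ (2 ℕ.* (m ℕ.+ (s ℕ.+ suc i)))))))
      ≡⟨ ∑-ext n (λ s → ∑-ext q (λ i → trans (∑-*ˡ p (- b s) (λ x → inv (+ suc i) * ((+ x) ^ p) ^ (2 ℕ.* (m ℕ.+ (s ℕ.+ suc i)))))
           (cong (_*_ (- b s)) (∑-*ˡ p (inv (+ suc i)) (λ x → ((+ x) ^ p) ^ (2 ℕ.* (m ℕ.+ (s ℕ.+ suc i)))))))) ⟩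
    ∑ n (λ s → ∑ q (λ i → - b s * (inv (+ suc i) * Z (m ℕ.+ (s ℕ.+ suc i)))))
      ≡⟨ ∑-ext n (λ s → trans (∑-*ˡ q (- b s) (λ i → inv (+ suc i) * Z (m ℕ.+ (s ℕ.+ suc i)))) (sign (b s) (ρ s))) ⟩
    ∑ n (λ s → b s * - ρ s) ∎
    where
    open ≡-Reasoning
    sign : ∀ b r → - b * r ≡ b * - r
    sign = solve-∀
    rearrange : ∀ z b w i w′ → z * (-1ℤ * b * w * (i * w′)) ≡ - b * (i * (z * (w * w′)))
    rearrange = solve-∀
    monomial : ∀ z s i → z ^ n * (-1ℤ ^ n′ * b s * (z * z) ^ s * (inv (+ suc i) * (z * z) ^ suc i)) ≡ - b s * (inv (+ suc i) * z ^ (2 ℕ.* (m ℕ.+ (s ℕ.+ suc i))))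
    monomial z s i = trans (cong (λ u → z ^ n * (u * b s * (z * z) ^ s * (inv (+ suc i) * (z * z) ^ suc i))) -1^n′≡-1)
      (trans (rearrange (z ^ n) (b s) ((z * z) ^ s) (inv (+ suc i)) ((z * z) ^ suc i))
        (cong (λ u → - b s * (inv (+ suc i) * u)) (trans (cong (_*_ (z ^ n)) (sym (ℤ.^-distribˡ-+-* (z * z) s (suc i)))) (z^n*w^k≡ z (s ℕ.+ suc i)))))

-- The Jacobsthal sum S(1) modulo p²

∑-halves : ∀ m (g : ℕ → ℤ) → ∑ (2 ℕ.* m) g ≡ ∑ m g + ∑ m (λ e → g (2 ℕ.* m ∸ suc e))
∑-halves m g = begin
  ∑ (2 ℕ.* m) g ≡⟨ cong (λ k → ∑ (m ℕ.+ k) g) (ℕ.+-identityʳ m) ⟩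
  ∑ (m ℕ.+ m) g ≡⟨ ∑-split m m g ⟩
  ∑ m g + ∑ m (λ i → g (m ℕ.+ i)) ≡⟨ cong (_+_ (∑ m g)) (∑-reverse m (λ i → g (m ℕ.+ i))) ⟩
  ∑ m g + ∑ m (λ e → g (m ℕ.+ (m ∸ suc e))) ≡⟨ cong (_+_ (∑ m g)) (∑-cong m (λ e e<m → cong g (trans (sym (ℕ.+-∸-assoc m e<m)) (cong (λ k → m ℕ.+ k ∸ suc e) (sym (ℕ.+-identityʳ m)))))) ⟩
  ∑ m g + ∑ m (λ e → g (2 ℕ.* m ∸ suc e)) ∎
  where open ≡-Reasoning

module Trace (m : ℕ) (p-prime : Prime (suc (4 ℕ.* m))) where

  open TraceCongruence m p-prime public

  private
    q = 4 ℕ.* m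

    σC : ℤ
    σC = -1ℤ ^ m * cb m

  -- Modulo p the indices i and n + i carry the same power sum, so their reciprocals combine. Within
  -- one period exactly one index reaches a multiple of n, where the power sum is ≡ q ≡ -1; the two
  -- bounds exclude the neighbouring multiples.
  ρ-at : ∀ t s i → i < n → m ℕ.+ (s ℕ.+ suc i) ≡ n ℕ.* suc t → n ℕ.* t < m ℕ.+ (s ℕ.+ 1) → m ℕ.+ (s ℕ.+ n) < n ℕ.* suc (suc t) →
         - ρ s ≈ inv (+ suc i) + inv (+ suc (n ℕ.+ i)) ⟨ + p ⟩
  ρ-at t s i i<n at lower upper = begin
    - ρ s ≡⟨ cong (λ k → - ∑ k (λ i → inv (+ suc i) * Z (m ℕ.+ (s ℕ.+ suc i)))) n+n≡q ⟨
    - ∑ (n ℕ.+ n) (λ i → inv (+ suc i) * Z (m ℕ.+ (s ℕ.+ suc i))) ≡⟨ cong -_ (∑-split n n (λ i → inv (+ suc i) * Z (m ℕ.+ (s ℕ.+ suc i)))) ⟩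
    - (∑ n (λ i → inv (+ suc i) * Z (m ℕ.+ (s ℕ.+ suc i))) + ∑ n (λ i → inv (+ suc (n ℕ.+ i)) * Z (m ℕ.+ (s ℕ.+ suc (n ℕ.+ i)))))
      ≈⟨ neg-≈ (+-≈ˡ (∑ n (λ i → inv (+ suc i) * Z (m ℕ.+ (s ℕ.+ suc i)))) (∑-≈ n (λ i _ → *-≈ˡ (inv (+ suc (n ℕ.+ i))) (≈-trans (≈-reflexive (cong Z (shift m s i))) (≈-trans (Z-periodic (m ℕ.+ (s ℕ.+ i))) (≈-reflexive (cong Z (unshift m s i)))))))) ⟩
    - (∑ n (λ i → inv (+ suc i) * Z (m ℕ.+ (s ℕ.+ suc i))) + ∑ n (λ i → inv (+ suc (n ℕ.+ i)) * Z (m ℕ.+ (s ℕ.+ suc i))))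
      ≡⟨ cong -_ (trans (sym (∑-+ n (λ i → inv (+ suc i) * Z (m ℕ.+ (s ℕ.+ suc i))) (λ i → inv (+ suc (n ℕ.+ i)) * Z (m ℕ.+ (s ℕ.+ suc i)))))
          (∑-ext n (λ i → sym (ℤ.*-distribʳ-+ (Z (m ℕ.+ (s ℕ.+ suc i))) (inv (+ suc i)) (inv (+ suc (n ℕ.+ i))))))) ⟩
    - ∑ n (λ i → (inv (+ suc i) + inv (+ suc (n ℕ.+ i))) * Z (m ℕ.+ (s ℕ.+ suc i)))
      ≈⟨ neg-≈ (∑-single-≈ n i i<n (λ j j<n j≢i → ≈-trans (*-≈ˡ (inv (+ suc j) + inv (+ suc (n ℕ.+ j))) (≈-weaken (+ p) (Z-off t (m ℕ.+ (s ℕ.+ suc j))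
           (ℕ.<-≤-trans lower (ℕ.+-monoʳ-≤ m (ℕ.+-monoʳ-≤ s (s≤s z≤n))))
           (ℕ.≤-<-trans (ℕ.+-monoʳ-≤ m (ℕ.+-monoʳ-≤ s j<n)) upper)
           (λ e → j≢i (ℕ.suc-injective (ℕ.+-cancelˡ-≡ s (suc j) (suc i) (ℕ.+-cancelˡ-≡ m (s ℕ.+ suc j) (s ℕ.+ suc i) (trans e (sym at)))))))))
           (≈-reflexive (ℤ.*-zeroʳ (inv (+ suc j) + inv (+ suc (n ℕ.+ j))))))) ⟩
    - ((inv (+ suc i) + inv (+ suc (n ℕ.+ i))) * Z (m ℕ.+ (s ℕ.+ suc i)))
      ≈⟨ neg-≈ (*-≈ˡ (inv (+ suc i) + inv (+ suc (n ℕ.+ i))) (≈-trans (≈-reflexive (cong Z at)) (≈-trans (≈-weaken (+ p) (Z-at t)) q≈-1))) ⟩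
    - ((inv (+ suc i) + inv (+ suc (n ℕ.+ i))) * -1ℤ)
      ≡⟨ lemma (inv (+ suc i) + inv (+ suc (n ℕ.+ i))) ⟩
    inv (+ suc i) + inv (+ suc (n ℕ.+ i)) ∎
    where
    open ≈-Reasoning (+ p)
    lemma : ∀ x → - (x * -1ℤ) ≡ x
    lemma = solve-∀
    shift : ∀ m s i → m ℕ.+ (s ℕ.+ suc (2 ℕ.* m ℕ.+ i)) ≡ 2 ℕ.* m ℕ.+ suc (m ℕ.+ (s ℕ.+ i))
    shift = ℕ-solve-∀
    unshift : ∀ m s i → suc (m ℕ.+ (s ℕ.+ i)) ≡ m ℕ.+ (s ℕ.+ suc i)
    unshift = ℕ-solve-∀

  module _ {s : ℕ} (s<m : s < m) where

    +[m∸s]≡ : + suc (m ∸ suc s) ≡ + m - + s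
    +[m∸s]≡ = trans (cong (_+_ (+ 1)) (+[m∸1+i] s<m)) (lemma (+ m) (+ s))
      where
      lemma : ∀ m s → + 1 + (m - (+ 1 + s)) ≡ m - s
      lemma = solve-∀

    +[3m∸s]≡ : + suc (n ℕ.+ (m ∸ suc s)) ≡ + 3 * + m - + s
    +[3m∸s]≡ = trans (cong (λ u → + 1 + (+ n + u)) (+[m∸1+i] s<m)) (trans (cong (λ u → + 1 + (u + (+ m - + suc s))) +n≡) (lemma (+ m) (+ s)))
      where
      lemma : ∀ m s → + 1 + (+ 2 * m + (m - (+ 1 + s))) ≡ + 3 * m - s
      lemma = solve-∀

    private
      m∸1+s<n : m ∸ suc s < n
      m∸1+s<n = ℕ.<-≤-trans (ℕ.∸-monoʳ-< {m} {suc s} {0} (s≤s z≤n) s<m) m≤n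

    Unit-m-s : Unit (+ m - + s)
    Unit-m-s = subst Unit +[m∸s]≡ (Unit-1+ (m ∸ suc s) (ℕ.<-trans m∸1+s<n n<q))

    Unit-3m-s : Unit (+ 3 * + m - + s)
    Unit-3m-s = subst Unit +[3m∸s]≡ (Unit-1+ (n ℕ.+ (m ∸ suc s)) (ℕ.<-≤-trans (ℕ.+-monoʳ-< n m∸1+s<n) (ℕ.≤-reflexive n+n≡q)))

    s+[m∸s]≡m : s ℕ.+ suc (m ∸ suc s) ≡ m
    s+[m∸s]≡m = trans (ℕ.+-suc s (m ∸ suc s)) (ℕ.m+[n∸m]≡n s<m)

    -ρ-lower : - ρ s ≈ inv (+ m - + s) + inv (+ 3 * + m - + s) ⟨ + p ⟩
    -ρ-lower = ≈-trans (ρ-at 0 s (m ∸ suc s) m∸1+s<n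
        (trans (cong (m ℕ.+_) s+[m∸s]≡m) (trans (sym n≡m+m) (sym (ℕ.*-identityʳ n))))
        (subst (_< m ℕ.+ (s ℕ.+ 1)) (sym (ℕ.*-zeroʳ n)) (ℕ.<-≤-trans m>0 (ℕ.m≤m+n m (s ℕ.+ 1))))
        (ℕ.<-≤-trans (ℕ.+-monoʳ-< m (ℕ.+-monoˡ-< n s<m)) (ℕ.≤-reflexive (total m))))
      (≈-reflexive (cong₂ (λ x y → inv x + inv y) +[m∸s]≡ +[3m∸s]≡))
      where
      total : ∀ m → m ℕ.+ (m ℕ.+ 2 ℕ.* m) ≡ 2 ℕ.* m ℕ.* 2
      total = ℕ-solve-∀

    s<n : s < n
    s<n = ℕ.<-≤-trans s<m m≤n

    -- The row n - 1 is odd, so its reflection changes the sign. The factor -ρ changes sign too, by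
    -- x ↦ p - x in the reciprocals, and the two halves of the correction sum agree.
    b-reflect : b (n ∸ suc s) ≡ - b s
    b-reflect = begin
      -1ℤ ^ (n ∸ suc s) * B n′ (n ∸ suc s) ≡⟨ cong (λ k → -1ℤ ^ k * B n′ k) n∸1+s≡n′∸s ⟩
      -1ℤ ^ (n′ ∸ s) * B n′ (n′ ∸ s) ≡⟨ cong₂ _*_ sign (sym (B-sym s≤n′)) ⟩
      - (-1ℤ ^ s) * B n′ s ≡⟨ ℤ.neg-distribˡ-* (-1ℤ ^ s) (B n′ s) ⟨
      - b s ∎
      where
      open ≡-Reasoning
      s≤n′ : s ≤ n′
      s≤n′ = ℕ.s≤s⁻¹ (ℕ.≤-trans s<n (ℕ.≤-reflexive (sym 1+n′≡n)))
      n∸1+s≡n′∸s : n ∸ suc s ≡ n′ ∸ s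
      n∸1+s≡n′∸s = cong (_∸ suc s) (sym 1+n′≡n)
      lemma : ∀ x → x ≡ x * + 1
      lemma = solve-∀
      sign : -1ℤ ^ (n′ ∸ s) ≡ - (-1ℤ ^ s)
      sign = trans (lemma (-1ℤ ^ (n′ ∸ s))) (trans (cong (_*_ (-1ℤ ^ (n′ ∸ s))) (sym (-1^k*-1^k≡1 s))) (trans (sym (ℤ.*-assoc (-1ℤ ^ (n′ ∸ s)) (-1ℤ ^ s) (-1ℤ ^ s)))
        (trans (cong (_* -1ℤ ^ s) (trans (sym (ℤ.^-distribˡ-+-* -1ℤ (n′ ∸ s) s)) (trans (cong (-1ℤ ^_) (ℕ.m∸n+n≡m s≤n′)) -1^n′≡-1))) (ℤ.-1*i≡-i (-1ℤ ^ s)))))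

    -ρ-upper : - ρ (n ∸ suc s) ≈ - inv (+ 3 * + m - + s) + - inv (+ m - + s) ⟨ + p ⟩
    -ρ-upper = ≈-trans (ρ-at 1 (n ∸ suc s) (m ℕ.+ s) (ℕ.<-≤-trans (ℕ.+-monoʳ-< m s<m) (ℕ.≤-reflexive (sym n≡m+m)))
        (trans (shift m (n ∸ suc s) s) (trans (cong (λ k → m ℕ.+ m ℕ.+ k) (ℕ.m∸n+n≡m s<n)) (total m)))
        (ℕ.≤-<-trans (ℕ.≤-reflexive (trans (ℕ.*-identityʳ n) n≡m+m)) (ℕ.+-monoʳ-< m (ℕ.≤-<-trans m≤n∸1+s (ℕ.m<m+n (n ∸ suc s) (s≤s z≤n)))))
        (ℕ.<-≤-trans (ℕ.+-monoʳ-< m (ℕ.+-monoˡ-< n (ℕ.∸-monoʳ-< {n} {suc s} {0} (s≤s z≤n) s<n))) (ℕ.≤-trans (ℕ.m≤n+m (m ℕ.+ (n ℕ.+ n)) m) (ℕ.≤-reflexive (total′ m)))))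
      (+-≈ (inv-reflect (trans (reflect (+ m) (+ s)) (sym +p≡)) Unit-3m-s)
           (inv-reflect (trans (cong (λ u → + 1 + (u + (+ m + + s)) + (+ m - + s)) +n≡) (trans (reflect′ (+ m) (+ s)) (sym +p≡))) Unit-m-s))
      where
      shift : ∀ m k s → m ℕ.+ (k ℕ.+ suc (m ℕ.+ s)) ≡ m ℕ.+ m ℕ.+ (k ℕ.+ suc s)
      shift = ℕ-solve-∀
      total : ∀ m → m ℕ.+ m ℕ.+ 2 ℕ.* m ≡ 2 ℕ.* m ℕ.* 2
      total = ℕ-solve-∀
      total′ : ∀ m → m ℕ.+ (m ℕ.+ (2 ℕ.* m ℕ.+ 2 ℕ.* m)) ≡ 2 ℕ.* m ℕ.* 3
      total′ = ℕ-solve-∀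
      m≤n∸1+s : m ≤ n ∸ suc s
      m≤n∸1+s = ℕ.≤-trans (ℕ.≤-reflexive (sym (trans (cong (_∸ m) n≡m+m) (ℕ.m+n∸n≡m m m)))) (ℕ.∸-monoʳ-≤ n s<m)
      reflect : ∀ m s → + 1 + (m + s) + (+ 3 * m - s) ≡ + 1 + + 4 * m
      reflect = solve-∀
      reflect′ : ∀ m s → + 1 + (+ 2 * m + (m + s)) + (m - s) ≡ + 1 + + 4 * m
      reflect′ = solve-∀

  U V : ℤ
  U = ∑ m (λ s → b s * inv (+ m - + s))
  V = ∑ m (λ s → b s * inv (+ 3 * + m - + s))

  correction≈ : ∑ n (λ s → b s * - ρ s) ≈ + 2 * (U + V) ⟨ + p ⟩
  correction≈ = begin
    ∑ n (λ s → b s * - ρ s) ≡⟨ ∑-halves m (λ s → b s * - ρ s) ⟩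
    ∑ m (λ s → b s * - ρ s) + ∑ m (λ s → b (n ∸ suc s) * - ρ (n ∸ suc s)) ≈⟨ +-≈ (∑-≈ m lower) (∑-≈ m upper) ⟩
    ∑ m (λ s → b s * inv (+ m - + s) + b s * inv (+ 3 * + m - + s)) + ∑ m (λ s → b s * inv (+ m - + s) + b s * inv (+ 3 * + m - + s))
      ≡⟨ cong (λ u → u + u) (∑-+ m (λ s → b s * inv (+ m - + s)) (λ s → b s * inv (+ 3 * + m - + s))) ⟩
    U + V + (U + V) ≡⟨ double (U + V) ⟩
    + 2 * (U + V) ∎
    where
    open ≈-Reasoning (+ p)
    double : ∀ x → x + x ≡ + 2 * x
    double = solve-∀
    lower : ∀ s → s < m → b s * - ρ s ≈ b s * inv (+ m - + s) + b s * inv (+ 3 * + m - + s) ⟨ + p ⟩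
    lower s s<m = ≈-trans (*-≈ˡ (b s) (-ρ-lower s<m)) (≈-reflexive (ℤ.*-distribˡ-+ (b s) (inv (+ m - + s)) (inv (+ 3 * + m - + s))))
    signs : ∀ b x y → - b * (- x + - y) ≡ b * y + b * x
    signs = solve-∀
    upper : ∀ s → s < m → b (n ∸ suc s) * - ρ (n ∸ suc s) ≈ b s * inv (+ m - + s) + b s * inv (+ 3 * + m - + s) ⟨ + p ⟩
    upper s s<m = ≈-trans (*-≈ (≈-reflexive (b-reflect s<m)) (-ρ-upper s<m)) (≈-reflexive (signs (b s) (inv (+ 3 * + m - + s)) (inv (+ m - + s))))

  private
    -- The partial row sum is (-1)ᵐ⁻¹ C(n-1, m-1), and C(2m, m) = 2 C(2m-1, m-1).
    ∑-B-lower : + 2 * ∑ m (λ s → -1ℤ ^ s * B n s) ≡ - σC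
    ∑-B-lower = begin
      + 2 * ∑ m (λ s → -1ℤ ^ s * B n s) ≡⟨ cong₂ (λ j k → + 2 * ∑ j (λ s → -1ℤ ^ s * B k s)) (sym 1+m′≡m) (sym 1+n′≡n) ⟩
      + 2 * ∑ (suc m′) (λ s → -1ℤ ^ s * B (suc n′) s) ≡⟨ cong (_*_ (+ 2)) (∑-B-partial n′ m′) ⟩
      + 2 * (-1ℤ ^ m′ * B n′ m′) ≡⟨ lemma (-1ℤ ^ m′) (B n′ m′) ⟩
      - (-1ℤ ^ suc m′ * (+ 2 * B n′ m′)) ≡⟨ cong₂ (λ k c → - (-1ℤ ^ k * c)) 1+m′≡m (sym cb≡2B) ⟩
      - σC ∎
      where
      open ≡-Reasoning
      m′ = ℕ.pred m
      1+m′≡m : suc m′ ≡ m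
      1+m′≡m = ℕ.suc-pred m {{ℕ.>-nonZero m>0}}
      lemma : ∀ s b → + 2 * (s * b) ≡ - (-1ℤ * s * (+ 2 * b))
      lemma = solve-∀
      lemma′ : ∀ m b → + 2 * m * b ≡ m * (+ 2 * b)
      lemma′ = solve-∀
      cb≡2B : cb m ≡ + 2 * B n′ m′
      cb≡2B = ℤ.*-cancelˡ-≡ (+ m) _ _ {{ℕ.>-nonZero m>0}} (begin
        + m * B n m ≡⟨ cong₂ (λ j k → + j * B k j) (sym 1+m′≡m) (sym 1+n′≡n) ⟩
        + suc m′ * B (suc n′) (suc m′) ≡⟨ B-absorb n′ m′ ⟩
        + suc n′ * B n′ m′ ≡⟨ cong (_* B n′ m′) (trans (cong +_ 1+n′≡n) +n≡) ⟩
        + 2 * + m * B n′ m′ ≡⟨ lemma′ (+ m) (B n′ m′) ⟩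
        + m * (+ 2 * B n′ m′) ∎)

    -- Since n C(n-1, s) = (n - s) C(n, s) and n - s = m + (m - s), the second summand cancels the
    -- denominator.
    n*U≈ : + n * U ≈ + m * Q m + ∑ m (λ s → -1ℤ ^ s * B n s) ⟨ + p ⟩
    n*U≈ = begin
      + n * U ≡⟨ ∑-*ˡ m (+ n) (λ s → b s * inv (+ m - + s)) ⟨
      ∑ m (λ s → + n * (b s * inv (+ m - + s))) ≈⟨ ∑-≈ m pointwise ⟩
      ∑ m (λ s → + m * (-1ℤ ^ s * B n s * inv (+ m - + s)) + -1ℤ ^ s * B n s) ≡⟨ ∑-+ m (λ s → + m * (-1ℤ ^ s * B n s * inv (+ m - + s))) (λ s → -1ℤ ^ s * B n s) ⟩
      ∑ m (λ s → + m * (-1ℤ ^ s * B n s * inv (+ m - + s))) + ∑ m (λ s → -1ℤ ^ s * B n s)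
        ≡⟨ cong (_+ ∑ m (λ s → -1ℤ ^ s * B n s)) (∑-*ˡ m (+ m) (λ s → -1ℤ ^ s * B n s * inv (+ m - + s))) ⟩
      + m * Q m + ∑ m (λ s → -1ℤ ^ s * B n s) ∎
      where
      open ≈-Reasoning (+ p)
      pull : ∀ n s b i → n * (s * b * i) ≡ s * (n * b) * i
      pull = solve-∀
      split : ∀ m s σ b i → σ * ((+ 2 * m - s) * b) * i ≡ m * (σ * b * i) + σ * b * ((m - s) * i)
      split = solve-∀
      pointwise : ∀ s → s < m → + n * (b s * inv (+ m - + s)) ≈ + m * (-1ℤ ^ s * B n s * inv (+ m - + s)) + -1ℤ ^ s * B n s ⟨ + p ⟩
      pointwise s s<m = begin
        + n * (b s * inv (+ m - + s)) ≡⟨ pull (+ n) (-1ℤ ^ s) (B n′ s) (inv (+ m - + s)) ⟩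
        -1ℤ ^ s * (+ n * B n′ s) * inv (+ m - + s)
          ≡⟨ cong (λ u → -1ℤ ^ s * u * inv (+ m - + s)) (trans (cong (λ k → + k * B n′ s) (sym 1+n′≡n)) (trans (sym (B-stepˡ n′ s)) (trans (cong (λ k → (+ k - + s) * B k s) 1+n′≡n) (cong (λ u → (u - + s) * B n s) +n≡)))) ⟩
        -1ℤ ^ s * ((+ 2 * + m - + s) * B n s) * inv (+ m - + s) ≡⟨ split (+ m) (+ s) (-1ℤ ^ s) (B n s) (inv (+ m - + s)) ⟩
        + m * (-1ℤ ^ s * B n s * inv (+ m - + s)) + -1ℤ ^ s * B n s * ((+ m - + s) * inv (+ m - + s))
          ≈⟨ +-≈ˡ (+ m * (-1ℤ ^ s * B n s * inv (+ m - + s))) (*-≈ˡ (-1ℤ ^ s * B n s) (x*inv[x]≈1p (Unit-m-s s<m))) ⟩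
        + m * (-1ℤ ^ s * B n s * inv (+ m - + s)) + -1ℤ ^ s * B n s * + 1
          ≡⟨ cong (_+_ (+ m * (-1ℤ ^ s * B n s * inv (+ m - + s)))) (ℤ.*-identityʳ (-1ℤ ^ s * B n s)) ⟩
        + m * (-1ℤ ^ s * B n s * inv (+ m - + s)) + -1ℤ ^ s * B n s ∎

    4m≈-1 : + 4 * + m ≈ -1ℤ ⟨ + p ⟩
    4m≈-1 = ≈-trans (≈-reflexive (trans (lemma (+ m)) (cong (_*_ (+ 2)) (sym +n≡)))) 2n≈-1
      where
      lemma : ∀ m → + 4 * m ≡ + 2 * (+ 2 * m)
      lemma = solve-∀

  -- Multiply by 4n ≡ -2: with 4m ≡ -1 and Q(m) ≡ 2 σC O(m), the two parts of `n*U≈` become -2 σC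
  -- O(m) and -2 σC.
  U≈ : U ≈ σC * (+ 1 + O m) ⟨ + p ⟩
  U≈ = *-cancelˡ-≈p (+ 2 * -1ℤ) (Unit-* Unit-2 (λ e → Unit-1 (neg-≈ e))) (begin
    + 2 * -1ℤ * U ≈⟨ *-≈ʳ U (*-≈ˡ (+ 2) 2n≈-1) ⟨
    + 2 * (+ 2 * + n) * U ≡⟨ quadruple (+ n) U ⟩
    + 4 * (+ n * U) ≈⟨ *-≈ˡ (+ 4) n*U≈ ⟩
    + 4 * (+ m * Q m + ∑ m (λ s → -1ℤ ^ s * B n s)) ≡⟨ distrib (+ m) (Q m) (∑ m (λ s → -1ℤ ^ s * B n s)) ⟩
    + 4 * + m * Q m + + 2 * (+ 2 * ∑ m (λ s → -1ℤ ^ s * B n s)) ≡⟨ cong (λ u → + 4 * + m * Q m + + 2 * u) ∑-B-lower ⟩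
    + 4 * + m * Q m + + 2 * - σC ≈⟨ +-≈ (*-≈ 4m≈-1 (≈-trans (Q≈ m ℕ.≤-refl) (neg-≈ (*-≈ˡ σC h≈-2O)))) (≈-refl {x = + 2 * - σC}) ⟩
    -1ℤ * - (σC * - (+ 2 * O m)) + + 2 * - σC ≡⟨ collect σC (O m) ⟩
    + 2 * -1ℤ * (σC * (+ 1 + O m)) ∎)
    where
    open ≈-Reasoning (+ p)
    quadruple : ∀ n u → + 2 * (+ 2 * n) * u ≡ + 4 * (n * u)
    quadruple = solve-∀
    distrib : ∀ m q u → + 4 * (m * q + u) ≡ + 4 * m * q + + 2 * (+ 2 * u)
    distrib = solve-∀
    collect : ∀ c o → -1ℤ * - (c * - (+ 2 * o)) + + 2 * - c ≡ + 2 * -1ℤ * (c * (+ 1 + o))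
    collect = solve-∀

  private
    beta-sum : ℤ
    beta-sum = ∑ (suc n′) (λ s → -1ℤ ^ s * B n′ s * inv (+ suc m + + s))

    -- In the lower half m + 1 + s = p - (3m - s); in the upper half the denominator is 3m - s
    -- itself, but the coefficient is reflected. Both halves give -V.
    -beta≈2V : - beta-sum ≈ + 2 * V ⟨ + p ⟩
    -beta≈2V = begin
      - beta-sum ≡⟨ cong (λ k → - ∑ k (λ s → b s * inv (+ suc m + + s))) 1+n′≡n ⟩
      - ∑ n (λ s → b s * inv (+ suc m + + s)) ≡⟨ cong -_ (∑-halves m (λ s → b s * inv (+ suc m + + s))) ⟩
      - (∑ m (λ s → b s * inv (+ suc m + + s)) + ∑ m (λ s → b (n ∸ suc s) * inv (+ suc m + + (n ∸ suc s))))
        ≈⟨ neg-≈ (+-≈ (∑-≈ m lower) (∑-≈ m upper)) ⟩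
      - (∑ m (λ s → - (b s * inv (+ 3 * + m - + s))) + ∑ m (λ s → - (b s * inv (+ 3 * + m - + s))))
        ≡⟨ trans (cong (λ u → - (u + u)) (∑-neg m (λ s → b s * inv (+ 3 * + m - + s)))) (double V) ⟩
      + 2 * V ∎
      where
      open ≈-Reasoning (+ p)
      double : ∀ v → - (- v + - v) ≡ + 2 * v
      double = solve-∀
      reflect : ∀ m s → + 1 + m + s + (+ 3 * m - s) ≡ + 1 + + 4 * m
      reflect = solve-∀
      lower : ∀ s → s < m → b s * inv (+ suc m + + s) ≈ - (b s * inv (+ 3 * + m - + s)) ⟨ + p ⟩
      lower s s<m = ≈-trans (*-≈ˡ (b s) (inv-reflect (trans (reflect (+ m) (+ s)) (sym +p≡)) (Unit-3m-s s<m))) (≈-reflexive (sym (ℤ.neg-distribʳ-* (b s) (inv (+ 3 * + m - + s)))))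
      3m-s : ∀ m s → + 1 + m + (+ 2 * m - (+ 1 + s)) ≡ + 3 * m - s
      3m-s = solve-∀
      upper : ∀ s → s < m → b (n ∸ suc s) * inv (+ suc m + + (n ∸ suc s)) ≈ - (b s * inv (+ 3 * + m - + s)) ⟨ + p ⟩
      upper s s<m = ≈-reflexive (trans (cong₂ (λ u v → u * inv v) (b-reflect s<m)
          (trans (cong (_+_ (+ suc m)) (trans (sym (trans (ℤ.m-n≡m⊖n n (suc s)) (ℤ.⊖-≥ (s<n s<m)))) (cong (_- + suc s) +n≡))) (3m-s (+ m) (+ s))))
        (sym (ℤ.neg-distribˡ-* (b s) (inv (+ 3 * + m - + s)))))

  -- By `beta`, -2V ≡ (n - 1)! m! / (n + m)!. With (n + m)! m! ≡ (-1)ᵐ n!² and C(2m, m) = n!/m!²,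
  -- all factorials cancel except n!/(n - 1)!, so V σC ≡ -1/(2n) ≡ 1.
  V*σC≈1 : V * σC ≈ + 1 ⟨ + p ⟩
  V*σC≈1 = *-cancelˡ-≈p (+ 2 * -1ℤ) (Unit-* Unit-2 (λ e → Unit-1 (neg-≈ e))) (*-cancelˡ-≈p (f * (g * g)) (Unit-* f≉0 (Unit-* g≉0 g≉0)) (begin
    f * (g * g) * (+ 2 * -1ℤ * (V * σC)) ≈⟨ *-≈ˡ (f * (g * g)) (*-≈ʳ (V * σC) (*-≈ˡ (+ 2) 2n≈-1)) ⟨
    f * (g * g) * (+ 2 * (+ 2 * + n) * (V * σC)) ≡⟨ rearrange f g (+ n) V (-1ℤ ^ m) (cb m) ⟩
    + 2 * (+ 2 * V) * (-1ℤ ^ m * (+ n * f * (cb m * (g * g)))) ≡⟨ cong₂ (λ u v → + 2 * (+ 2 * V) * (-1ℤ ^ m * (u * v))) n*f≡ cb-m*m!² ⟩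
    + 2 * (+ 2 * V) * (-1ℤ ^ m * (+ (n !) * + (n !))) ≈⟨ *-≈ (*-≈ˡ (+ 2) (≈-sym -beta≈2V)) (≈-sym (!-reflect m m≤n)) ⟩
    + 2 * - beta-sum * (+ ((n ℕ.+ m) !) * + ((n ∸ m) !)) ≡⟨ cong₂ (λ j k → + 2 * - beta-sum * (+ (j !) * + (k !))) n+m≡ (trans (cong (_∸ m) n≡m+m) (ℕ.m+n∸n≡m m m)) ⟩
    + 2 * - beta-sum * (+ (suc (m ℕ.+ n′) !) * g) ≡⟨ rearrange′ beta-sum (+ (suc (m ℕ.+ n′) !)) g ⟩
    + 2 * -1ℤ * (beta-sum * + (suc (m ℕ.+ n′) !) * g) ≈⟨ *-≈ˡ (+ 2 * -1ℤ) (*-≈ʳ g (beta n′ m m+n′<q)) ⟩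
    + 2 * -1ℤ * (f * g * g) ≡⟨ rearrange″ f g ⟩
    f * (g * g) * (+ 2 * -1ℤ * + 1) ∎))
    where
    open ≈-Reasoning (+ p)
    f g : ℤ
    f = + (n′ !)
    g = + (m !)
    g≉0 : Unit g
    g≉0 = Unit-! m m<p
    n′<n : n′ < n
    n′<n = ℕ.≤-reflexive 1+n′≡n
    f≉0 : Unit f
    f≉0 = Unit-! n′ (ℕ.<-trans n′<n n<p)
    n*f≡ : + n * f ≡ + (n !)
    n*f≡ = trans (cong (λ k → + k * f) (sym 1+n′≡n)) (trans (sym (ℤ.pos-* (suc n′) (n′ !))) (cong (λ k → + (k !)) 1+n′≡n))
    n+m≡ : n ℕ.+ m ≡ suc (m ℕ.+ n′)
    n+m≡ = trans (ℕ.+-comm n m) (trans (cong (m ℕ.+_) (sym 1+n′≡n)) (ℕ.+-suc m n′))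
    m+n′<q : m ℕ.+ n′ < q
    m+n′<q = ℕ.<-≤-trans (ℕ.+-mono-≤-< m≤n n′<n) (ℕ.≤-reflexive n+n≡q)
    rearrange : ∀ f g n v s c → f * (g * g) * (+ 2 * (+ 2 * n) * (v * (s * c))) ≡ + 2 * (+ 2 * v) * (s * (n * f * (c * (g * g))))
    rearrange = solve-∀
    rearrange′ : ∀ β h g → + 2 * - β * (h * g) ≡ + 2 * -1ℤ * (β * h * g)
    rearrange′ = solve-∀
    rearrange″ : ∀ f g → + 2 * -1ℤ * (f * g * g) ≡ f * (g * g) * (+ 2 * -1ℤ * + 1)
    rearrange″ = solve-∀

  X : ℤ
  X = cb m * inv (+ 4) ^ m

  -- The power of 4 is eliminated by `[-4]^m*[1+pO]≈1`, which identifies 4⁻ᵐ with (-1)ᵐ (1 + p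
  -- O(m)).
  X≈ : X ≈ σC * (+ 1 + + p * O m) ⟨ + p * + p ⟩
  X≈ = begin
    cb m * inv (+ 4) ^ m ≡⟨ cong (_*_ (cb m)) (ℤ.*-identityʳ (inv (+ 4) ^ m)) ⟨
    cb m * (inv (+ 4) ^ m * + 1) ≈⟨ *-≈ˡ (cb m) (*-≈ˡ (inv (+ 4) ^ m) [-4]^m*[1+pO]≈1) ⟨
    cb m * (inv (+ 4) ^ m * ((- + 4) ^ m * (+ 1 + + p * O m))) ≡⟨ cong (λ u → cb m * (inv (+ 4) ^ m * (u * (+ 1 + + p * O m)))) (^-distribʳ-* -1ℤ (+ 4) m) ⟩
    cb m * (inv (+ 4) ^ m * (-1ℤ ^ m * (+ 4) ^ m * (+ 1 + + p * O m))) ≡⟨ rearrange (cb m) (inv (+ 4) ^ m) (-1ℤ ^ m) ((+ 4) ^ m) (+ 1 + + p * O m) ⟩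
    (+ 4) ^ m * inv (+ 4) ^ m * (σC * (+ 1 + + p * O m)) ≡⟨ cong (_* (σC * (+ 1 + + p * O m))) (^-distribʳ-* (+ 4) (inv (+ 4)) m) ⟨
    (+ 4 * inv (+ 4)) ^ m * (σC * (+ 1 + + p * O m)) ≈⟨ *-≈ʳ (σC * (+ 1 + + p * O m)) (≈-trans (^-≈ m (x*inv[x]≈1 Unit-4)) (≈-reflexive (ℤ.^-zeroˡ m))) ⟩
    + 1 * (σC * (+ 1 + + p * O m)) ≡⟨ ℤ.*-identityˡ _ ⟩
    σC * (+ 1 + + p * O m) ∎
    where
    open ≈-Reasoning (+ p * + p)
    rearrange : ∀ c i s f e → c * (i * (s * f * e)) ≡ f * i * (s * c * e)
    rearrange = solve-∀

  -- The main sum is σC (p - 1); since 2n ≡ -1, the correction is -p (σC (1 + O(m)) + V). The terms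
  -- p σC cancel, and σC (1 + p O(m)) reassembles to X.
  S[1]≈ : S (+ 1) ≈ - (X + + p * V) ⟨ + p * + p ⟩
  S[1]≈ = begin
    S (+ 1) ≈⟨ ∑-≈ p (λ x _ → χ≈teichmüller (+ x)) ⟩
    ∑ₚ (λ x → main x + + n * (+ p * correction x)) ≡⟨ trans (∑-+ p (λ x → main (+ x)) (λ x → + n * (+ p * correction (+ x))))
        (cong (_+_ (∑ₚ main)) (trans (∑-*ˡ p (+ n) (λ x → + p * correction (+ x))) (cong (_*_ (+ n)) (∑-*ˡ p (+ p) (λ x → correction (+ x)))))) ⟩
    ∑ₚ main + + n * (+ p * ∑ₚ correction) ≈⟨ +-≈ main-sum (≈-reflexive (cong (λ u → + n * (+ p * u)) correction-sum)) ⟩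
    σC * + q + + n * (+ p * ∑ n (λ s → b s * - ρ s)) ≡⟨ cong (_+_ (σC * + q)) (swap (+ n) (+ p) (∑ n (λ s → b s * - ρ s))) ⟩
    σC * + q + + p * (+ n * ∑ n (λ s → b s * - ρ s)) ≈⟨ +-≈ˡ (σC * + q) (*-≈-scale (+ p) (correction′)) ⟩
    σC * + q + + p * (-1ℤ * (σC * (+ 1 + O m) + V)) ≡⟨ collect σC (+ q) (O m) V ⟩
    - (σC * (+ 1 + + p * O m) + + p * V) ≈⟨ neg-≈ (+-≈ X≈ (≈-refl {x = + p * V})) ⟨
    - (X + + p * V) ∎
    where
    open ≈-Reasoning (+ p * + p)
    main correction : ℤ → ℤ
    main x = (x ^ p) ^ n * (x ^ p * x ^ p - + 1) ^ n
    correction x = (x ^ p) ^ n * ((x ^ p * x ^ p - + 1) ^ n′ * R (x ^ p * x ^ p))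
    swap : ∀ n P u → n * (P * u) ≡ P * (n * u)
    swap = solve-∀
    double : ∀ n u → n * (+ 2 * u) ≡ + 2 * n * u
    double = solve-∀
    collect : ∀ c q o v → c * q + (+ 1 + q) * (-1ℤ * (c * (+ 1 + o) + v)) ≡ - (c * (+ 1 + (+ 1 + q) * o) + (+ 1 + q) * v)
    collect = solve-∀
    correction′ : + n * ∑ n (λ s → b s * - ρ s) ≈ -1ℤ * (σC * (+ 1 + O m) + V) ⟨ + p ⟩
    correction′ = ≈-trans (*-≈ˡ (+ n) correction≈) (≈-trans (≈-reflexive (double (+ n) (U + V))) (*-≈ 2n≈-1 (+-≈ U≈ (≈-refl {x = V}))))

  X≈σC : X ≈ σC ⟨ + p ⟩
  X≈σC = ≈-trans (≈-weaken (+ p) X≈) (≈-trans (*-≈ˡ σC (+-≈ˡ (+ 1) (M*≈0 (O m)))) (≈-reflexive (ℤ.*-identityʳ σC)))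

  p*X*V≈p : + p * (X * V) ≈ + p ⟨ + p * + p ⟩
  p*X*V≈p = ≈-trans (*-≈-scale (+ p) (≈-trans (*-≈ʳ V X≈σC) (≈-trans (≈-reflexive (ℤ.*-comm σC V)) V*σC≈1))) (≈-reflexive (ℤ.*-identityʳ (+ p)))

  module _ (a c : ℤ) (a²+c²≡p : a * a + c * c ≡ + p) (a≈1 : a ≈ + 1 ⟨ + 4 ⟩) where

    2A : ℤ
    2A = + 2 * (-1ℤ ^ m * a)

    2A≈ : 2A ≈ X + + p * V ⟨ + p * + p ⟩
    2A≈ = ≈-trans (≈-reflexive (trans (sym (ℤ.neg-involutive 2A)) (cong -_ (sym (S[1]≡ a c a²+c²≡p a≈1))))) (≈-trans (neg-≈ S[1]≈) (≈-reflexive (ℤ.neg-involutive (X + + p * V))))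

    -- Modulo p, 2A is ± C(2m, m), whose factorial form contains no factor p.
    Unit-a : Unit a
    Unit-a = Unit-*ʳ (-1ℤ ^ m) a (Unit-*ʳ (+ 2) (-1ℤ ^ m * a) (Unit-≈ (≈-sym 2A≈σC) (Unit-* (Unit-^ m (λ e → Unit-1 (neg-≈ e))) Unit-cb-m)))
      where
      2A≈σC : 2A ≈ σC ⟨ + p ⟩
      2A≈σC = ≈-trans (≈-weaken (+ p) 2A≈) (≈-trans (+-≈ X≈σC (M*≈0 V)) (≈-reflexive (ℤ.+-identityʳ σC)))

    -- The relation X ≡ 2A - p/(2A) without denominators. From 2A ≡ X + p V and p X V ≡ p, both
    -- sides equal X² + p modulo p².
    X*2A≈ : X * 2A ≈ 2A * 2A - + p ⟨ + p * + p ⟩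
    X*2A≈ = begin
      X * 2A ≈⟨ *-≈ˡ X 2A≈ ⟩
      X * (X + + p * V) ≡⟨ expand X (+ p) V ⟩
      X * X + + p * (X * V) ≈⟨ +-≈ˡ (X * X) p*X*V≈p ⟩
      X * X + + p ≡⟨ expand′ X (+ p) ⟩
      X * X + + 2 * + p - + p ≈⟨ −-≈ (+-≈ˡ (X * X) (*-≈ˡ (+ 2) p*X*V≈p)) (≈-refl {x = + p}) ⟨
      X * X + + 2 * (+ p * (X * V)) - + p ≈⟨ by (- (V * V)) (expand″ X (+ p) V) ⟩
      (X + + p * V) * (X + + p * V) - + p ≈⟨ −-≈ (*-≈ 2A≈ 2A≈) (≈-refl {x = + p}) ⟨
      2A * 2A - + p ∎
      where
      open ≈-Reasoning (+ p * + p)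
      expand : ∀ x P v → x * (x + P * v) ≡ x * x + P * (x * v)
      expand = solve-∀
      expand′ : ∀ x P → x * x + P ≡ x * x + + 2 * P - P
      expand′ = solve-∀
      expand″ : ∀ x P v → x * x + + 2 * (P * (x * v)) - P ≡ (x + P * v) * (x + P * v) - P + - (v * v) * (P * P)
      expand″ = solve-∀

-- Coefficients of (1 - 4t)^(-1/2) (1 + 4t)^(-1/2) = (1 - 16t²)^(-1/2)

private
  convolution : (ℕ → ℤ) → ℕ → ℤ
  convolution w N = ∑ (suc N) (λ k → -1ℤ ^ k * w k * (cb k * cb (N ∸ k)))

  conv convˡ convʳ : ℕ → ℤ
  conv N = convolution (λ _ → + 1) N
  convˡ N = convolution (λ k → + k) N
  convʳ N = convolution (λ k → + (N ∸ k)) N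

  convˡ+convʳ : ∀ N → convˡ N + convʳ N ≡ + N * conv N
  convˡ+convʳ N = trans (sym (∑-+ (suc N) _ _)) (trans (∑-cong (suc N) (λ k k≤N → trans (lemma (-1ℤ ^ k) (+ k) (+ (N ∸ k)) (cb k * cb (N ∸ k)))
      (cong (λ j → + j * (-1ℤ ^ k * + 1 * (cb k * cb (N ∸ k)))) (ℕ.m+[n∸m]≡n (ℕ.s≤s⁻¹ k≤N))))) (∑-*ˡ (suc N) (+ N) _))
    where
    lemma : ∀ s k l c → s * k * c + s * l * c ≡ (k + l) * (s * + 1 * c)
    lemma = solve-∀

  -- The weight k is t d/dt acting on the factor F = (1 + 4t)^(-1/2); this is the coefficient form
  -- of (1 + 4t) F' = -2F. `convʳ-suc` treats the other factor in the same way.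
  convˡ-suc : ∀ N → convˡ (suc N) ≡ - (+ 4 * convˡ N + + 2 * conv N)
  convˡ-suc N = begin
    convˡ (suc N)
      ≡⟨ ∑-head (suc N) (λ k → -1ℤ ^ k * + k * (cb k * cb (suc N ∸ k))) ⟩
    + 1 * + 0 * (cb 0 * cb (suc N)) + ∑ (suc N) (λ k → -1ℤ ^ suc k * + suc k * (cb (suc k) * cb (N ∸ k)))
      ≡⟨ trans (cong (_+ ∑ (suc N) (λ k → -1ℤ ^ suc k * + suc k * (cb (suc k) * cb (N ∸ k)))) (zeroes (cb 0 * cb (suc N)))) (ℤ.+-identityˡ _) ⟩
    ∑ (suc N) (λ k → -1ℤ ^ suc k * + suc k * (cb (suc k) * cb (N ∸ k)))
      ≡⟨ ∑-ext (suc N) (λ k → trans (pull (-1ℤ ^ k) (+ suc k) (cb (suc k)) (cb (N ∸ k))) (trans (cong (λ u → - (-1ℤ ^ k * (u * cb (N ∸ k)))) (cb-suc k)) (expand (-1ℤ ^ k) (+ k) (cb k) (cb (N ∸ k))))) ⟩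
    ∑ (suc N) (λ k → - (+ 4 * (-1ℤ ^ k * + k * (cb k * cb (N ∸ k))) + + 2 * (-1ℤ ^ k * + 1 * (cb k * cb (N ∸ k)))))
      ≡⟨ trans (∑-neg (suc N) _) (cong -_ (trans (∑-+ (suc N) _ _) (cong₂ _+_ (∑-*ˡ (suc N) (+ 4) _) (∑-*ˡ (suc N) (+ 2) _)))) ⟩
    - (+ 4 * convˡ N + + 2 * conv N) ∎
    where
    open ≡-Reasoning
    zeroes : ∀ c → + 1 * + 0 * c ≡ + 0
    zeroes = solve-∀
    pull : ∀ s k c d → -1ℤ * s * k * (c * d) ≡ - (s * (k * c * d))
    pull = solve-∀
    expand : ∀ s k c d → - (s * (+ 2 * (+ 2 * k + + 1) * c * d)) ≡ - (+ 4 * (s * k * (c * d)) + + 2 * (s * + 1 * (c * d)))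
    expand = solve-∀

  convʳ-suc : ∀ N → convʳ (suc N) ≡ + 4 * convʳ N + + 2 * conv N
  convʳ-suc N = begin
    convʳ (suc N)
      ≡⟨ cong (λ j → ∑ (suc N) (λ k → -1ℤ ^ k * + (suc N ∸ k) * (cb k * cb (suc N ∸ k))) + -1ℤ ^ suc N * + j * (cb (suc N) * cb j)) (ℕ.n∸n≡0 N) ⟩
    ∑ (suc N) (λ k → -1ℤ ^ k * + (suc N ∸ k) * (cb k * cb (suc N ∸ k))) + -1ℤ ^ suc N * + 0 * (cb (suc N) * cb 0)
      ≡⟨ trans (cong (_+_ (∑ (suc N) _)) (zeroes (-1ℤ ^ suc N) (cb (suc N) * cb 0))) (ℤ.+-identityʳ _) ⟩
    ∑ (suc N) (λ k → -1ℤ ^ k * + (suc N ∸ k) * (cb k * cb (suc N ∸ k)))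
      ≡⟨ ∑-cong (suc N) (λ k k≤N → trans (cong (λ j → -1ℤ ^ k * + j * (cb k * cb j)) (ℕ.+-∸-assoc 1 (ℕ.s≤s⁻¹ k≤N)))
           (trans (pull (-1ℤ ^ k) (+ suc (N ∸ k)) (cb k) (cb (suc (N ∸ k)))) (trans (cong (λ u → -1ℤ ^ k * (cb k * u)) (cb-suc (N ∸ k))) (expand (-1ℤ ^ k) (+ (N ∸ k)) (cb k) (cb (N ∸ k)))))) ⟩
    ∑ (suc N) (λ k → + 4 * (-1ℤ ^ k * + (N ∸ k) * (cb k * cb (N ∸ k))) + + 2 * (-1ℤ ^ k * + 1 * (cb k * cb (N ∸ k))))
      ≡⟨ trans (∑-+ (suc N) _ _) (cong₂ _+_ (∑-*ˡ (suc N) (+ 4) _) (∑-*ˡ (suc N) (+ 2) _)) ⟩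
    + 4 * convʳ N + + 2 * conv N ∎
    where
    open ≡-Reasoning
    zeroes : ∀ s c → s * + 0 * c ≡ + 0
    zeroes = solve-∀
    pull : ∀ s j c d → s * j * (c * d) ≡ s * (c * (j * d))
    pull = solve-∀
    expand : ∀ s j c d → s * (c * (+ 2 * (+ 2 * j + + 1) * d)) ≡ + 4 * (s * j * (c * d)) + + 2 * (s * + 1 * (c * d))
    expand = solve-∀

  -- The coefficient form of (1 - 16t²) y' = 16 t y. The odd coefficients conv (N + 1) cancel
  -- between the two factors.
  conv-suc-suc : ∀ N → + suc (suc N) * conv (suc (suc N)) ≡ + 16 * + suc N * conv N
  conv-suc-suc N = begin
    + suc (suc N) * conv (suc (suc N)) ≡⟨ convˡ+convʳ (suc (suc N)) ⟨
    convˡ (suc (suc N)) + convʳ (suc (suc N)) ≡⟨ cong₂ _+_ (convˡ-suc (suc N)) (convʳ-suc (suc N)) ⟩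
    - (+ 4 * convˡ (suc N) + + 2 * conv (suc N)) + (+ 4 * convʳ (suc N) + + 2 * conv (suc N))
      ≡⟨ cong₂ (λ u v → - (+ 4 * u + + 2 * conv (suc N)) + (+ 4 * v + + 2 * conv (suc N))) (convˡ-suc N) (convʳ-suc N) ⟩
    - (+ 4 * - (+ 4 * convˡ N + + 2 * conv N) + + 2 * conv (suc N)) + (+ 4 * (+ 4 * convʳ N + + 2 * conv N) + + 2 * conv (suc N))
      ≡⟨ collect (convˡ N) (convʳ N) (conv N) (conv (suc N)) ⟩
    + 16 * (convˡ N + convʳ N) + + 16 * conv N ≡⟨ cong (λ u → + 16 * u + + 16 * conv N) (convˡ+convʳ N) ⟩
    + 16 * (+ N * conv N) + + 16 * conv N ≡⟨ collect′ (+ N) (conv N) ⟩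
    + 16 * + suc N * conv N ∎
    where
    open ≡-Reasoning
    collect : ∀ a b c d → - (+ 4 * - (+ 4 * a + + 2 * c) + + 2 * d) + (+ 4 * (+ 4 * b + + 2 * c) + + 2 * d) ≡ + 16 * (a + b) + + 16 * c
    collect = solve-∀
    collect′ : ∀ N c → + 16 * (N * c) + + 16 * c ≡ + 16 * (+ 1 + N) * c
    collect′ = solve-∀

  conv-even : ∀ M → conv (2 ℕ.* M) ≡ (+ 4) ^ M * cb M
  conv-even zero = trans (lemma (cb 0)) (cong (_*_ (+ 1)) (trans (cong (_* cb 0) cb-zero) (ℤ.*-identityˡ (cb 0))))
    where
    lemma : ∀ c → + 0 + + 1 * + 1 * (c * c) ≡ + 1 * (c * c)
    lemma = solve-∀
  conv-even (suc M) = ℤ.*-cancelˡ-≡ (+ suc (suc (2 ℕ.* M))) _ _ (begin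
    + suc (suc (2 ℕ.* M)) * conv (2 ℕ.* suc M) ≡⟨ cong (λ j → + suc (suc (2 ℕ.* M)) * conv j) (2*suc M) ⟩
    + suc (suc (2 ℕ.* M)) * conv (suc (suc (2 ℕ.* M))) ≡⟨ conv-suc-suc (2 ℕ.* M) ⟩
    + 16 * + suc (2 ℕ.* M) * conv (2 ℕ.* M) ≡⟨ cong₂ (λ u v → + 16 * (+ 1 + u) * v) (ℤ.pos-* 2 M) (conv-even M) ⟩
    + 16 * (+ 1 + + 2 * + M) * ((+ 4) ^ M * cb M) ≡⟨ regroup (+ M) ((+ 4) ^ M) (cb M) ⟩
    + 2 * (+ 4) ^ suc M * (+ 2 * (+ 2 * + M + + 1) * cb M) ≡⟨ cong (_*_ (+ 2 * (+ 4) ^ suc M)) (cb-suc M) ⟨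
    + 2 * (+ 4) ^ suc M * (+ suc M * cb (suc M)) ≡⟨ regroup′ (+ M) ((+ 4) ^ suc M) (cb (suc M)) ⟩
    (+ 2 + + 2 * + M) * ((+ 4) ^ suc M * cb (suc M)) ≡⟨ cong (λ u → (+ 2 + u) * ((+ 4) ^ suc M * cb (suc M))) (ℤ.pos-* 2 M) ⟨
    + suc (suc (2 ℕ.* M)) * ((+ 4) ^ suc M * cb (suc M)) ∎)
    where
    open ≡-Reasoning
    regroup : ∀ M f c → + 16 * (+ 1 + + 2 * M) * (f * c) ≡ + 2 * (+ 4 * f) * (+ 2 * (+ 2 * M + + 1) * c)
    regroup = solve-∀
    regroup′ : ∀ M f c → + 2 * f * ((+ 1 + M) * c) ≡ (+ 2 + + 2 * M) * (f * c)
    regroup′ = solve-∀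

∑-cb-cb : ∀ M → ∑ (suc (2 ℕ.* M)) (λ k → -1ℤ ^ k * (cb k * cb (2 ℕ.* M ∸ k))) ≡ (+ 4) ^ M * cb M
∑-cb-cb M = trans (∑-ext (suc (2 ℕ.* M)) (λ k → cong (_* (cb k * cb (2 ℕ.* M ∸ k))) (sym (ℤ.*-identityʳ (-1ℤ ^ k))))) (conv-even M)

-- 2ⁿ Pₙ(x), and Pₙ(1 + 2u) as its expansion at x = 1

legendre-coefficient : ℕ → ℕ → ℤ
legendre-coefficient n k = -1ℤ ^ k * (cb (n ∸ k) * B (n ∸ k) k)

2^n*legendre : ℕ → ℤ → ℤ
2^n*legendre n x = ∑ (suc n) (λ k → legendre-coefficient n k * x ^ (n ∸ 2 ℕ.* k))

-- This is C(n, k) C(n + k, k). In the present form one factor is already `cb k`, and the other is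
-- congruent to it up to (-16)ᵏ.
shifted-coefficient : ℕ → ℕ → ℤ
shifted-coefficient n k = B (n ℕ.+ k) (2 ℕ.* k) * cb k

shifted-legendre : ℕ → ℤ → ℤ
shifted-legendre n u = ∑ (suc n) (λ k → shifted-coefficient n k * u ^ k)

-- Justifies the summation range k ≤ n: past n/2 the exponent n ∸ 2k is truncated to 0, so it is the
-- coefficient that has to vanish.
legendre-coefficient-above : ∀ n k → n < 2 ℕ.* k → legendre-coefficient n k ≡ + 0
legendre-coefficient-above n k n<2k = trans (cong (λ b → -1ℤ ^ k * (cb (n ∸ k) * b)) (B-above {n ∸ k} {k} n∸k<k)) (lemma (-1ℤ ^ k) (cb (n ∸ k)))
  where
  lemma : ∀ s c → s * (c * + 0) ≡ + 0
  lemma = solve-∀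
  n∸k<k : n ∸ k < k
  n∸k<k = [ (λ n≤k → subst (_< k) (sym (ℕ.m≤n⇒m∸n≡0 n≤k)) (positive k n<2k))
          , (λ k≤n → ℕ.+-cancelʳ-< k (n ∸ k) k (subst₂ _<_ (sym (ℕ.m∸n+n≡m k≤n)) (cong (k ℕ.+_) (ℕ.+-identityʳ k)) n<2k)) ]′ (ℕ.≤-total n k)
    where
    positive : ∀ k → n < 2 ℕ.* k → 0 < k
    positive (suc k) _ = s≤s z≤n

-- The coefficient of x^(n - 2i) in Bonnet's recurrence, with n = J + i to avoid truncated
-- subtraction. After `cb-suc` and Pascal's rule, the surplus is 2 cb J times the relation
-- `B-stepʳ`.
legendre-coefficient-rec : ∀ J i → + suc (suc (J ℕ.+ i)) * (cb (suc J) * B (suc J) (suc i))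
  ≡ + 2 * (+ 2 * + (J ℕ.+ i) + + 3) * (cb J * B J (suc i)) + + 4 * + suc (J ℕ.+ i) * (cb J * B J i)
legendre-coefficient-rec J i = ℤ.*-cancelˡ-≡ (+ suc J) _ _ (begin
  + suc J * (+ suc (suc (J ℕ.+ i)) * (cb (suc J) * B (suc J) (suc i)))
    ≡⟨ pull (+ suc J) (+ suc (suc (J ℕ.+ i))) (cb (suc J)) (B (suc J) (suc i)) ⟩
  + suc (suc (J ℕ.+ i)) * (+ suc J * cb (suc J)) * B (suc J) (suc i)
    ≡⟨ cong₂ (λ u v → + suc (suc (J ℕ.+ i)) * u * v) (cb-suc J) (B-pascal J i) ⟩
  + suc (suc (J ℕ.+ i)) * (+ 2 * (+ 2 * + J + + 1) * cb J) * (B J i + B J (suc i))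
    ≡⟨ expand (+ J) (+ i) (cb J) (B J i) (B J (suc i)) ⟩
  rhs + + 2 * cb J * ((+ J - + i) * B J i - + suc i * B J (suc i))
    ≡⟨ cong (λ u → rhs + + 2 * cb J * ((+ J - + i) * B J i - u)) (B-stepʳ J i) ⟩
  rhs + + 2 * cb J * ((+ J - + i) * B J i - (+ J - + i) * B J i)
    ≡⟨ cancel rhs (+ 2 * cb J) ((+ J - + i) * B J i) ⟩
  rhs ∎)
  where
  open ≡-Reasoning
  rhs : ℤ
  rhs = + suc J * (+ 2 * (+ 2 * + (J ℕ.+ i) + + 3) * (cb J * B J (suc i)) + + 4 * + suc (J ℕ.+ i) * (cb J * B J i))
  pull : ∀ j n c b → j * (n * (c * b)) ≡ n * (j * c) * b
  pull = solve-∀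
  expand : ∀ J i c x y → (+ 2 + (J + i)) * (+ 2 * (+ 2 * J + + 1) * c) * (x + y)
      ≡ (+ 1 + J) * (+ 2 * (+ 2 * (J + i) + + 3) * (c * y) + + 4 * (+ 1 + (J + i)) * (c * x)) + + 2 * c * ((J - i) * x - (+ 1 + i) * y)
  expand = solve-∀
  cancel : ∀ r c x → r + c * (x - x) ≡ r
  cancel = solve-∀

-- Bonnet's recurrence times 2^(n+2), whence the extra factors 2 and 4.
2^n*legendre-rec : ∀ n x → + suc (suc n) * 2^n*legendre (suc (suc n)) x ≡ + 2 * (+ 2 * + n + + 3) * x * 2^n*legendre (suc n) x - + 4 * + suc n * 2^n*legendre n x
2^n*legendre-rec n x = begin
  + suc (suc n) * (∑ (suc (suc n)) f₂ + f₂ (suc (suc n)))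
    ≡⟨ cong (_*_ (+ suc (suc n))) (trans (cong (_+_ (∑ (suc (suc n)) f₂)) last) (trans (ℤ.+-identityʳ _) (∑-head (suc n) f₂))) ⟩
  + suc (suc n) * (f₂ 0 + ∑ (suc n) (f₂ ∘ suc))
    ≡⟨ trans (ℤ.*-distribˡ-+ (+ suc (suc n)) (f₂ 0) _) (cong₂ _+_ head (sym (∑-*ˡ (suc n) (+ suc (suc n)) (f₂ ∘ suc)))) ⟩
  c * f₁ 0 + ∑ (suc n) (λ i → + suc (suc n) * f₂ (suc i))
    ≡⟨ cong (_+_ (c * f₁ 0)) (trans (∑-cong (suc n) step) (trans (∑-− (suc n) (λ i → c * f₁ (suc i)) (λ i → d * f₀ i)) (cong₂ _-_ (∑-*ˡ (suc n) c (f₁ ∘ suc)) (∑-*ˡ (suc n) d f₀)))) ⟩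
  c * f₁ 0 + (c * ∑ (suc n) (f₁ ∘ suc) - d * ∑ (suc n) f₀)
    ≡⟨ collect c (f₁ 0) (∑ (suc n) (f₁ ∘ suc)) (d * ∑ (suc n) f₀) ⟩
  c * (f₁ 0 + ∑ (suc n) (f₁ ∘ suc)) - d * ∑ (suc n) f₀
    ≡⟨ cong (λ u → c * u - d * ∑ (suc n) f₀) (∑-head (suc n) f₁) ⟨
  c * 2^n*legendre (suc n) x - d * 2^n*legendre n x ∎
  where
  open ≡-Reasoning
  f₀ f₁ f₂ : ℕ → ℤ
  f₀ k = legendre-coefficient n k * x ^ (n ∸ 2 ℕ.* k)
  f₁ k = legendre-coefficient (suc n) k * x ^ (suc n ∸ 2 ℕ.* k)
  f₂ k = legendre-coefficient (suc (suc n)) k * x ^ (suc (suc n) ∸ 2 ℕ.* k)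
  c d : ℤ
  c = + 2 * (+ 2 * + n + + 3) * x
  d = + 4 * + suc n
  collect : ∀ c a b d → c * a + (c * b - d) ≡ c * (a + b) - d
  collect = solve-∀
  zeroes : ∀ y → + 0 * y ≡ + 0
  zeroes = solve-∀
  last : f₂ (suc (suc n)) ≡ + 0
  last = trans (cong (_* x ^ (suc (suc n) ∸ 2 ℕ.* suc (suc n))) (legendre-coefficient-above (suc (suc n)) (suc (suc n)) (ℕ.m<m+n (suc (suc n)) (s≤s z≤n)))) (zeroes (x ^ (suc (suc n) ∸ 2 ℕ.* suc (suc n))))
  head : + suc (suc n) * f₂ 0 ≡ c * f₁ 0
  head = begin
    + suc (suc n) * (+ 1 * (cb (suc (suc n)) * B (suc (suc n)) 0) * (x * (x * x ^ n))) ≡⟨ cong (λ b → + suc (suc n) * (+ 1 * (cb (suc (suc n)) * b) * (x * (x * x ^ n)))) (B-zero (suc (suc n))) ⟩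
    + suc (suc n) * (+ 1 * (cb (suc (suc n)) * + 1) * (x * (x * x ^ n))) ≡⟨ pull (+ suc (suc n)) (cb (suc (suc n))) x (x ^ n) ⟩
    + suc (suc n) * cb (suc (suc n)) * (x * (x * x ^ n)) ≡⟨ cong (_* (x * (x * x ^ n))) (cb-suc (suc n)) ⟩
    + 2 * (+ 2 * + suc n + + 1) * cb (suc n) * (x * (x * x ^ n)) ≡⟨ pull′ (+ n) (cb (suc n)) x (x ^ n) ⟩
    c * (+ 1 * (cb (suc n) * + 1) * (x * x ^ n)) ≡⟨ cong (λ b → c * (+ 1 * (cb (suc n) * b) * (x * x ^ n))) (B-zero (suc n)) ⟨
    c * (+ 1 * (cb (suc n) * B (suc n) 0) * (x * x ^ n)) ∎
    where
    pull : ∀ n c x y → n * (+ 1 * (c * + 1) * (x * (x * y))) ≡ n * c * (x * (x * y))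
    pull = solve-∀
    pull′ : ∀ n c x y → + 2 * (+ 2 * (+ 1 + n) + + 1) * c * (x * (x * y)) ≡ + 2 * (+ 2 * n + + 3) * x * (+ 1 * (c * + 1) * (x * y))
    pull′ = solve-∀
  -- The exponents fail to match only where the subtraction is truncated, and there the coefficient
  -- is zero.
  x-power : ∀ i → legendre-coefficient (suc n) (suc i) * x ^ (n ∸ 2 ℕ.* i) ≡ x * f₁ (suc i)
  x-power i = [ (λ n<2i+1 → trans (cong (_* x ^ (n ∸ 2 ℕ.* i)) (vanish n<2i+1)) (trans (zeroes (x ^ (n ∸ 2 ℕ.* i)))
      (sym (trans (cong (λ b → x * (b * x ^ (suc n ∸ 2 ℕ.* suc i))) (vanish n<2i+1)) (zeroes′ x (x ^ (suc n ∸ 2 ℕ.* suc i)))))))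
      , (λ 2i+1≤n → trans (cong (λ k → legendre-coefficient (suc n) (suc i) * x ^ k) (ℕ.+-∸-assoc 1 2i+1≤n))
      (trans (swap (legendre-coefficient (suc n) (suc i)) x (x ^ (n ∸ suc (2 ℕ.* i))))
      (cong (λ k → x * (legendre-coefficient (suc n) (suc i) * x ^ (suc n ∸ k))) (sym (2*suc i)))))
      ]′ (ℕ.<-≤-connex n (suc (2 ℕ.* i)))
    where
    swap : ∀ e x y → e * (x * y) ≡ x * (e * y)
    swap = solve-∀
    zeroes′ : ∀ x y → x * (+ 0 * y) ≡ + 0
    zeroes′ = solve-∀
    vanish : n < suc (2 ℕ.* i) → legendre-coefficient (suc n) (suc i) ≡ + 0
    vanish n<2i+1 = legendre-coefficient-above (suc n) (suc i) (ℕ.<-≤-trans (s≤s n<2i+1) (ℕ.≤-reflexive (sym (2*suc i))))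
  step : ∀ i → i < suc n → + suc (suc n) * f₂ (suc i) ≡ c * f₁ (suc i) - d * f₀ i
  step i i≤n = begin
    + suc (suc n) * f₂ (suc i)
      ≡⟨ cong₂ (λ j k → + suc (suc n) * (-1ℤ ^ suc i * (cb j * B j (suc i)) * x ^ (suc (suc n) ∸ k))) (ℕ.+-∸-assoc 1 (ℕ.s≤s⁻¹ i≤n)) (2*suc i) ⟩
    + suc (suc n) * (-1ℤ ^ suc i * (cb (suc J) * B (suc J) (suc i)) * y)
      ≡⟨ pull (+ suc (suc n)) (-1ℤ ^ i) (cb (suc J) * B (suc J) (suc i)) y ⟩
    - (-1ℤ ^ i * (+ suc (suc n) * (cb (suc J) * B (suc J) (suc i))) * y)
      ≡⟨ cong (λ u → - (-1ℤ ^ i * u * y)) (subst (λ k → + suc (suc k) * (cb (suc J) * B (suc J) (suc i)) ≡ + 2 * (+ 2 * + k + + 3) * (cb J * B J (suc i)) + + 4 * + suc k * (cb J * B J i))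
           (ℕ.m∸n+n≡m (ℕ.s≤s⁻¹ i≤n)) (legendre-coefficient-rec J i)) ⟩
    - (-1ℤ ^ i * (+ 2 * (+ 2 * + n + + 3) * (cb J * B J (suc i)) + d * (cb J * B J i)) * y)
      ≡⟨ distrib (-1ℤ ^ i) (+ n) (cb J * B J (suc i)) (cb J * B J i) y ⟩
    + 2 * (+ 2 * + n + + 3) * (-1ℤ ^ suc i * (cb J * B J (suc i)) * y) - d * f₀ i
      ≡⟨ cong (λ u → + 2 * (+ 2 * + n + + 3) * u - d * f₀ i) (x-power i) ⟩
    + 2 * (+ 2 * + n + + 3) * (x * f₁ (suc i)) - d * f₀ i
      ≡⟨ cong (_- d * f₀ i) (ℤ.*-assoc (+ 2 * (+ 2 * + n + + 3)) x (f₁ (suc i))) ⟨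
    c * f₁ (suc i) - d * f₀ i ∎
    where
    J = n ∸ i
    y : ℤ
    y = x ^ (n ∸ 2 ℕ.* i)
    pull : ∀ n s c y → n * (-1ℤ * s * c * y) ≡ - (s * (n * c) * y)
    pull = solve-∀
    distrib : ∀ s n a b y → - (s * (+ 2 * (+ 2 * n + + 3) * a + + 4 * (+ 1 + n) * b) * y) ≡ + 2 * (+ 2 * n + + 3) * (-1ℤ * s * a * y) - + 4 * (+ 1 + n) * (s * b * y)
    distrib = solve-∀

shifted-coefficient-above : ∀ n k → n < k → shifted-coefficient n k ≡ + 0
shifted-coefficient-above n k n<k = trans (cong (_* cb k) (B-above {n ℕ.+ k} {2 ℕ.* k} (ℕ.<-≤-trans (ℕ.+-monoˡ-< k n<k) (ℕ.≤-reflexive (cong (k ℕ.+_) (sym (ℕ.+-identityʳ k))))))) (ℤ.*-zeroˡ (cb k))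

-- Bonnet's recurrence with x = 1 + 2u, compared at u^(j+1). Pascal's rule brings the binomials to
-- row n + j + 1; `cb-suc` and one step from column 2j to 2j + 1 do the rest.
shifted-coefficient-rec : ∀ n j → + suc (suc n) * shifted-coefficient (suc (suc n)) (suc j)
  ≡ (+ 2 * + n + + 3) * (shifted-coefficient (suc n) (suc j) + + 2 * shifted-coefficient (suc n) j) - + suc n * shifted-coefficient n (suc j)
shifted-coefficient-rec n j = ℤ.*-cancelˡ-≡ (+ suc j) _ _ (begin
  + suc j * (+ suc (suc n) * (B (suc (suc n) ℕ.+ suc j) (2 ℕ.* suc j) * cb (suc j)))
    ≡⟨ cong₂ (λ N k → + suc j * (+ suc (suc n) * (B (suc (suc N)) k * cb (suc j)))) (ℕ.+-suc n j) (2*suc j) ⟩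
  + suc j * (+ suc (suc n) * (B (suc (suc N)) (suc (suc 2j)) * cb (suc j)))
    ≡⟨ cong (λ b → + suc j * (+ suc (suc n) * (b * cb (suc j)))) (trans (B-pascal (suc N) (suc 2j)) (cong₂ _+_ (B-pascal N 2j) (B-pascal N (suc 2j)))) ⟩
  + suc j * (+ suc (suc n) * ((β + α + (α + γ)) * cb (suc j)))
    ≡⟨ split (+ j) (+ n) α β γ (cb (suc j)) ⟩
  + suc j * ((+ 2 * + n + + 3) * ((α + γ) * cb (suc j)) - + suc n * (γ * cb (suc j))) + (α + + suc (suc n) * β) * (+ suc j * cb (suc j))
    ≡⟨ cong (λ u → A + (α + + suc (suc n) * β) * u) (cb-suc j) ⟩
  A + (α + + suc (suc n) * β) * (+ 2 * (+ 2 * + j + + 1) * cb j)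
    ≡⟨ split′ A (+ n) (+ j) α β (cb j) ⟩
  A + + 2 * cb j * ((+ 1 + + 2 * + j) * α + + suc (suc n) * (+ 2 * + j + + 1) * β)
    ≡⟨ cong (λ u → A + + 2 * cb j * (u + + suc (suc n) * (+ 2 * + j + + 1) * β)) (trans (cong (λ u → (+ 1 + u) * α) (sym (ℤ.pos-* 2 j))) (trans (B-stepʳ N 2j) (cong (λ u → (+ N - u) * β) (ℤ.pos-* 2 j)))) ⟩
  A + + 2 * cb j * ((+ 1 + (+ n + + j) - + 2 * + j) * β + + suc (suc n) * (+ 2 * + j + + 1) * β)
    ≡⟨ split″ (+ n) (+ j) α β γ (cb (suc j)) (cb j) ⟩
  + suc j * ((+ 2 * + n + + 3) * ((α + γ) * cb (suc j) + + 2 * (β * cb j)) - + suc n * (γ * cb (suc j)))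
    ≡⟨ cong (λ b → + suc j * ((+ 2 * + n + + 3) * (b * cb (suc j) + + 2 * (β * cb j)) - + suc n * (γ * cb (suc j)))) (B-pascal N (suc 2j)) ⟨
  + suc j * ((+ 2 * + n + + 3) * (B (suc N) (suc (suc 2j)) * cb (suc j) + + 2 * (β * cb j)) - + suc n * (B N (suc (suc 2j)) * cb (suc j)))
    ≡⟨ cong₂ (λ M k → + suc j * ((+ 2 * + n + + 3) * (B (suc M) k * cb (suc j) + + 2 * (β * cb j)) - + suc n * (B M k * cb (suc j)))) (ℕ.+-suc n j) (2*suc j) ⟨
  + suc j * ((+ 2 * + n + + 3) * (shifted-coefficient (suc n) (suc j) + + 2 * shifted-coefficient (suc n) j) - + suc n * shifted-coefficient n (suc j)) ∎)
  where
  open ≡-Reasoning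
  N 2j : ℕ
  N = suc (n ℕ.+ j)
  2j = 2 ℕ.* j
  α β γ A : ℤ
  α = B N (suc 2j)
  β = B N 2j
  γ = B N (suc (suc 2j))
  A = + suc j * ((+ 2 * + n + + 3) * ((α + γ) * cb (suc j)) - + suc n * (γ * cb (suc j)))
  split : ∀ j n α β γ c → (+ 1 + j) * ((+ 2 + n) * ((β + α + (α + γ)) * c))
      ≡ (+ 1 + j) * ((+ 2 * n + + 3) * ((α + γ) * c) - (+ 1 + n) * (γ * c)) + (α + (+ 2 + n) * β) * ((+ 1 + j) * c)
  split = solve-∀
  split′ : ∀ A n j α β c → A + (α + (+ 2 + n) * β) * (+ 2 * (+ 2 * j + + 1) * c) ≡ A + + 2 * c * ((+ 1 + + 2 * j) * α + (+ 2 + n) * (+ 2 * j + + 1) * β)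
  split′ = solve-∀
  split″ : ∀ n j α β γ c d → (+ 1 + j) * ((+ 2 * n + + 3) * ((α + γ) * c) - (+ 1 + n) * (γ * c)) + + 2 * d * ((+ 1 + (n + j) - + 2 * j) * β + (+ 2 + n) * (+ 2 * j + + 1) * β)
      ≡ (+ 1 + j) * ((+ 2 * n + + 3) * ((α + γ) * c + + 2 * (β * d)) - (+ 1 + n) * (γ * c))
  split″ = solve-∀

shifted-coefficient-zero : ∀ n → shifted-coefficient n 0 ≡ + 1
shifted-coefficient-zero n = cong₂ _*_ (B-zero (n ℕ.+ 0)) cb-zero

shifted-legendre-rec : ∀ n u → + suc (suc n) * shifted-legendre (suc (suc n)) u
  ≡ (+ 2 * + n + + 3) * (+ 1 + + 2 * u) * shifted-legendre (suc n) u - + suc n * shifted-legendre n u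
shifted-legendre-rec n u = begin
  + suc (suc n) * ∑ (suc K) f₂
    ≡⟨ cong (_*_ (+ suc (suc n))) (∑-head K f₂) ⟩
  + suc (suc n) * (f₂ 0 + ∑ K (f₂ ∘ suc))
    ≡⟨ trans (ℤ.*-distribˡ-+ (+ suc (suc n)) (f₂ 0) (∑ K (f₂ ∘ suc))) (cong₂ _+_ head (trans (sym (∑-*ˡ K (+ suc (suc n)) (f₂ ∘ suc))) (∑-ext K step))) ⟩
  c * f₁ 0 - d * f₀ 0 + ∑ K (λ j → c * f₁ (suc j) + c * (+ 2 * u) * f₁ j - d * f₀ (suc j))
    ≡⟨ cong (_+_ (c * f₁ 0 - d * f₀ 0)) (trans (∑-− K (λ j → c * f₁ (suc j) + c * (+ 2 * u) * f₁ j) (λ j → d * f₀ (suc j)))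
         (cong₂ _-_ (trans (∑-+ K (λ j → c * f₁ (suc j)) (λ j → c * (+ 2 * u) * f₁ j)) (cong₂ _+_ (∑-*ˡ K c (f₁ ∘ suc)) (∑-*ˡ K (c * (+ 2 * u)) f₁))) (∑-*ˡ K d (f₀ ∘ suc)))) ⟩
  c * f₁ 0 - d * f₀ 0 + (c * ∑ K (f₁ ∘ suc) + c * (+ 2 * u) * ∑ K f₁ - d * ∑ K (f₀ ∘ suc))
    ≡⟨ collect c d (+ 2 * u) (f₁ 0) (f₀ 0) (∑ K (f₁ ∘ suc)) (∑ K f₁) (∑ K (f₀ ∘ suc)) ⟩
  c * (f₁ 0 + ∑ K (f₁ ∘ suc)) + c * (+ 2 * u) * ∑ K f₁ - d * (f₀ 0 + ∑ K (f₀ ∘ suc))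
    ≡⟨ cong₂ (λ a b → c * a + c * (+ 2 * u) * ∑ K f₁ - d * b) (trans (sym (∑-head K f₁)) (drop (suc n) K ℕ.≤-refl)) (trans (sym (∑-head K f₀)) (trans (drop n K (ℕ.n≤1+n (suc n))) (drop n (suc n) ℕ.≤-refl))) ⟩
  c * ∑ K f₁ + c * (+ 2 * u) * ∑ K f₁ - d * ∑ (suc n) f₀
    ≡⟨ collect′ c u (∑ K f₁) (d * ∑ (suc n) f₀) ⟩
  c * (+ 1 + + 2 * u) * shifted-legendre (suc n) u - d * shifted-legendre n u ∎
  where
  open ≡-Reasoning
  K : ℕ
  K = suc (suc n)
  f₀ f₁ f₂ : ℕ → ℤ
  f₀ k = shifted-coefficient n k * u ^ k
  f₁ k = shifted-coefficient (suc n) k * u ^ k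
  f₂ k = shifted-coefficient (suc (suc n)) k * u ^ k
  c d : ℤ
  c = + 2 * + n + + 3
  d = + suc n
  drop : ∀ n K → n < K → ∑ (suc K) (λ k → shifted-coefficient n k * u ^ k) ≡ ∑ K (λ k → shifted-coefficient n k * u ^ k)
  drop n K n<K = trans (cong (_+_ (∑ K (λ k → shifted-coefficient n k * u ^ k))) (trans (cong (_* u ^ K) (shifted-coefficient-above n K n<K)) (ℤ.*-zeroˡ (u ^ K)))) (ℤ.+-identityʳ _)
  collect : ∀ c d w a₁ a₀ b₁ s b₀ → c * a₁ - d * a₀ + (c * b₁ + c * w * s - d * b₀) ≡ c * (a₁ + b₁) + c * w * s - d * (a₀ + b₀)
  collect = solve-∀
  collect′ : ∀ c u s t → c * s + c * (+ 2 * u) * s - t ≡ c * (+ 1 + + 2 * u) * s - t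
  collect′ = solve-∀
  head : + suc (suc n) * f₂ 0 ≡ c * f₁ 0 - d * f₀ 0
  head = trans (cong (λ s → + suc (suc n) * (s * + 1)) (shifted-coefficient-zero (suc (suc n)))) (trans (lemma (+ n))
    (sym (cong₂ (λ s t → c * (s * + 1) - d * (t * + 1)) (shifted-coefficient-zero (suc n)) (shifted-coefficient-zero n))))
    where
    lemma : ∀ n → (+ 2 + n) * (+ 1 * + 1) ≡ (+ 2 * n + + 3) * (+ 1 * + 1) - (+ 1 + n) * (+ 1 * + 1)
    lemma = solve-∀
  step : ∀ j → + suc (suc n) * f₂ (suc j) ≡ c * f₁ (suc j) + c * (+ 2 * u) * f₁ j - d * f₀ (suc j)
  step j = trans (sym (ℤ.*-assoc (+ suc (suc n)) (shifted-coefficient (suc (suc n)) (suc j)) (u ^ suc j))) (trans (cong (_* u ^ suc j) (shifted-coefficient-rec n j))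
    (lemma c d (shifted-coefficient (suc n) (suc j)) (shifted-coefficient (suc n) j) (shifted-coefficient n (suc j)) u (u ^ j)))
    where
    lemma : ∀ c d x y z u v → (c * (x + + 2 * y) - d * z) * (u * v) ≡ c * (x * (u * v)) + c * (+ 2 * u) * (y * v) - d * (z * (u * v))
    lemma = solve-∀

-- Both sides satisfy Bonnet's recurrence.
2^n*legendre≡ : ∀ n u → 2^n*legendre n (+ 1 + + 2 * u) ≡ (+ 2) ^ n * shifted-legendre n u
2^n*legendre≡ n u = proj₁ (both n)
  where
  x : ℤ
  x = + 1 + + 2 * u
  Claim : ℕ → Set
  Claim n = 2^n*legendre n x ≡ (+ 2) ^ n * shifted-legendre n u
  claim-0 : Claim 0
  claim-0 = trans (cong₂ (λ a b → + 0 + + 1 * (a * b) * + 1) cb-zero (B-zero 0)) (sym (cong (λ s → + 1 * (+ 0 + s * + 1)) (shifted-coefficient-zero 0)))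
  cb-1 : cb 1 ≡ + 2
  cb-1 = trans (sym (ℤ.*-identityˡ (cb 1))) (trans (cb-suc 0) (cong (_*_ (+ 2 * (+ 2 * + 0 + + 1))) cb-zero))
  claim-1 : Claim 1
  claim-1 = trans (cong₂ (λ a b → + 0 + + 1 * (a * b) * (x * + 1) + legendre-coefficient 1 1 * + 1) cb-1 (B-zero 1))
    (trans (cong (λ e → + 0 + + 1 * (+ 2 * + 1) * (x * + 1) + e * + 1) (legendre-coefficient-above 1 1 (s≤s (s≤s z≤n)))) (trans (lemma u)
      (sym (cong₂ (λ s t → + 2 * + 1 * (+ 0 + s * + 1 + t * (u * + 1))) (shifted-coefficient-zero 1) (cong₂ _*_ (B-diag 2) cb-1)))))
    where
    lemma : ∀ u → + 0 + + 1 * (+ 2 * + 1) * ((+ 1 + + 2 * u) * + 1) + + 0 * + 1 ≡ + 2 * + 1 * (+ 0 + + 1 * + 1 + + 1 * + 2 * (u * + 1))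
    lemma = solve-∀
  step : ∀ n → Claim n → Claim (suc n) → Claim (suc (suc n))
  step n claim-n claim-1+n = ℤ.*-cancelˡ-≡ (+ suc (suc n)) _ _ (begin
    + suc (suc n) * 2^n*legendre (suc (suc n)) x ≡⟨ 2^n*legendre-rec n x ⟩
    + 2 * (+ 2 * + n + + 3) * x * 2^n*legendre (suc n) x - + 4 * + suc n * 2^n*legendre n x
      ≡⟨ cong₂ (λ a b → + 2 * (+ 2 * + n + + 3) * x * a - + 4 * + suc n * b) claim-1+n claim-n ⟩
    + 2 * (+ 2 * + n + + 3) * x * ((+ 2) ^ suc n * shifted-legendre (suc n) u) - + 4 * + suc n * ((+ 2) ^ n * shifted-legendre n u)
      ≡⟨ factor (+ n) x ((+ 2) ^ n) (shifted-legendre (suc n) u) (shifted-legendre n u) ⟩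
    (+ 2) ^ suc (suc n) * ((+ 2 * + n + + 3) * x * shifted-legendre (suc n) u - + suc n * shifted-legendre n u)
      ≡⟨ cong (_*_ ((+ 2) ^ suc (suc n))) (shifted-legendre-rec n u) ⟨
    (+ 2) ^ suc (suc n) * (+ suc (suc n) * shifted-legendre (suc (suc n)) u) ≡⟨ swap ((+ 2) ^ suc (suc n)) (+ suc (suc n)) (shifted-legendre (suc (suc n)) u) ⟩
    + suc (suc n) * ((+ 2) ^ suc (suc n) * shifted-legendre (suc (suc n)) u) ∎)
    where
    open ≡-Reasoning
    factor : ∀ n x w a b → + 2 * (+ 2 * n + + 3) * x * (+ 2 * w * a) - + 4 * (+ 1 + n) * (w * b) ≡ + 2 * (+ 2 * w) * ((+ 2 * n + + 3) * x * a - (+ 1 + n) * b)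
    factor = solve-∀
    swap : ∀ a b c → a * (b * c) ≡ b * (a * c)
    swap = solve-∀
  both : ∀ n → Claim n × Claim (suc n)
  both zero = claim-0 , claim-1
  both (suc n) = proj₂ (both n) , step n (proj₁ (both n)) (proj₂ (both n))

2^n*legendre-even : ∀ m x → 2^n*legendre (2 ℕ.* m) (- x) ≡ 2^n*legendre (2 ℕ.* m) x
2^n*legendre-even m x = ∑-ext (suc (2 ℕ.* m)) (λ k → cong (_*_ (legendre-coefficient (2 ℕ.* m) k)) (trans (cong ((- x) ^_) (sym (ℕ.*-distribˡ-∸ 2 m k)))
  (trans (sym (ℤ.^-*-assoc (- x) 2 (m ∸ k))) (trans (cong (_^ (m ∸ k)) (lemma x)) (trans (ℤ.^-*-assoc x 2 (m ∸ k)) (cong (x ^_) (ℕ.*-distribˡ-∸ 2 m k)))))))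
  where
  lemma : ∀ x → - x * (- x * + 1) ≡ x * (x * + 1)
  lemma = solve-∀

-- The values of Pₙ at 3 and -3 modulo p²

module LegendreCongruences (m : ℕ) (p-prime : Prime (suc (4 ℕ.* m))) where

  open Trace m p-prime public

  -- (2n + 2k + 2)(2n - 2k) = (p + 2k + 1)(p - 2k - 1) ≡ -(2k + 1)²
  [-16]^k*B≈cb : ∀ k → k ≤ n → (- + 16) ^ k * B (n ℕ.+ k) (2 ℕ.* k) ≈ cb k ⟨ + p * + p ⟩
  [-16]^k*B≈cb zero _ = ≈-reflexive (trans (cong (_*_ (+ 1)) (B-zero (n ℕ.+ 0))) (sym cb-zero))
  [-16]^k*B≈cb (suc k) k<n = *-cancelˡ-≈ ((+ 2 * + k + + 2) * (+ 2 * + k + + 1)) (Unit-* 2k+2≉0 (Unit-2i+1 k k<n)) (begin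
    (+ 2 * + k + + 2) * t * ((- + 16) ^ suc k * B (n ℕ.+ suc k) (2 ℕ.* suc k))
      ≡⟨ cong₂ (λ N j → (+ 2 * + k + + 2) * t * ((- + 16) ^ suc k * B N j)) (ℕ.+-suc n k) (2*suc k) ⟩
    (+ 2 * + k + + 2) * t * ((- + 16) ^ suc k * B (suc N) (suc (suc 2k)))
      ≡⟨ pull (+ k) ((- + 16) ^ k) (B (suc N) (suc (suc 2k))) ⟩
    - + 16 * (- + 16) ^ k * (t * ((+ 2 + + 2 * + k) * B (suc N) (suc (suc 2k))))
      ≡⟨ cong (λ u → - + 16 * (- + 16) ^ k * (t * ((+ 2 + u) * B (suc N) (suc (suc 2k))))) (ℤ.pos-* 2 k) ⟨
    - + 16 * (- + 16) ^ k * (t * (+ suc (suc 2k) * B (suc N) (suc (suc 2k))))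
      ≡⟨ cong (λ u → - + 16 * (- + 16) ^ k * (t * u)) (B-absorb N (suc 2k)) ⟩
    - + 16 * (- + 16) ^ k * (t * (+ suc N * B N (suc 2k)))
      ≡⟨ pull′ ((- + 16) ^ k) (+ k) (+ suc N) (B N (suc 2k)) ⟩
    - + 16 * (- + 16) ^ k * (+ suc N * ((+ 1 + + 2 * + k) * B N (suc 2k)))
      ≡⟨ cong (λ u → - + 16 * (- + 16) ^ k * (+ suc N * u)) (trans (cong (λ u → (+ 1 + u) * B N (suc 2k)) (sym (ℤ.pos-* 2 k))) (trans (B-stepʳ N 2k) (cong (λ u → (+ N - u) * B N 2k) (ℤ.pos-* 2 k)))) ⟩
    - + 16 * (- + 16) ^ k * ((+ 1 + (+ n + + k)) * ((+ n + + k - + 2 * + k) * B N 2k))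
      ≡⟨ cong (λ u → - + 16 * (- + 16) ^ k * ((+ 1 + (u + + k)) * ((u + + k - + 2 * + k) * B N 2k))) +n≡ ⟩
    - + 16 * (- + 16) ^ k * ((+ 1 + (+ 2 * + m + + k)) * ((+ 2 * + m + + k - + 2 * + k) * B N 2k))
      ≡⟨ factor (+ m) (+ k) ((- + 16) ^ k) (B N 2k) ⟩
    - + 4 * ((+ 1 + + 4 * + m) * (+ 1 + + 4 * + m) - t * t) * ((- + 16) ^ k * B N 2k)
      ≡⟨ cong (λ P → - + 4 * (P * P - t * t) * ((- + 16) ^ k * B N 2k)) +p≡ ⟨
    - + 4 * (+ p * + p - t * t) * ((- + 16) ^ k * B N 2k)
      ≈⟨ *-≈ (*-≈ˡ (- + 4) (−-≈ M≈0 (≈-refl {x = t * t}))) ([-16]^k*B≈cb k (ℕ.<⇒≤ k<n)) ⟩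
    - + 4 * (+ 0 - t * t) * cb k
      ≡⟨ regroup t (cb k) ⟩
    + 2 * t * (+ 2 * t * cb k)
      ≡⟨ cong (_*_ (+ 2 * t)) (cb-suc k) ⟨
    + 2 * t * (+ suc k * cb (suc k))
      ≡⟨ regroup′ (+ k) (cb (suc k)) ⟩
    (+ 2 * + k + + 2) * t * cb (suc k) ∎)
    where
    open ≈-Reasoning (+ p * + p)
    N 2k : ℕ
    N = n ℕ.+ k
    2k = 2 ℕ.* k
    t : ℤ
    t = + 2 * + k + + 1
    2k+2≉0 : Unit (+ 2 * + k + + 2)
    2k+2≉0 = subst Unit (lemma (+ k)) (Unit-* Unit-2 (Unit-1+ k (ℕ.<-trans k<n n<q)))
      where
      lemma : ∀ k → + 2 * (+ 1 + k) ≡ + 2 * k + + 2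
      lemma = solve-∀
    pull : ∀ k s b → (+ 2 * k + + 2) * (+ 2 * k + + 1) * (- + 16 * s * b) ≡ - + 16 * s * ((+ 2 * k + + 1) * ((+ 2 + + 2 * k) * b))
    pull = solve-∀
    pull′ : ∀ s k N b → - + 16 * s * ((+ 2 * k + + 1) * (N * b)) ≡ - + 16 * s * (N * ((+ 1 + + 2 * k) * b))
    pull′ = solve-∀
    factor : ∀ m k s b → - + 16 * s * ((+ 1 + (+ 2 * m + k)) * ((+ 2 * m + k - + 2 * k) * b))
        ≡ - + 4 * ((+ 1 + + 4 * m) * (+ 1 + + 4 * m) - (+ 2 * k + + 1) * (+ 2 * k + + 1)) * (s * b)
    factor = solve-∀
    regroup : ∀ t c → - + 4 * (+ 0 - t * t) * c ≡ + 2 * t * (+ 2 * t * c)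
    regroup = solve-∀
    regroup′ : ∀ k c → + 2 * (+ 2 * k + + 1) * ((+ 1 + k) * c) ≡ (+ 2 * k + + 2) * (+ 2 * k + + 1) * c
    regroup′ = solve-∀

  cb²≈ : ∀ k → k ≤ n → cb k * cb k ≈ (- + 16) ^ k * shifted-coefficient n k ⟨ + p * + p ⟩
  cb²≈ k k≤n = ≈-trans (*-≈ʳ (cb k) (≈-sym ([-16]^k*B≈cb k k≤n))) (≈-reflexive (ℤ.*-assoc ((- + 16) ^ k) (B (n ℕ.+ k) (2 ℕ.* k)) (cb k)))

  private
    c : ℕ → ℤ
    c k = cb k * inv (+ 4) ^ k

    c≈ : ∀ k → k ≤ n → c k ≈ -1ℤ ^ k * B n k ⟨ + p ⟩
    c≈ k k≤n = begin
      cb k * inv (+ 4) ^ k ≈⟨ *-≈ʳ (inv (+ 4) ^ k) (≈-weaken (+ p) (cb≈ k k≤n)) ⟩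
      (- + 4) ^ k * B n k * (+ 1 + + p * O k) * inv (+ 4) ^ k ≈⟨ *-≈ʳ (inv (+ 4) ^ k) (*-≈ˡ ((- + 4) ^ k * B n k) (+-≈ˡ (+ 1) (M*≈0 (O k)))) ⟩
      (- + 4) ^ k * B n k * (+ 1 + + 0) * inv (+ 4) ^ k ≡⟨ cong (λ u → u * B n k * (+ 1 + + 0) * inv (+ 4) ^ k) (^-distribʳ-* -1ℤ (+ 4) k) ⟩
      -1ℤ ^ k * (+ 4) ^ k * B n k * (+ 1 + + 0) * inv (+ 4) ^ k ≡⟨ regroup (-1ℤ ^ k) ((+ 4) ^ k) (B n k) (inv (+ 4) ^ k) ⟩
      (+ 4) ^ k * inv (+ 4) ^ k * (-1ℤ ^ k * B n k) ≡⟨ cong (_* (-1ℤ ^ k * B n k)) (^-distribʳ-* (+ 4) (inv (+ 4)) k) ⟨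
      (+ 4 * inv (+ 4)) ^ k * (-1ℤ ^ k * B n k) ≈⟨ *-≈ʳ (-1ℤ ^ k * B n k) (≈-trans (^-≈ k (x*inv[x]≈1p Unit-4)) (≈-reflexive (ℤ.^-zeroˡ k))) ⟩
      + 1 * (-1ℤ ^ k * B n k) ≡⟨ ℤ.*-identityˡ _ ⟩
      -1ℤ ^ k * B n k ∎
      where
      open ≈-Reasoning (+ p)
      regroup : ∀ s f b i → s * f * b * (+ 1 + + 0) * i ≡ f * i * (s * b)
      regroup = solve-∀

    -1^[n∸k]≡ : ∀ k → k ≤ n → -1ℤ ^ (n ∸ k) ≡ -1ℤ ^ k
    -1^[n∸k]≡ k k≤n = begin
      -1ℤ ^ (n ∸ k) ≡⟨ trans (cong (_*_ (-1ℤ ^ (n ∸ k))) (-1^k*-1^k≡1 k)) (ℤ.*-identityʳ _) ⟨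
      -1ℤ ^ (n ∸ k) * (-1ℤ ^ k * -1ℤ ^ k) ≡⟨ ℤ.*-assoc (-1ℤ ^ (n ∸ k)) (-1ℤ ^ k) (-1ℤ ^ k) ⟨
      -1ℤ ^ (n ∸ k) * -1ℤ ^ k * -1ℤ ^ k ≡⟨ cong (_* -1ℤ ^ k) (ℤ.^-distribˡ-+-* -1ℤ (n ∸ k) k) ⟨
      -1ℤ ^ (n ∸ k ℕ.+ k) * -1ℤ ^ k ≡⟨ cong (λ j → -1ℤ ^ j * -1ℤ ^ k) (ℕ.m∸n+n≡m k≤n) ⟩
      -1ℤ ^ n * -1ℤ ^ k ≡⟨ trans (cong (_* -1ℤ ^ k) -1^n≡1) (ℤ.*-identityˡ _) ⟩
      -1ℤ ^ k ∎
      where open ≡-Reasoning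

    square≈0 : ∀ {x y} → x ≈ y ⟨ + p ⟩ → (x - y) * (x - y) ≈ + 0 ⟨ + p * + p ⟩
    square≈0 {y = y} (by k refl) = by (k * k) (lemma y k (+ p))
      where
      lemma : ∀ y k P → (y + k * P - y) * (y + k * P - y) ≡ + 0 + k * k * (P * P)
      lemma = solve-∀

    [c-c]²≈0 : ∀ k → k ≤ n → (c k - c (n ∸ k)) * (c k - c (n ∸ k)) ≈ + 0 ⟨ + p * + p ⟩
    [c-c]²≈0 k k≤n = square≈0 (≈-trans (c≈ k k≤n) (≈-trans (≈-reflexive (sym (cong₂ _*_ (-1^[n∸k]≡ k k≤n) (sym (B-sym k≤n))))) (≈-sym (c≈ (n ∸ k) (ℕ.m∸n≤m n k)))))

    F K : ℤ
    F = ∑ (suc n) (λ k → -1ℤ ^ k * (c k * c k))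
    K = ∑ (suc n) (λ k → -1ℤ ^ k * (c k * c (n ∸ k)))

    F-reflect : ∑ (suc n) (λ k → -1ℤ ^ k * (c (n ∸ k) * c (n ∸ k))) ≡ F
    F-reflect = trans (∑-cong (suc n) (λ k k≤n → cong (_* (c (n ∸ k) * c (n ∸ k))) (sym (-1^[n∸k]≡ k (ℕ.s≤s⁻¹ k≤n))))) (sym (∑-reverse (suc n) (λ k → -1ℤ ^ k * (c k * c k))))

    F≈K : F ≈ K ⟨ + p * + p ⟩
    F≈K = *-cancelˡ-≈ (+ 2) Unit-2 (x-y≈0⇒x≈y (begin
      + 2 * F - + 2 * K ≡⟨ cong (_- + 2 * K) (double F) ⟩
      F + F - + 2 * K ≡⟨ cong (λ u → F + u - + 2 * K) F-reflect ⟨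
      F + ∑ (suc n) (λ k → -1ℤ ^ k * (c (n ∸ k) * c (n ∸ k))) - + 2 * K
        ≡⟨ cong₂ _-_ (∑-+ (suc n) (λ k → -1ℤ ^ k * (c k * c k)) (λ k → -1ℤ ^ k * (c (n ∸ k) * c (n ∸ k)))) (∑-*ˡ (suc n) (+ 2) (λ k → -1ℤ ^ k * (c k * c (n ∸ k)))) ⟨
      ∑ (suc n) (λ k → -1ℤ ^ k * (c k * c k) + -1ℤ ^ k * (c (n ∸ k) * c (n ∸ k))) - ∑ (suc n) (λ k → + 2 * (-1ℤ ^ k * (c k * c (n ∸ k))))
        ≡⟨ ∑-− (suc n) _ _ ⟨
      ∑ (suc n) (λ k → -1ℤ ^ k * (c k * c k) + -1ℤ ^ k * (c (n ∸ k) * c (n ∸ k)) - + 2 * (-1ℤ ^ k * (c k * c (n ∸ k))))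
        ≡⟨ ∑-ext (suc n) (λ k → complete-square (-1ℤ ^ k) (c k) (c (n ∸ k))) ⟩
      ∑ (suc n) (λ k → -1ℤ ^ k * ((c k - c (n ∸ k)) * (c k - c (n ∸ k))))
        ≈⟨ ∑-≈0 (suc n) (λ k k≤n → ≈-trans (*-≈ˡ (-1ℤ ^ k) ([c-c]²≈0 k (ℕ.s≤s⁻¹ k≤n))) (≈-reflexive (ℤ.*-zeroʳ (-1ℤ ^ k)))) ⟩
      + 0 ∎))
      where
      open ≈-Reasoning (+ p * + p)
      double : ∀ x → + 2 * x ≡ x + x
      double = solve-∀
      complete-square : ∀ s x y → s * (x * x) + s * (y * y) - + 2 * (s * (x * y)) ≡ s * ((x - y) * (x - y))
      complete-square = solve-∀

    -- The powers of 1/4 combine to 4⁻ⁿ, and the convolution identity returns 4ᵐ C(2m, m); as n =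
    -- 2m, a single 4⁻ᵐ is left.
    K≈X : K ≈ X ⟨ + p * + p ⟩
    K≈X = begin
      K ≡⟨ ∑-cong (suc n) (λ k k≤n → trans (regroup (-1ℤ ^ k) (cb k) (inv (+ 4) ^ k) (cb (n ∸ k)) (inv (+ 4) ^ (n ∸ k)))
          (cong (_* (-1ℤ ^ k * (cb k * cb (n ∸ k)))) (trans (sym (ℤ.^-distribˡ-+-* (inv (+ 4)) k (n ∸ k))) (cong (inv (+ 4) ^_) (ℕ.m+[n∸m]≡n (ℕ.s≤s⁻¹ k≤n)))))) ⟩
      ∑ (suc n) (λ k → inv (+ 4) ^ n * (-1ℤ ^ k * (cb k * cb (n ∸ k)))) ≡⟨ trans (∑-*ˡ (suc n) (inv (+ 4) ^ n) _) (cong (_*_ (inv (+ 4) ^ n)) (∑-cb-cb m)) ⟩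
      inv (+ 4) ^ n * ((+ 4) ^ m * cb m) ≡⟨ cong (_* ((+ 4) ^ m * cb m)) (trans (cong (inv (+ 4) ^_) n≡m+m) (ℤ.^-distribˡ-+-* (inv (+ 4)) m m)) ⟩
      inv (+ 4) ^ m * inv (+ 4) ^ m * ((+ 4) ^ m * cb m) ≡⟨ regroup′ (inv (+ 4) ^ m) ((+ 4) ^ m) (cb m) ⟩
      (+ 4) ^ m * inv (+ 4) ^ m * X ≡⟨ cong (_* X) (^-distribʳ-* (+ 4) (inv (+ 4)) m) ⟨
      (+ 4 * inv (+ 4)) ^ m * X ≈⟨ *-≈ʳ X (≈-trans (^-≈ m (x*inv[x]≈1 Unit-4)) (≈-reflexive (ℤ.^-zeroˡ m))) ⟩
      + 1 * X ≡⟨ ℤ.*-identityˡ X ⟩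
      X ∎
      where
      open ≈-Reasoning (+ p * + p)
      regroup : ∀ s c i d j → s * (c * i * (d * j)) ≡ i * j * (s * (c * d))
      regroup = solve-∀
      regroup′ : ∀ i f c → i * i * (f * c) ≡ f * i * (c * i)
      regroup′ = solve-∀

    shifted≈c² : ∀ k → k ≤ n → shifted-coefficient n k ≈ -1ℤ ^ k * (c k * c k) ⟨ + p * + p ⟩
    shifted≈c² k k≤n = ≈-sym (begin
      -1ℤ ^ k * (cb k * i * (cb k * i)) ≡⟨ regroup (-1ℤ ^ k) (cb k) i ⟩
      -1ℤ ^ k * (i * i) * (cb k * cb k) ≈⟨ *-≈ˡ (-1ℤ ^ k * (i * i)) (cb²≈ k k≤n) ⟩
      -1ℤ ^ k * (i * i) * ((- + 16) ^ k * shifted-coefficient n k) ≡⟨ ℤ.*-assoc (-1ℤ ^ k * (i * i)) ((- + 16) ^ k) (shifted-coefficient n k) ⟨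
      -1ℤ ^ k * (i * i) * (- + 16) ^ k * shifted-coefficient n k ≡⟨ cong (_* shifted-coefficient n k) powers ⟨
      (-1ℤ * (inv (+ 4) * inv (+ 4)) * - + 16) ^ k * shifted-coefficient n k
        ≈⟨ *-≈ʳ (shifted-coefficient n k) (≈-trans (^-≈ k (≈-trans (≈-reflexive (lemma (inv (+ 4)))) (*-≈ (x*inv[x]≈1 Unit-4) (x*inv[x]≈1 Unit-4)))) (≈-reflexive (ℤ.^-zeroˡ k))) ⟩
      + 1 * shifted-coefficient n k ≡⟨ ℤ.*-identityˡ _ ⟩
      shifted-coefficient n k ∎)
      where
      open ≈-Reasoning (+ p * + p)
      i : ℤ
      i = inv (+ 4) ^ k
      regroup : ∀ s c i → s * (c * i * (c * i)) ≡ s * (i * i) * (c * c)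
      regroup = solve-∀
      lemma : ∀ i → -1ℤ * (i * i) * - + 16 ≡ + 4 * i * (+ 4 * i)
      lemma = solve-∀
      powers : (-1ℤ * (inv (+ 4) * inv (+ 4)) * - + 16) ^ k ≡ -1ℤ ^ k * (i * i) * (- + 16) ^ k
      powers = trans (^-distribʳ-* (-1ℤ * (inv (+ 4) * inv (+ 4))) (- + 16) k) (cong (_* (- + 16) ^ k)
        (trans (^-distribʳ-* -1ℤ (inv (+ 4) * inv (+ 4)) k) (cong (_*_ (-1ℤ ^ k)) (^-distribʳ-* (inv (+ 4)) (inv (+ 4)) k))))

  shifted-legendre[1]≈X : shifted-legendre n (+ 1) ≈ X ⟨ + p * + p ⟩
  shifted-legendre[1]≈X = ≈-trans (∑-≈ (suc n) (λ k k≤n → ≈-trans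
      (≈-reflexive (trans (cong (_*_ (shifted-coefficient n k)) (ℤ.^-zeroˡ k)) (ℤ.*-identityʳ (shifted-coefficient n k))))
      (shifted≈c² k (ℕ.s≤s⁻¹ k≤n))))
    (≈-trans F≈K K≈X)

  -- The points u = -2 and u = 1 are x = -3 and x = 3, and 2ⁿ Pₙ is even. This holds exactly in ℤ,
  -- not merely modulo p².
  shifted-legendre[-2]≡ : shifted-legendre n (- + 2) ≡ shifted-legendre n (+ 1)
  shifted-legendre[-2]≡ = ℤ.*-cancelˡ-≡ ((+ 2) ^ n) _ _ {{i^n≢0 (+ 2) n}} (begin
    (+ 2) ^ n * shifted-legendre n (- + 2) ≡⟨ 2^n*legendre≡ n (- + 2) ⟨
    2^n*legendre n (- + 3) ≡⟨ 2^n*legendre-even m (+ 3) ⟩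
    2^n*legendre n (+ 3) ≡⟨ 2^n*legendre≡ n (+ 1) ⟩
    (+ 2) ^ n * shifted-legendre n (+ 1) ∎)
    where open ≡-Reasoning

-- Rationals with denominator prime to p and their residues modulo p²

ι-+ : ∀ i j → ι (i + j) ≡ ι i ℚ.+ ι j
-- `ι` normalises by a gcd that does not compute on variables, so the identity is checked on
-- unnormalised fractions.
ι-+ i j = ℚ.toℚᵘ-injective (begin
  ℚ.toℚᵘ (ι (i + j)) ≈⟨ ℚ.toℚᵘ-fromℚᵘ (mkℚᵘ (i + j) 0) ⟩
  mkℚᵘ (i + j) 0 ≈⟨ ℚᵘ.*≡* (lemma i j) ⟩
  mkℚᵘ i 0 ℚᵘ.+ mkℚᵘ j 0 ≈⟨ ℚᵘ.+-cong (ℚ.toℚᵘ-fromℚᵘ (mkℚᵘ i 0)) (ℚ.toℚᵘ-fromℚᵘ (mkℚᵘ j 0)) ⟨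
  ℚ.toℚᵘ (ι i) ℚᵘ.+ ℚ.toℚᵘ (ι j) ≈⟨ ℚ.toℚᵘ-homo-+ (ι i) (ι j) ⟨
  ℚ.toℚᵘ (ι i ℚ.+ ι j) ∎)
  where
  open SetoidReasoning ℚᵘ.≃-setoid
  lemma : ∀ i j → (i + j) * + 1 ≡ (i * + 1 + j * + 1) * + 1
  lemma = solve-∀

ι-* : ∀ i j → ι (i * j) ≡ ι i ℚ.* ι j
ι-* i j = ℚ.toℚᵘ-injective (begin
  ℚ.toℚᵘ (ι (i * j)) ≈⟨ ℚ.toℚᵘ-fromℚᵘ (mkℚᵘ (i * j) 0) ⟩
  mkℚᵘ i 0 ℚᵘ.* mkℚᵘ j 0 ≈⟨ ℚᵘ.*-cong (ℚ.toℚᵘ-fromℚᵘ (mkℚᵘ i 0)) (ℚ.toℚᵘ-fromℚᵘ (mkℚᵘ j 0)) ⟨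
  ℚ.toℚᵘ (ι i) ℚᵘ.* ℚ.toℚᵘ (ι j) ≈⟨ ℚ.toℚᵘ-homo-* (ι i) (ι j) ⟨
  ℚ.toℚᵘ (ι i ℚ.* ι j) ∎)
  where open SetoidReasoning ℚᵘ.≃-setoid

ι-neg : ∀ i → ι (- i) ≡ ℚ.- ι i
ι-neg i = trans (cong ι (sym (ℤ.-1*i≡-i i))) (trans (ι-* -1ℤ i) (lemma (ι i)))
  where
  open +-*-Solver
  lemma : ∀ x → ι -1ℤ ℚ.* x ≡ ℚ.- x
  lemma = solve 1 (λ x → con (ι -1ℤ) :* x := :- x) refl

ι-− : ∀ i j → ι (i - j) ≡ ι i ℚ.- ι j
ι-− i j = trans (ι-+ i (- j)) (cong (ℚ._+_ (ι i)) (ι-neg j))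

∕-*-cancel : ∀ i j .{{_ : ℤ.NonZero j}} → (i ∕ j) ℚ.* ι j ≡ ι i
∕-*-cancel i j = trans (ℚ.*-assoc (ι i) (ℚ.1/_ (ι j) {{ι≢0 j}}) (ι j))
  (trans (cong (ℚ._*_ (ι i)) (ℚ.*-inverseˡ (ι j) {{ι≢0 j}})) (ℚ.*-identityʳ (ι i)))

*-ι-cancel : ∀ j .{{_ : ℤ.NonZero j}} {x y} → x ℚ.* ι j ≡ y ℚ.* ι j → x ≡ y
*-ι-cancel j {x} {y} xj≡yj = trans (expand x) (trans (cong (ℚ._* ℚ.1/_ (ι j) {{ι≢0 j}}) xj≡yj) (sym (expand y)))
  where
  expand : ∀ x → x ≡ x ℚ.* ι j ℚ.* ℚ.1/_ (ι j) {{ι≢0 j}}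
  expand x = sym (trans (ℚ.*-assoc x (ι j) (ℚ.1/_ (ι j) {{ι≢0 j}})) (trans (cong (ℚ._*_ x) (ℚ.*-inverseʳ (ι j) {{ι≢0 j}})) (ℚ.*-identityʳ x)))

∕-≡ : ∀ i j {y} .{{_ : ℤ.NonZero j}} → i ≡ j * y → i ∕ j ≡ ι y
∕-≡ i j {y} i≡jy = *-ι-cancel j (trans (∕-*-cancel i j) (trans (cong ι (trans i≡jy (ℤ.*-comm j y))) (ι-* y j)))

-- In lowest terms x = u/v, so v divides u d and, being prime to u, divides d. The coprimality
-- stored in a rational is irrelevant and has to be recomputed.
denominator-divides : ∀ x d i → x ℚ.* ι d ≡ ι i → ↧ₙ x ℕ.∣ ℤ.∣ d ∣
denominator-divides x@(mkℚ u v-1 coprime) d i xd≡i = Coprime.coprime-divisor (Coprime.sym (Coprime.recompute coprime))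
  (subst (suc v-1 ℕ.∣_) (ℤ.abs-* u d) (Signed.∣⇒∣ᵤ {+ suc v-1} {u * d} (Signed.divides i (cross-multiply (begin
    mkℚᵘ u v-1 ℚᵘ.* mkℚᵘ d 0 ≈⟨ ℚᵘ.*-cong (ℚᵘ.≃-refl {mkℚᵘ u v-1}) (ℚ.toℚᵘ-fromℚᵘ (mkℚᵘ d 0)) ⟨
    ℚ.toℚᵘ x ℚᵘ.* ℚ.toℚᵘ (ι d) ≈⟨ ℚ.toℚᵘ-homo-* x (ι d) ⟨
    ℚ.toℚᵘ (x ℚ.* ι d) ≈⟨ ℚ.toℚᵘ-cong xd≡i ⟩
    ℚ.toℚᵘ (ι i) ≈⟨ ℚ.toℚᵘ-fromℚᵘ (mkℚᵘ i 0) ⟩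
    mkℚᵘ i 0 ∎)))))
  where
  open SetoidReasoning ℚᵘ.≃-setoid
  cross-multiply : mkℚᵘ u v-1 ℚᵘ.* mkℚᵘ d 0 ℚᵘ.≃ mkℚᵘ i 0 → u * d ≡ i * + suc v-1
  cross-multiply (ℚᵘ.*≡* eq) = trans (sym (ℤ.*-identityʳ (u * d))) (trans eq (cong (λ k → i * + k) (ℕ.*-identityʳ (suc v-1))))

module IntegralRationals (q : ℕ) (p-prime : Prime (suc q)) where

  open ModPrime q p-prime

  -- x represents the residue class of y modulo p²
  infix 4 _↦_
  record _↦_ (x : ℚ) (y : ℤ) : Set where
    field
      denominator : ℤ
      numerator : ℤ
      unit : Unit denominator
      fraction : x ℚ.* ι denominator ≡ ι numerator
      congruence : numerator ≈ denominator * y ⟨ + p * + p ⟩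
  open _↦_

  Unit⇒NonZero : ∀ {d} → Unit d → ℤ.NonZero d
  Unit⇒NonZero {d} d≉0 = ℤ.≢-nonZero (λ d≡0 → d≉0 (≈-reflexive d≡0))

  -- A common divisor of the denominator and p is 1 or p, and p would divide the unit d.
  ↦⇒Integral : ∀ x d i → Unit d → x ℚ.* ι d ≡ ι i → Integral p x
  ↦⇒Integral x d i d≉0 xd≡i {j} (j∣↧x , j∣p) =
    [ (λ j≡1 → j≡1) , (λ { refl → contradiction (∣⇒≈0 (ℕ.∣-trans j∣↧x (denominator-divides x d i xd≡i))) d≉0 }) ]′ (prime⇒irreducible p-prime j∣p)

  ι-↦ : ∀ y → ι y ↦ y
  ι-↦ y = record
    { denominator = + 1
    ; numerator = y
    ; unit = Unit-1
    ; fraction = ℚ.*-identityʳ (ι y)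
    ; congruence = ≈-reflexive (sym (ℤ.*-identityˡ y))
    }

  ∕-↦ : ∀ {i j y} .{{_ : ℤ.NonZero j}} → Unit j → i ≈ j * y ⟨ + p * + p ⟩ → i ∕ j ↦ y
  ∕-↦ {i} {j} j≉0 i≈jy = record
    { denominator = j
    ; numerator = i
    ; unit = j≉0
    ; fraction = ∕-*-cancel i j
    ; congruence = i≈jy
    }

  ↦-≈ : ∀ {x y z} → x ↦ y → y ≈ z ⟨ + p * + p ⟩ → x ↦ z
  ↦-≈ x↦y y≈z = record
    { denominator = denominator x↦y
    ; numerator = numerator x↦y
    ; unit = unit x↦y
    ; fraction = fraction x↦y
    ; congruence = ≈-trans (congruence x↦y) (*-≈ˡ (denominator x↦y) y≈z)
    }

  +-↦ : ∀ {x y x′ y′} → x ↦ y → x′ ↦ y′ → x ℚ.+ x′ ↦ y + y′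
  +-↦ {x} {y} {x′} {y′} r r′ = record
    { denominator = d * d′
    ; numerator = i * d′ + i′ * d
    ; unit = Unit-* (unit r) (unit r′)
    ; fraction = trans (cong (ℚ._*_ (x ℚ.+ x′)) (ι-* d d′)) (trans (distrib x x′ (ι d) (ι d′))
        (trans (cong₂ (λ u v → u ℚ.* ι d′ ℚ.+ v ℚ.* ι d) (fraction r) (fraction r′)) (sym (trans (ι-+ (i * d′) (i′ * d)) (cong₂ ℚ._+_ (ι-* i d′) (ι-* i′ d))))))
    ; congruence = ≈-trans (+-≈ (*-≈ʳ d′ (congruence r)) (*-≈ʳ d (congruence r′))) (≈-reflexive (lemma d d′ y y′))
    }
    where
    open +-*-Solver
    d d′ i i′ : ℤ
    d = denominator r
    d′ = denominator r′
    i = numerator r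
    i′ = numerator r′
    distrib : ∀ x x′ d d′ → (x ℚ.+ x′) ℚ.* (d ℚ.* d′) ≡ x ℚ.* d ℚ.* d′ ℚ.+ x′ ℚ.* d′ ℚ.* d
    distrib = solve 4 (λ x x′ d d′ → (x :+ x′) :* (d :* d′) := x :* d :* d′ :+ x′ :* d′ :* d) refl
    lemma : ∀ d d′ y y′ → d * y * d′ + d′ * y′ * d ≡ d * d′ * (y + y′)
    lemma = solve-∀

  -- `∑≤` unfolds at its first term and `∑` at its last, so the induction runs on the form that
  -- `∑-head` provides.
  ∑-↦ : ∀ n {f : ℕ → ℚ} {g : ℕ → ℤ} → (∀ k → k ≤ n → f k ↦ g k) → ∑≤ n f ↦ ∑ (suc n) g
  ∑-↦ n {f} {g} f↦g = subst (∑≤ n f ↦_) (sym (∑-head n g)) (go n f g f↦g)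
    where
    go : ∀ n f g → (∀ k → k ≤ n → f k ↦ g k) → ∑≤ n f ↦ g 0 + ∑ n (g ∘ suc)
    go zero f g f↦g = +-↦ (f↦g 0 z≤n) (ι-↦ (+ 0))
    go (suc n) f g f↦g = +-↦ (f↦g 0 z≤n) (subst (∑≤ n (f ∘ suc) ↦_) (sym (∑-head n (g ∘ suc))) (go n (f ∘ suc) (g ∘ suc) (λ k k≤n → f↦g (suc k) (s≤s k≤n))))

  -- After cross-multiplication the numerators differ by k p²; the quotient demanded by the relation
  -- is k over the product of the two unit denominators.
  ↦⇒≅ : ∀ {x x′ y} → x ↦ y → x′ ↦ y → x ≅ x′ [mod p ^ 2 ]
  ↦⇒≅ {x} {x′} {y} r r′ =
    ↦⇒Integral x d i (unit r) (fraction r) , ↦⇒Integral x′ d′ i′ (unit r′) (fraction r′) , z , ↦⇒Integral z (d * d′) k dd′≉0 (∕-*-cancel k (d * d′)) ,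
    *-ι-cancel (d * d′) (begin
      (x ℚ.- x′) ℚ.* ι (d * d′) ≡⟨ trans (cong (ℚ._*_ (x ℚ.- x′)) (ι-* d d′)) (distrib x x′ (ι d) (ι d′)) ⟩
      x ℚ.* ι d ℚ.* ι d′ ℚ.- x′ ℚ.* ι d′ ℚ.* ι d ≡⟨ cong₂ (λ u v → u ℚ.* ι d′ ℚ.- v ℚ.* ι d) (fraction r) (fraction r′) ⟩
      ι i ℚ.* ι d′ ℚ.- ι i′ ℚ.* ι d ≡⟨ trans (ι-− (i * d′) (i′ * d)) (cong₂ ℚ._-_ (ι-* i d′) (ι-* i′ d)) ⟨
      ι (i * d′ - i′ * d) ≡⟨ cong ι (trans (_≈_⟨_⟩.equality difference) (rearrange k (+ p))) ⟩
      ι (+ p * (+ p * + 1) * k) ≡⟨ cong (λ w → ι (w * k)) (trans (ℤ.pos-* p (p ℕ.* 1)) (cong (_*_ (+ p)) (ℤ.pos-* p 1))) ⟨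
      ι (+ (p ℕ.^ 2) * k) ≡⟨ ι-* (+ (p ℕ.^ 2)) k ⟩
      ι (+ (p ℕ.^ 2)) ℚ.* ι k ≡⟨ cong (ℚ._*_ (ι (+ (p ℕ.^ 2)))) (∕-*-cancel k (d * d′)) ⟨
      ι (+ (p ℕ.^ 2)) ℚ.* (z ℚ.* ι (d * d′)) ≡⟨ ℚ.*-assoc (ι (+ (p ℕ.^ 2))) z (ι (d * d′)) ⟨
      ι (+ (p ℕ.^ 2)) ℚ.* z ℚ.* ι (d * d′) ∎)
    where
    open ≡-Reasoning
    open +-*-Solver
    d d′ i i′ : ℤ
    d = denominator r
    d′ = denominator r′
    i = numerator r
    i′ = numerator r′
    dd′≉0 : Unit (d * d′)
    dd′≉0 = Unit-* (unit r) (unit r′)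
    instance
      dd′≢0 : ℤ.NonZero (d * d′)
      dd′≢0 = Unit⇒NonZero dd′≉0
    lemma : ∀ d d′ y → d * y * d′ - d′ * y * d ≡ + 0
    lemma = solve-∀
    difference : i * d′ - i′ * d ≈ + 0 ⟨ + p * + p ⟩
    difference = ≈-trans (−-≈ (*-≈ʳ d′ (congruence r)) (*-≈ʳ d (congruence r′))) (≈-reflexive (lemma d d′ y))
    k : ℤ
    k = _≈_⟨_⟩.quotient difference
    z : ℚ
    z = k ∕ (d * d′)
    rearrange : ∀ k P → + 0 + k * (P * P) ≡ P * (P * + 1) * k
    rearrange = solve-∀
    distrib : ∀ x x′ d d′ → (x ℚ.- x′) ℚ.* (d ℚ.* d′) ≡ x ℚ.* d ℚ.* d′ ℚ.- x′ ℚ.* d′ ℚ.* d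
    distrib = solve 4 (λ x x′ d d′ → (x :- x′) :* (d :* d′) := x :* d :* d′ :- x′ :* d′ :* d) refl


-- Legendre polynomials over ℚ and the final congruences

ι-^ : ∀ i n → ι i ^ℚ n ≡ ι (i ^ n)
ι-^ i zero = refl
ι-^ i (suc n) = trans (cong (ℚ._*_ (ι i)) (ι-^ i n)) (sym (ι-* i (i ^ n)))

∑≤-ι : ∀ n {f : ℕ → ℚ} {g : ℕ → ℤ} → (∀ k → k ≤ n → f k ≡ ι (g k)) → ∑≤ n f ≡ ι (∑ (suc n) g)
∑≤-ι n {f} {g} f≡g = trans (go n f g f≡g) (cong ι (sym (∑-head n g)))
  where
  go : ∀ n f g → (∀ k → k ≤ n → f k ≡ ι (g k)) → ∑≤ n f ≡ ι (g 0 + ∑ n (g ∘ suc))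
  go zero f g f≡g = trans (cong (ℚ._+ ι (+ 0)) (f≡g 0 z≤n)) (sym (ι-+ (g 0) (+ 0)))
  go (suc n) f g f≡g = trans (cong₂ ℚ._+_ (f≡g 0 z≤n) (trans (go n (f ∘ suc) (g ∘ suc) (λ k k≤n → f≡g (suc k) (s≤s k≤n))) (cong ι (sym (∑-head n (g ∘ suc))))))
    (sym (ι-+ (g 0) (∑ (suc n) (g ∘ suc))))

-- With J = n - k, the numerator (2J)! is cb J · J!², and one J! is C(J, k) · k! (n - 2k)!. The
-- bound on k makes J - k = n - 2k exact.
P-coefficient≡ : ∀ n k → 2 ℕ.* k ≤ n → P-coefficient n k ≡ ι (legendre-coefficient n k)
P-coefficient≡ n k 2k≤n = ∕-≡ (-1ℤ ^ k * + ((2 ℕ.* n ∸ 2 ℕ.* k) !)) (+ P-denominator n k) {{P-denominator≢0 n k}} (sym (begin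
  + (k ! ℕ.* J ! ℕ.* (n ∸ 2 ℕ.* k) !) * (-1ℤ ^ k * (cb J * B J k)) ≡⟨ cong (_* (-1ℤ ^ k * (cb J * B J k))) (trans (ℤ.pos-* (k ! ℕ.* J !) ((n ∸ 2 ℕ.* k) !)) (cong (_* + ((n ∸ 2 ℕ.* k) !)) (ℤ.pos-* (k !) (J !)))) ⟩
  + (k !) * + (J !) * + ((n ∸ 2 ℕ.* k) !) * (-1ℤ ^ k * (cb J * B J k)) ≡⟨ regroup (+ (k !)) (+ (J !)) (+ ((n ∸ 2 ℕ.* k) !)) (-1ℤ ^ k) (cb J) (B J k) ⟩
  -1ℤ ^ k * (cb J * (+ (J !) * (B J k * (+ (k !) * + ((n ∸ 2 ℕ.* k) !)))))
    ≡⟨ cong (λ u → -1ℤ ^ k * (cb J * (+ (J !) * u))) (trans (cong (λ j → B j k * (+ (k !) * + ((n ∸ 2 ℕ.* k) !))) (sym k+n∸2k≡J)) (trans (B*!*! k (n ∸ 2 ℕ.* k)) (cong (λ j → + (j !)) k+n∸2k≡J))) ⟩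
  -1ℤ ^ k * (cb J * (+ (J !) * + (J !))) ≡⟨ cong (_*_ (-1ℤ ^ k)) (trans (cong (λ j → B j J * (+ (J !) * + (J !))) 2J≡J+J) (trans (B*!*! J J) (cong (λ j → + (j !)) (sym 2J≡J+J)))) ⟩
  -1ℤ ^ k * + ((2 ℕ.* J) !) ≡⟨ cong (λ j → -1ℤ ^ k * + (j !)) (ℕ.*-distribˡ-∸ 2 n k) ⟩
  -1ℤ ^ k * + ((2 ℕ.* n ∸ 2 ℕ.* k) !) ∎))
  where
  open ≡-Reasoning
  J : ℕ
  J = n ∸ k
  2J≡J+J : 2 ℕ.* J ≡ J ℕ.+ J
  2J≡J+J = cong (J ℕ.+_) (ℕ.+-identityʳ J)
  k+n∸2k≡J : k ℕ.+ (n ∸ 2 ℕ.* k) ≡ J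
  k+n∸2k≡J = ℕ.+-cancelˡ-≡ k _ _ (trans (sym (ℕ.+-assoc k k (n ∸ 2 ℕ.* k))) (trans (cong (λ j → k ℕ.+ j ℕ.+ (n ∸ 2 ℕ.* k)) (sym (ℕ.+-identityʳ k)))
    (trans (ℕ.m+[n∸m]≡n 2k≤n) (sym (ℕ.m+[n∸m]≡n (ℕ.≤-trans (ℕ.m≤m+n k (k ℕ.+ 0)) 2k≤n))))))
  regroup : ∀ a b c s d e → a * b * c * (s * (d * e)) ≡ s * (d * (b * (e * (a * c))))
  regroup = solve-∀

P-even≡ : ∀ m x → P (2 ℕ.* m) (ι x) ≡ (+ 1 ∕[ + 2 ^ 2 ℕ.* m ]) ℚ.* ι (2^n*legendre (2 ℕ.* m) x)
P-even≡ m x = cong (ℚ._*_ (+ 1 ∕[ + 2 ^ n ])) (trans (cong (λ M → ∑≤ M f) ⌊n/2⌋≡m) (trans (∑≤-ι m term) (cong ι extend)))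
  where
  n : ℕ
  n = 2 ℕ.* m
  f : ℕ → ℚ
  f k = P-coefficient n k ℚ.* ι x ^ℚ (n ∸ 2 ℕ.* k)
  g : ℕ → ℤ
  g k = legendre-coefficient n k * x ^ (n ∸ 2 ℕ.* k)
  ⌊n/2⌋≡m : ⌊ n /2⌋ ≡ m
  ⌊n/2⌋≡m = trans (cong (λ k → ⌊ m ℕ.+ k /2⌋) (ℕ.+-identityʳ m)) (sym (ℕ.n≡⌊n+n/2⌋ m))
  term : ∀ k → k ≤ m → f k ≡ ι (g k)
  term k k≤m = trans (cong₂ ℚ._*_ (P-coefficient≡ n k (ℕ.*-monoʳ-≤ 2 k≤m)) (ι-^ x (n ∸ 2 ℕ.* k))) (sym (ι-* (legendre-coefficient n k) (x ^ (n ∸ 2 ℕ.* k))))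
  extend : ∑ (suc m) g ≡ ∑ (suc n) g
  extend = sym (trans (cong (λ k → ∑ (suc m ℕ.+ k) g) (ℕ.+-identityʳ m)) (trans (∑-split (suc m) m g) (trans (cong (_+_ (∑ (suc m) g))
    (∑-≡0 m (λ i _ → trans (cong (_* x ^ (n ∸ 2 ℕ.* (suc m ℕ.+ i))) (legendre-coefficient-above n (suc m ℕ.+ i) (ℕ.*-monoʳ-< 2 (ℕ.m≤m+n (suc m) i)))) (ℤ.*-zeroˡ (x ^ (n ∸ 2 ℕ.* (suc m ℕ.+ i)))))))
    (ℤ.+-identityʳ (∑ (suc m) g)))))

P-even[1+2u]≡ : ∀ m u → P (2 ℕ.* m) (ι (+ 1 + + 2 * u)) ≡ ι (shifted-legendre (2 ℕ.* m) u)
P-even[1+2u]≡ m u = *-ι-cancel ((+ 2) ^ n) {{i^n≢0 (+ 2) n}} (begin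
  P n (ι (+ 1 + + 2 * u)) ℚ.* ι ((+ 2) ^ n) ≡⟨ cong (ℚ._* ι ((+ 2) ^ n)) (trans (P-even≡ m (+ 1 + + 2 * u)) (cong (λ y → (+ 1 ∕[ + 2 ^ n ]) ℚ.* ι y) (2^n*legendre≡ n u))) ⟩
  (+ 1 ∕[ + 2 ^ n ]) ℚ.* ι ((+ 2) ^ n * shifted-legendre n u) ℚ.* ι ((+ 2) ^ n) ≡⟨ cong (λ y → (+ 1 ∕[ + 2 ^ n ]) ℚ.* y ℚ.* ι ((+ 2) ^ n)) (ι-* ((+ 2) ^ n) (shifted-legendre n u)) ⟩
  (+ 1 ∕[ + 2 ^ n ]) ℚ.* (ι ((+ 2) ^ n) ℚ.* ι (shifted-legendre n u)) ℚ.* ι ((+ 2) ^ n) ≡⟨ cong (ℚ._* ι ((+ 2) ^ n)) (trans (sym (ℚ.*-assoc (+ 1 ∕[ + 2 ^ n ]) (ι ((+ 2) ^ n)) (ι (shifted-legendre n u))))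
      (trans (cong (ℚ._* ι (shifted-legendre n u)) (∕-*-cancel (+ 1) ((+ 2) ^ n) {{i^n≢0 (+ 2) n}})) (ℚ.*-identityˡ (ι (shifted-legendre n u))))) ⟩
  ι (shifted-legendre n u) ℚ.* ι ((+ 2) ^ n) ∎)
  where
  open ≡-Reasoning
  n : ℕ
  n = 2 ℕ.* m

module SunCongruences (m : ℕ) (p-prime : Prime (suc (4 ℕ.* m))) where

  open LegendreCongruences m p-prime
  open IntegralRationals (4 ℕ.* m) p-prime

  central-square : ∀ k → + (((2 ℕ.* k) C k) ℕ.^ 2) ≡ cb k * cb k
  central-square k = trans (ℤ.pos-* c (c ℕ.* 1)) (cong₂ _*_ (sym (B≡C (2 ℕ.* k) k)) (trans (cong +_ (ℕ.*-identityʳ c)) (sym (B≡C (2 ℕ.* k) k))))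
    where
    c : ℕ
    c = (2 ℕ.* k) C k

  Unit-16 : Unit (- + 16)
  Unit-16 e = Unit-* Unit-4 Unit-4 (neg-≈ e)

  S₂↦X : (∑[ k ≤ n ] (+ (((2 ℕ.* k) C k) ℕ.^ 2) ∕[ - (+ 16) ^ k ])) ↦ X
  S₂↦X = ↦-≈ (∑-↦ n (λ k k≤n → ∕-↦ {{i^n≢0 (- (+ 16)) k}} (Unit-^ k Unit-16) (≈-trans (≈-reflexive (central-square k)) (≈-trans (cb²≈ k k≤n)
    (≈-reflexive (cong (_*_ ((- + 16) ^ k)) (trans (sym (ℤ.*-identityʳ (shifted-coefficient n k))) (cong (_*_ (shifted-coefficient n k)) (sym (ℤ.^-zeroˡ k))))))))))
    shifted-legendre[1]≈X

  -- As (-16)ᵏ = 8ᵏ (-2)ᵏ, dividing by 8ᵏ leaves the shifted Legendre sum at u = -2.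
  S₁↦X : (∑[ k ≤ n ] (+ (((2 ℕ.* k) C k) ℕ.^ 2) ∕[ + 8 ^ k ])) ↦ X
  S₁↦X = ↦-≈ (∑-↦ n (λ k k≤n → ∕-↦ {{i^n≢0 (+ 8) k}} (Unit-^ k (Unit-* Unit-4 Unit-2)) (≈-trans (≈-reflexive (central-square k)) (≈-trans (cb²≈ k k≤n)
    (≈-reflexive (trans (cong (_* shifted-coefficient n k) (^-distribʳ-* (+ 8) (- + 2) k)) (lemma ((+ 8) ^ k) ((- + 2) ^ k) (shifted-coefficient n k))))))))
    (≈-trans (≈-reflexive shifted-legendre[-2]≡) shifted-legendre[1]≈X)
    where
    lemma : ∀ a b c → a * b * c ≡ a * (c * b)
    lemma = solve-∀

  P[3]↦X : P n (ι (+ 3)) ↦ X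
  P[3]↦X = ↦-≈ (subst (_↦ shifted-legendre n (+ 1)) (sym (P-even[1+2u]≡ m (+ 1))) (ι-↦ (shifted-legendre n (+ 1)))) shifted-legendre[1]≈X

  %4≡1⇒≈1 : ∀ a → a %ℕ 4 ≡ 1 → a ≈ + 1 ⟨ + 4 ⟩
  %4≡1⇒≈1 a a≡1 = by (a /ℕ 4) (trans (a≡a%ℕn+[a/ℕn]*n a 4) (cong (λ r → + r + (a /ℕ 4) * + 4) a≡1))

  module _ (a b : ℤ) (p≡a²+b² : + p ≡ a ^ 2 + b ^ 2) (a≡1 : a %ℕ 4 ≡ 1) where

    private
      instance
        2a≢0 : ℤ.NonZero (+ 2 * a)
        2a≢0 = %4≡1⇒2*≢0 {a} a≡1

      a²+b²≡p : a * a + b * b ≡ + p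
      a²+b²≡p = sym (trans p≡a²+b² (cong₂ (λ u v → a * u + b * v) (ℤ.*-identityʳ a) (ℤ.*-identityʳ b)))

      s : ℤ
      s = -1ℤ ^ m

      a≈1 : a ≈ + 1 ⟨ + 4 ⟩
      a≈1 = %4≡1⇒≈1 a a≡1

      Unit-2a : Unit (+ 2 * a)
      Unit-2a = Unit-* Unit-2 (Unit-a a b a²+b²≡p a≈1)

    -- Clearing the denominator 2a leaves 2a X ≡ (-1)ᵐ (4a² - p), which is `X*2A≈` multiplied by
    -- (-1)ᵐ.
    R↦X : ι s ℚ.* (ι (+ 2 * a) ℚ.- (+ p ∕ (+ 2 * a))) ↦ X
    R↦X = record
      { denominator = + 2 * a
      ; numerator = s * (+ 2 * a * (+ 2 * a) - + p)
      ; unit = Unit-2a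
      ; fraction = trans (distrib (ι s) (ι (+ 2 * a)) (+ p ∕ (+ 2 * a))) (trans (cong (λ y → ι s ℚ.* (ι (+ 2 * a) ℚ.* ι (+ 2 * a) ℚ.- y)) (∕-*-cancel (+ p) (+ 2 * a)))
          (sym (trans (ι-* s (+ 2 * a * (+ 2 * a) - + p)) (cong (ℚ._*_ (ι s)) (trans (ι-− (+ 2 * a * (+ 2 * a)) (+ p)) (cong (ℚ._- ι (+ p)) (ι-* (+ 2 * a) (+ 2 * a))))))))
      ; congruence = begin
          s * (+ 2 * a * (+ 2 * a) - + p) ≡⟨ cong (λ u → s * (u - + p)) square ⟩
          s * (+ 2 * (s * a) * (+ 2 * (s * a)) - + p) ≈⟨ *-≈ˡ s (X*2A≈ a b a²+b²≡p a≈1) ⟨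
          s * (X * (+ 2 * (s * a))) ≡⟨ regroup s X a ⟩
          s * s * (+ 2 * a * X) ≡⟨ trans (cong (_* (+ 2 * a * X)) (-1^k*-1^k≡1 m)) (ℤ.*-identityˡ _) ⟩
          + 2 * a * X ∎
      }
      where
      open ≈-Reasoning (+ p * + p)
      open +-*-Solver using (solve; _:=_; _:*_; _:-_)
      distrib : ∀ s x y → s ℚ.* (x ℚ.- y) ℚ.* x ≡ s ℚ.* (x ℚ.* x ℚ.- y ℚ.* x)
      distrib = solve 3 (λ s x y → s :* (x :- y) :* x := s :* (x :* x :- y :* x)) refl
      square : + 2 * a * (+ 2 * a) ≡ + 2 * (s * a) * (+ 2 * (s * a))
      square = trans (sym (ℤ.*-identityˡ (+ 2 * a * (+ 2 * a)))) (trans (cong (_* (+ 2 * a * (+ 2 * a))) (sym (-1^k*-1^k≡1 m))) (regroup′ s a))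
        where
        regroup′ : ∀ s a → s * s * (+ 2 * a * (+ 2 * a)) ≡ + 2 * (s * a) * (+ 2 * (s * a))
        regroup′ = solve-∀
      regroup : ∀ s x a → s * (x * (+ 2 * (s * a))) ≡ s * s * (+ 2 * a * x)
      regroup = solve-∀

-- The quotients (p ∸ 1) / 2 and (p ∸ 1) / 4 do not reduce for a variable p. As variables n and h
-- with equations they, like p itself, can be matched with `refl`.
sun-congruences : ∀ p m → p ≡ suc (4 ℕ.* m) → Prime p → ∀ n h → n ≡ 2 ℕ.* m → h ≡ m →
    ∀ (a b : ℤ) → + p ≡ a ^ 2 + b ^ 2 → (a≡1 : a %ℕ 4 ≡ 1) →
    let S₁ = ∑[ k ≤ n ] (+ (((2 ℕ.* k) C k) ℕ.^ 2) ∕[ + 8 ^ k ])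
        S₂ = ∑[ k ≤ n ] (+ (((2 ℕ.* k) C k) ℕ.^ 2) ∕[ (- (+ 16)) ^ k ])
        R = ι (-1ℤ ^ h) ℚ.* (ι (+ 2 * a) ℚ.- (+ p ∕ (+ 2 * a)) {{%4≡1⇒2*≢0 {a} a≡1}})
    in (S₁ ≅ S₂ [mod p ^ 2 ]) × (S₂ ≅ P n (ι (+ 3)) [mod p ^ 2 ]) × (P n (ι (+ 3)) ≅ R [mod p ^ 2 ])
sun-congruences _ m refl p-prime _ _ refl refl a b p≡a²+b² a≡1 =
  ↦⇒≅ S₁↦X S₂↦X , ↦⇒≅ S₂↦X P[3]↦X , ↦⇒≅ P[3]↦X (R↦X a b p≡a²+b² a≡1)
  where
  open SunCongruences m p-prime
  open IntegralRationals (4 ℕ.* m) p-prime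

theorem2p9 : ∀ (p : ℕ) → Prime p → p % 4 ≡ 1 →
    ∀ (a b : ℤ) → + p ≡ a ℤ.^ 2 ℤ.+ b ℤ.^ 2 → (a≡1 : a %ℕ 4 ≡ 1) →
    let n  = (p ∸ 1) / 2
        S₁ = ∑[ k ≤ n ] (+ (((2 ℕ.* k) C k) ℕ.^ 2) ∕[ + 8 ^ k ])
        S₂ = ∑[ k ≤ n ] (+ (((2 ℕ.* k) C k) ℕ.^ 2) ∕[ (- (+ 16)) ^ k ])
        R  = ι (-1ℤ ℤ.^ ((p ∸ 1) / 4)) ℚ.* (ι (+ 2 ℤ.* a) ℚ.- (+ p ∕ (+ 2 ℤ.* a)) {{%4≡1⇒2*≢0 {a} a≡1}})
    in (S₁ ≅ S₂ [mod p ^ 2 ]) × (S₂ ≅ P n (ι (+ 3)) [mod p ^ 2 ]) × (P n (ι (+ 3)) ≅ R [mod p ^ 2 ])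
theorem2p9 p p-prime p%4≡1 = sun-congruences p m p≡1+4m p-prime ((p ∸ 1) / 2) ((p ∸ 1) / 4)
  (trans (cong (λ k → (k ∸ 1) / 2) p≡1+4m) (trans (cong (_/ 2) (4m≡2m*2 m)) (m*n/n≡m (2 ℕ.* m) 2)))
  (trans (cong (λ k → (k ∸ 1) / 4) p≡1+4m) (trans (cong (_/ 4) (ℕ.*-comm 4 m)) (m*n/n≡m m 4)))
  where
  m : ℕ
  m = p / 4
  p≡1+4m : p ≡ suc (4 ℕ.* m)
  p≡1+4m = trans (m≡m%n+[m/n]*n p 4) (trans (cong (ℕ._+ m ℕ.* 4) p%4≡1) (cong suc (ℕ.*-comm m 4)))
  4m≡2m*2 : ∀ m → 4 ℕ.* m ≡ 2 ℕ.* m ℕ.* 2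
  4m≡2m*2 = ℕ-solve-∀
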